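{- Let $F=\prod_{i\in I}\mathbb{F}_{q_i}/\mathcal{U}$ be a pseudofinite field and $A=\prod_{i\in I}A_i/\mathcal{U}$ an infinite internal subset of $F$. Suppose there is a positive constant $C$ such that $\{i\in I:|A_i|\le C\log_2 q_i\}\in\mathcal{U}$. Then all internal subsets of $A$ are uniformly definable: there is a formula $\theta(x,\bar y)$ in the language of rings expanded by a unary predicate interpreted as $A$ such that for every internal subset $E\subseteq A$ there is a tuple $\bar c$ from $F$ with $E=\{a\in F:(F,A)\models\theta(a,\bar c)\}$.
   Context: $\mathcal{U}$ is a non-principal ultrafilter on $I$, each $\mathbb{F}_{q_i}$ a finite field, $A_i\subseteq\mathbb{F}_{q_i}$. A subset of $F$ is internal if it is of the form $\prod_{i\in I}E_i/\mathcal{U}$ with $E_i\subseteq\mathbb{F}_{q_i}$. -}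

module Defs where

open import Level using (0ℓ)
open import Algebra.Bundles using (RawRing)
open import Algebra.Structures using (IsCommutativeRing)
open import Data.Empty using (⊥)
open import Data.Fin.Base using (Fin)
open import Data.Fin.Subset using (Subset) renaming (_∈_ to _∈ˢ_)
open import Data.Integer.Base using () renaming (∣_∣ to ∣_∣ℤ)
open import Data.List.Base using (List)
open import Data.List.Relation.Unary.Any using (Any)
open import Data.Nat.Base as ℕ using (ℕ; zero; suc)
open import Data.Product.Base using (Σ; ∃; ∃-syntax; _×_; _,_)
open import Data.Rational.Base as ℚ using (ℚ; 0ℚ; ↥_; ↧ₙ_)
open import Data.Sum.Base using (_⊎_)
open import Data.Unit.Base using (⊤)
open import Data.Vec.Base using (Vec; []; _∷_; lookup)
open import Function.Bundles using (_⇔_; _↔_; Inverse)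
open import Relation.Binary.PropositionalEquality.Core using (_≡_; _≢_)
open import Relation.Nullary.Negation.Core using (¬_)
open import Relation.Unary using (Pred; _∈_; _⊆_; _∩_; ∁; ∅; U)

-- Real numbers as two-sided Dedekind cuts of ℚ.
record ℝ : Set₁ where
  field
    lower upper     : Pred ℚ 0ℓ
    lower-inhabited : ∃[ p ] p ∈ lower
    upper-inhabited : ∃[ r ] r ∈ upper
    lower-rounded   : ∀ p → p ∈ lower ⇔ (∃[ r ] p ℚ.< r × r ∈ lower)
    upper-rounded   : ∀ r → r ∈ upper ⇔ (∃[ p ] p ℚ.< r × p ∈ upper)
    disjoint        : ∀ p → ¬ (p ∈ lower × p ∈ upper)
    located         : ∀ p r → p ℚ.< r → p ∈ lower ⊎ r ∈ upper

Positive : ℝ → Set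
Positive C = 0ℚ ∈ ℝ.lower C

-- n ≤ C · log₂ q, for C > 0 and q ≥ 1.  Since log₂ q ≥ 0, this says that
-- n ≤ (a / b) · log₂ q, i.e. 2 ^ (n b) ≤ q ^ a, for all rationals a / b > C.
infix 4 _≤_·log₂_
_≤_·log₂_ : ℕ → ℝ → ℕ → Set
n ≤ C ·log₂ q = ∀ r → r ∈ ℝ.upper C → 2 ℕ.^ (n ℕ.* ↧ₙ r) ℕ.≤ q ℕ.^ ∣ ↥ r ∣ℤ

record Ultrafilter (I : Set) : Set₁ where
  field
    Large      : Pred I 0ℓ → Set
    large-U    : Large U
    large-⊆    : ∀ {S T : Pred I 0ℓ} → S ⊆ T → Large S → Large T
    large-∩    : ∀ {S T : Pred I 0ℓ} → Large S → Large T → Large (S ∩ T)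
    ¬large-∅   : ¬ Large ∅
    large-or-∁ : ∀ (S : Pred I 0ℓ) → Large S ⊎ Large (∁ S)

open Ultrafilter public using (Large)

NonPrincipal : ∀ {I} → Ultrafilter I → Set
NonPrincipal 𝓤 = ∀ i → ¬ Large 𝓤 (_≡ i)

record FiniteField : Set₁ where
  infix  8 -_
  infixl 7 _*_
  infixl 6 _+_
  field
    Carrier           : Set
    _+_ _*_           : Carrier → Carrier → Carrier
    -_                : Carrier → Carrier
    0# 1#             : Carrier
    isCommutativeRing : IsCommutativeRing _≡_ _+_ _*_ -_ 0# 1#
    0≢1               : 0# ≢ 1#
    inverse           : ∀ x → x ≢ 0# → ∃[ y ] x * y ≡ 1#
    order             : ℕ
    enumeration       : Carrier ↔ Fin order

  index : Carrier → Fin order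
  index = Inverse.to enumeration

  rawRing : RawRing 0ℓ 0ℓ
  rawRing = record
    { Carrier = Carrier ; _≈_ = _≡_
    ; _+_ = _+_ ; _*_ = _*_ ; -_ = -_ ; 0# = 0# ; 1# = 1# }

-- A subset of K is given by the indices of its elements in the enumeration
-- of K, so that its cardinality is the one of Data.Fin.Subset.
SubsetOf : FiniteField → Set
SubsetOf K = Subset (FiniteField.order K)

-- First-order formulas over the language of rings expanded by a family P of
-- unary predicate symbols, with free variables among n de Bruijn indices.
data Term (n : ℕ) : Set where
  var     : Fin n → Term n
  _⊕_ _⊗_ : Term n → Term n → Term n
  ⊖_      : Term n → Term n
  𝟎 𝟏     : Term n

data Formula (P : Set) (n : ℕ) : Set where
  _≐_         : Term n → Term n → Formula P n
  pred        : P → Term n → Formula P n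
  ⊥̇           : Formula P n
  _∧̇_ _∨̇_ _⇒̇_ : Formula P n → Formula P n → Formula P n
  ∀̇_ ∃̇_       : Formula P (suc n) → Formula P n

module Semantics (R : RawRing 0ℓ 0ℓ) {P : Set}
                 (⟦_⟧ : P → Pred (RawRing.Carrier R) 0ℓ) where
  open RawRing R

  eval : ∀ {n} → Vec Carrier n → Term n → Carrier
  eval ρ (var x) = lookup ρ x
  eval ρ (s ⊕ t) = eval ρ s + eval ρ t
  eval ρ (s ⊗ t) = eval ρ s * eval ρ t
  eval ρ (⊖ t)   = - eval ρ t
  eval ρ 𝟎       = 0#
  eval ρ 𝟏       = 1#

  Sat : ∀ {n} → Formula P n → Vec Carrier n → Set
  Sat (s ≐ t)    ρ = eval ρ s ≈ eval ρ t
  Sat (pred p t) ρ = eval ρ t ∈ ⟦ p ⟧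
  Sat ⊥̇          ρ = ⊥
  Sat (φ ∧̇ ψ)    ρ = Sat φ ρ × Sat ψ ρ
  Sat (φ ∨̇ ψ)    ρ = Sat φ ρ ⊎ Sat ψ ρ
  Sat (φ ⇒̇ ψ)    ρ = Sat φ ρ → Sat ψ ρ
  Sat (∀̇ φ)      ρ = ∀ x → Sat φ (x ∷ ρ)
  Sat (∃̇ φ)      ρ = ∃[ x ] Sat φ (x ∷ ρ)

RingSentence : Set
RingSentence = Formula ⊥ 0

_⊨ᵣ_ : RawRing 0ℓ 0ℓ → RingSentence → Set
R ⊨ᵣ σ = Semantics.Sat R (λ ()) σ []

RingFormulaWithPredicate : ℕ → Set
RingFormulaWithPredicate = Formula ⊤

infix 4 ⟨_,_⟩⊨_[_]
⟨_,_⟩⊨_[_] : (R : RawRing 0ℓ 0ℓ) → Pred (RawRing.Carrier R) 0ℓ →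
             ∀ {n} → RingFormulaWithPredicate n → Vec (RawRing.Carrier R) n → Set
⟨ R , A ⟩⊨ θ [ ρ ] = Semantics.Sat R (λ _ → A) θ ρ

Infinite : (R : RawRing 0ℓ 0ℓ) → Pred (RawRing.Carrier R) 0ℓ → Set
Infinite R S = ¬ (Σ (List Carrier) λ xs → ∀ x → x ∈ S → Any (x ≈_) xs)
  where open RawRing R

-- An infinite model of the theory of finite fields (the field axioms are
-- among the sentences σ).
Pseudofinite : RawRing 0ℓ 0ℓ → Set₁
Pseudofinite R =
  Infinite R U ×
  (∀ (σ : RingSentence) → (∀ K → FiniteField.rawRing K ⊨ᵣ σ) → R ⊨ᵣ σ)

module _ {I : Set} (𝓤 : Ultrafilter I) (K : I → FiniteField) where

  private module K i = FiniteField (K i)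

  -- The quotient by 𝓤 is expressed by the equality _≈_.
  ultraproduct : RawRing 0ℓ 0ℓ
  ultraproduct = record
    { Carrier = ∀ i → K.Carrier i
    ; _≈_     = λ x y → Large 𝓤 (λ i → x i ≡ y i)
    ; _+_     = λ x y i → K._+_ i (x i) (y i)
    ; _*_     = λ x y i → K._*_ i (x i) (y i)
    ; -_      = λ x i → K.-_ i (x i)
    ; 0#      = λ i → K.0# i
    ; 1#      = λ i → K.1# i
    }

  ultraproductSubset : (∀ i → SubsetOf (K i)) → Pred (RawRing.Carrier ultraproduct) 0ℓ
  ultraproductSubset E x = Large 𝓤 (λ i → K.index i (x i) ∈ˢ E i)

  Internal : Pred (RawRing.Carrier ultraproduct) 0ℓ → Set
  Internal S = ∃[ E ] (∀ x → x ∈ S ⇔ x ∈ ultraproductSubset E)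

{-# OPTIONS --safe #-}
-- A definable family of ± 1-valued functions F c on a set of n elements realises
-- every sign pattern s as soon as the correlations ∑_c ∏_{x ∈ S} F c x, S ≠ ∅,
-- are smaller than 2 ^ - n times the number of parameters: expand the sum over c
-- of ∏ (1 + s x · F c x).  Taking the product of m independent copies of F raises
-- the correlations to the m-th power.  As n = O(log q), it therefore suffices
-- that the relative correlations are at most q ^ - δ for some fixed δ > 0, and a
-- family with this property is definable in the language of rings:
-- * in odd characteristic, whether x + d is a square.  The correlation is a sum
--   of the quadratic character over the values of ∏ (X + x), which is bounded by
--   Stepanov's method;
-- * in characteristic two, whether y / (x + d) has the form z² + z.  The sum over
--   y vanishes unless ∑ 1 / (x + d) = 0, which holds for few d only.
-- Łoś's theorem transfers the resulting formula to the ultraproduct.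

module Submission where

open import Defs
open import Level using (0ℓ)
open import Algebra.Bundles using (RawRing; CommutativeRing)
open import Data.Fin.Subset using (∣_∣)
open import Data.Nat.Base using (ℕ; suc)
open import Data.Product.Base using (Σ-syntax; ∃-syntax; _×_)
open import Data.Vec.Base using (Vec; _∷_)
open import Function.Bundles using (_⇔_)
open import Relation.Unary using (Pred; _∈_; _⊆_)

open import Algebra.Properties.AbelianGroup using (⁻¹-∙-comm)
import Algebra.Properties.Ring as RingProperties
import Algebra.Properties.CommutativeSemiring.Exp as Exp
import Algebra.Properties.Semiring.Mult.TCOptimised as Mult
import Algebra.Solver.Ring as RingSolver
open import Algebra.Solver.Ring.AlmostCommutativeRing using (fromCommutativeRing; _-Raw-AlmostCommutative⟶_)
open import Data.Bool.Base using (Bool; true; false; not)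
import Data.Bool.Properties as Bool
open import Data.Empty using (⊥)
open import Data.Fin.Base as Fin using (Fin; zero; suc; toℕ; fromℕ<; combine; remQuot; finToFun; funToFin)
import Data.Fin.Properties as Fin
import Data.Fin.Subset as Subset
import Data.Fin.Subset.Properties as Subset
open import Data.Integer.Base as ℤ using (ℤ; -[1+_]) renaming (+_ to pos)
import Data.Integer.Properties as ℤ
open import Data.List.Base using (List; []; _∷_; _++_; length; map; foldr; filter; replicate; tabulate; allFin; concatMap; applyUpTo; cartesianProduct; cartesianProductWith)
import Data.List.Properties as List
open import Data.List.Membership.Propositional using () renaming (_∈_ to _∈ˡ_)
import Data.List.Membership.Propositional.Properties as Mem
open import Data.List.Membership.Propositional.Properties.WithK using (unique∧set⇒bag)
open import Data.List.Relation.Binary.BagAndSetEquality using (∼bag⇒↭)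
open import Data.List.Relation.Binary.Permutation.Propositional using (_↭_; ↭⇒↭ₛ)
import Data.List.Relation.Binary.Permutation.Propositional.Properties as Perm
import Data.List.Relation.Binary.Permutation.Setoid.Properties as PermSetoid
open import Data.List.Relation.Binary.Sublist.Propositional using ([]; _∷_; _∷ʳ_) renaming (_⊆_ to _⊑_)
import Data.List.Relation.Binary.Sublist.Propositional.Properties as Sublist
open import Data.List.Relation.Unary.All as All using (All; []; _∷_)
import Data.List.Relation.Unary.All.Properties as All
open import Data.List.Relation.Unary.AllPairs using ([]; _∷_)
open import Data.List.Relation.Unary.Any as Any using (Any; here; there)
import Data.List.Relation.Unary.Any.Properties as Any
open import Data.List.Relation.Unary.Unique.Propositional using (Unique)
import Data.List.Relation.Unary.Unique.Propositional.Properties as Unique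
open import Data.Maybe.Base using (Maybe; just; nothing)
open import Data.Nat.Base as ℕ using (zero; z≤n; s≤s; _≤_; _<_; _∸_; _^_)
import Data.Nat.DivMod as ℕ
import Data.Nat.Properties as ℕ
open import Data.Nat.Solver using (module +-*-Solver)
open import Data.Product.Base using (∃; _,_; proj₁; proj₂)
open import Data.Rational.Base using (↥_; ↧ₙ_)
open import Data.Sum.Base using (_⊎_; inj₁; inj₂; [_,_]′)
open import Data.Unit.Base using (⊤; tt)
open import Data.Vec.Base as Vec using ([]; lookup)
import Data.Vec.Properties as Vec
open import Function.Base using (_∘_; id; case_of_)
open import Function.Bundles using (Equivalence; Inverse; mk⇔)
open import Relation.Binary.PropositionalEquality using (_≡_; _≢_; _≗_; refl; sym; trans; cong; cong₂; subst; subst₂; setoid; module ≡-Reasoning)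
open import Relation.Nullary.Decidable as Dec using (Dec; yes; no; does; ¬?; _×-dec_; _⊎-dec_; _→-dec_; map′)
open import Relation.Nullary.Negation using (¬_; contradiction)

-- A set of size n ≤ C log₂ q has 2 ^ n subsets, which is polynomial in q. Hence a saving by any
-- fixed power of q per copy suffices, and the number of copies depends on C alone; this is why a
-- single formula serves all internal subsets. Two obstacles shape the use of Stepanov's method.
-- Derivatives lose information in positive characteristic, so a high order of vanishing at t is
-- expressed by substituting t + f(t) V for X and truncating in V. The field is given only by its
-- axioms and an enumeration, so the Frobenius identity and Euler's criterion are derived by
-- counting roots instead of through the characteristic. The auxiliary polynomial is likewise found
-- by counting: two coefficient vectors whose expansions coincide play the part of a nonzero
-- solution of a linear system. In characteristic two every element is a square, which forces
-- another family there. All estimates are multiplied out, so that biases, which are fractions,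
-- appear as inequalities between natural numbers.

-- Normalisation in commutative rings with integer coefficients

module IntegerSolver (R : CommutativeRing 0ℓ 0ℓ) where
  open CommutativeRing R hiding (zero; setoid) renaming (refl to ≈-refl; sym to ≈-sym; trans to ≈-trans)
  open Mult semiring using (×-homo-+; ×1-homo-*; 1+×) renaming (_×_ to _·_)
  open RingProperties ring using (-0#≈0#; -‿distribˡ-*; -‿involutive)
  open import Relation.Binary.Reasoning.Setoid (CommutativeRing.setoid R)

  fromℤ : ℤ → Carrier
  fromℤ (pos n)    = n · 1#
  fromℤ -[1+ n ] = - (suc n · 1#)

  private
    -‿homo : ∀ i → fromℤ (ℤ.- i) ≈ - fromℤ i
    -‿homo (pos zero)  = ≈-sym -0#≈0#
    -‿homo (pos (suc n)) = ≈-refl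
    -‿homo -[1+ n ]  = ≈-sym (-‿involutive _)

    cancel : ∀ x y z → (x + y) - (x + z) ≈ y - z
    cancel x y z = begin
      (x + y) - (x + z)       ≈⟨ +-congˡ (⁻¹-∙-comm +-abelianGroup x z) ⟨
      (x + y) + (- x + - z)   ≈⟨ +-congʳ (+-comm x y) ⟩
      (y + x) + (- x + - z)   ≈⟨ +-assoc y x _ ⟩
      y + (x + (- x + - z))   ≈⟨ +-congˡ (+-assoc x (- x) (- z)) ⟨
      y + ((x - x) + - z)     ≈⟨ +-congˡ (+-congʳ (-‿inverseʳ x)) ⟩
      y + (0# + - z)          ≈⟨ +-congˡ (+-identityˡ _) ⟩
      y - z                   ∎

    ⊖-homo : ∀ m n → fromℤ (m ℤ.⊖ n) ≈ m · 1# - n · 1#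
    ⊖-homo m zero = ≈-sym (≈-trans (+-congˡ -0#≈0#) (+-identityʳ _))
    ⊖-homo zero (suc n) = ≈-sym (+-identityˡ _)
    ⊖-homo (suc m) (suc n) = begin
      fromℤ (suc m ℤ.⊖ suc n)         ≡⟨ cong fromℤ (ℤ.[1+m]⊖[1+n]≡m⊖n m n) ⟩
      fromℤ (m ℤ.⊖ n)                 ≈⟨ ⊖-homo m n ⟩
      m · 1# - n · 1#                 ≈⟨ cancel 1# _ _ ⟨
      (1# + m · 1#) - (1# + n · 1#)   ≈⟨ +-cong (1+× m 1#) (-‿cong (1+× n 1#)) ⟨
      suc m · 1# - suc n · 1#         ∎

    +-homo : ∀ i j → fromℤ (i ℤ.+ j) ≈ fromℤ i + fromℤ j
    +-homo (pos m)    (pos n)    = ×-homo-+ 1# m n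
    +-homo (pos m)    -[1+ n ] = ⊖-homo m (suc n)
    +-homo -[1+ m ] (pos n)    = begin
      fromℤ (n ℤ.⊖ suc m)     ≈⟨ ⊖-homo n (suc m) ⟩
      n · 1# - suc m · 1#     ≈⟨ +-comm _ _ ⟩
      - (suc m · 1#) + n · 1# ∎
    +-homo -[1+ m ] -[1+ n ] = begin
      - (suc (suc (m ℕ.+ n)) · 1#)      ≡⟨ cong (λ k → - (k · 1#)) (ℕ.+-suc (suc m) n) ⟨
      - ((suc m ℕ.+ suc n) · 1#)        ≈⟨ -‿cong (×-homo-+ 1# (suc m) (suc n)) ⟩
      - (suc m · 1# + suc n · 1#)       ≈⟨ ⁻¹-∙-comm +-abelianGroup _ _ ⟨
      - (suc m · 1#) + - (suc n · 1#)   ∎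

    *-homo⁺ : ∀ m n → fromℤ (pos m ℤ.* pos n) ≈ m · 1# * n · 1#
    *-homo⁺ m n = begin
      fromℤ (pos m ℤ.* pos n) ≡⟨ cong fromℤ (ℤ.pos-* m n) ⟨
      (m ℕ.* n) · 1#      ≈⟨ ×1-homo-* m n ⟩
      m · 1# * n · 1#     ∎

    *-homo⁺ʳ : ∀ m j → fromℤ (pos m ℤ.* j) ≈ m · 1# * fromℤ j
    *-homo⁺ʳ m (pos n)    = *-homo⁺ m n
    *-homo⁺ʳ m -[1+ n ] = begin
      fromℤ (pos m ℤ.* -[1+ n ])        ≡⟨ cong fromℤ (ℤ.neg-distribʳ-* (pos m) (pos (suc n))) ⟨
      fromℤ (ℤ.- (pos m ℤ.* pos (suc n)))   ≈⟨ -‿homo (pos m ℤ.* pos (suc n)) ⟩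
      - fromℤ (pos m ℤ.* pos (suc n))       ≈⟨ -‿cong (*-homo⁺ m (suc n)) ⟩
      - (m · 1# * suc n · 1#)         ≈⟨ RingProperties.-‿distribʳ-* ring _ _ ⟩
      m · 1# * - (suc n · 1#)         ∎

    *-homo : ∀ i j → fromℤ (i ℤ.* j) ≈ fromℤ i * fromℤ j
    *-homo (pos m)    j = *-homo⁺ʳ m j
    *-homo -[1+ m ] j = begin
      fromℤ (-[1+ m ] ℤ.* j)        ≡⟨ cong fromℤ (ℤ.neg-distribˡ-* (pos (suc m)) j) ⟨
      fromℤ (ℤ.- (pos (suc m) ℤ.* j))   ≈⟨ -‿homo (pos (suc m) ℤ.* j) ⟩
      - fromℤ (pos (suc m) ℤ.* j)       ≈⟨ -‿cong (*-homo⁺ʳ (suc m) j) ⟩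
      - (suc m · 1# * fromℤ j)      ≈⟨ -‿distribˡ-* _ _ ⟩
      - (suc m · 1#) * fromℤ j      ∎

    morphism : ℤ.+-*-rawRing -Raw-AlmostCommutative⟶ fromCommutativeRing R
    morphism = record
      { ⟦_⟧ = fromℤ ; +-homo = +-homo ; *-homo = *-homo ; -‿homo = -‿homo
      ; 0-homo = ≈-refl ; 1-homo = ≈-refl }

    -- Coefficients are compared in ℤ, whatever the characteristic. Identities that rest on 1 + 1 =
    -- 0 are therefore left to separate steps such as `x+x≡0`.
    _coeff≟_ : ∀ i j → Maybe (fromℤ i ≈ fromℤ j)
    i coeff≟ j with i ℤ.≟ j
    ... | yes refl = just ≈-refl
    ... | no _     = nothing

  open RingSolver ℤ.+-*-rawRing (fromCommutativeRing R) morphism _coeff≟_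
    public using (solve; _:=_; _:+_; _:*_; _:-_; :-_; con)

-- Patterns of signs and their correlations

module _ {X : Set} where

  ∑ ∏ : List X → (X → ℤ) → ℤ
  ∑ []       f = pos 0
  ∑ (x ∷ xs) f = f x ℤ.+ ∑ xs f
  ∏ []       f = pos 1
  ∏ (x ∷ xs) f = f x ℤ.* ∏ xs f

  ∑-cong : ∀ {f g} xs → f ≗ g → ∑ xs f ≡ ∑ xs g
  ∑-cong []       f≗g = refl
  ∑-cong (x ∷ xs) f≗g = cong₂ ℤ._+_ (f≗g x) (∑-cong xs f≗g)

  ∏-cong : ∀ {f g} xs → (∀ x → x ∈ˡ xs → f x ≡ g x) → ∏ xs f ≡ ∏ xs g
  ∏-cong []       f≗g = refl
  ∏-cong (x ∷ xs) f≗g = cong₂ ℤ._*_ (f≗g x (here refl)) (∏-cong xs (λ y → f≗g y ∘ there))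

  ∑-+ : ∀ f g xs → ∑ xs (λ x → f x ℤ.+ g x) ≡ ∑ xs f ℤ.+ ∑ xs g
  ∑-+ f g []       = refl
  ∑-+ f g (x ∷ xs) = trans (cong (λ z → f x ℤ.+ g x ℤ.+ z) (∑-+ f g xs)) (solve 4 (λ a b c d →
    a :+ b :+ (c :+ d) := a :+ c :+ (b :+ d)) refl (f x) (g x) (∑ xs f) (∑ xs g))
    where open IntegerSolver ℤ.+-*-commutativeRing

  ∏-* : ∀ f g xs → ∏ xs (λ x → f x ℤ.* g x) ≡ ∏ xs f ℤ.* ∏ xs g
  ∏-* f g []       = refl
  ∏-* f g (x ∷ xs) = trans (cong (λ z → f x ℤ.* g x ℤ.* z) (∏-* f g xs)) (solve 4 (λ a b c d →
    a :* b :* (c :* d) := a :* c :* (b :* d)) refl (f x) (g x) (∏ xs f) (∏ xs g))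
    where open IntegerSolver ℤ.+-*-commutativeRing

  ∑-*ˡ : ∀ c f xs → ∑ xs (λ x → c ℤ.* f x) ≡ c ℤ.* ∑ xs f
  ∑-*ˡ c f []       = sym (ℤ.*-zeroʳ c)
  ∑-*ˡ c f (x ∷ xs) = trans (cong (λ z → c ℤ.* f x ℤ.+ z) (∑-*ˡ c f xs)) (sym (ℤ.*-distribˡ-+ c (f x) (∑ xs f)))

  ∑-++ : ∀ f xs ys → ∑ (xs ++ ys) f ≡ ∑ xs f ℤ.+ ∑ ys f
  ∑-++ f []       ys = sym (ℤ.+-identityˡ _)
  ∑-++ f (x ∷ xs) ys = trans (cong (ℤ._+_ (f x)) (∑-++ f xs ys)) (sym (ℤ.+-assoc (f x) _ _))

  ∑-const : ∀ c xs → ∑ xs (λ _ → c) ≡ pos (length xs) ℤ.* c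
  ∑-const c []       = refl
  ∑-const c (x ∷ xs) = trans (cong (ℤ._+_ c) (∑-const c xs)) (sym (ℤ.suc-* (pos (length xs)) c))

  ∑-nonzero : ∀ f xs → ∑ xs f ≢ pos 0 → ∃[ x ] f x ≢ pos 0
  ∑-nonzero f []       ≢0 = contradiction refl ≢0
  ∑-nonzero f (x ∷ xs) ≢0 with f x ℤ.≟ pos 0
  ... | no fx≢0 = x , fx≢0
  ... | yes fx≡0 = ∑-nonzero f xs λ s≡0 → ≢0 (cong₂ ℤ._+_ fx≡0 s≡0)

  ∏-nonzero : ∀ {f x} xs → ∏ xs f ≢ pos 0 → x ∈ˡ xs → f x ≢ pos 0
  ∏-nonzero {f} (x ∷ xs) ≢0 (here refl) fx≡0 = ≢0 (cong (ℤ._* ∏ xs f) fx≡0)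
  ∏-nonzero {f} (x ∷ xs) ≢0 (there y∈xs) = ∏-nonzero {f} xs (λ p≡0 → ≢0 (trans (cong (f x ℤ.*_) p≡0) (ℤ.*-zeroʳ (f x)))) y∈xs

  ∑-↭ : ∀ f {xs ys} → xs ↭ ys → ∑ xs f ≡ ∑ ys f
  ∑-↭ f {xs} {ys} xs↭ys = begin
    ∑ xs f                         ≡⟨ ∑-foldr xs ⟩
    foldr ℤ._+_ (pos 0) (map f xs)   ≡⟨ foldr-commMonoid ℤ.+-0-isCommutativeMonoid (↭⇒↭ₛ (Perm.map⁺ f xs↭ys)) ⟩
    foldr ℤ._+_ (pos 0) (map f ys)   ≡⟨ ∑-foldr ys ⟨
    ∑ ys f                         ∎
    where open ≡-Reasoning
          open PermSetoid (setoid ℤ) using (foldr-commMonoid)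
          ∑-foldr : ∀ xs → ∑ xs f ≡ foldr ℤ._+_ (pos 0) (map f xs)
          ∑-foldr []       = refl
          ∑-foldr (x ∷ xs) = cong (ℤ._+_ (f x)) (∑-foldr xs)

  ∑-bound : ∀ f c {b} {B : X → Set b} (B? : ∀ x → Dec (B x)) xs → (∀ x → ℤ.∣ f x ∣ ≤ c) →
            (∀ x → ¬ B x → f x ≡ pos 0) → ℤ.∣ ∑ xs f ∣ ≤ length (filter B? xs) ℕ.* c
  ∑-bound f c B? []       f≤c f≡0 = z≤n
  ∑-bound f c B? (x ∷ xs) f≤c f≡0 with B? x
  ... | yes _ = ℕ.≤-trans (ℤ.∣i+j∣≤∣i∣+∣j∣ (f x) _) (ℕ.+-mono-≤ (f≤c x) (∑-bound f c B? xs f≤c f≡0))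
  ... | no ¬b = subst (λ z → ℤ.∣ z ∣ ≤ _) (sym (trans (cong (ℤ._+ ∑ xs f) (f≡0 x ¬b)) (ℤ.+-identityˡ (∑ xs f))))
                      (∑-bound f c B? xs f≤c f≡0)

∑-map : ∀ {X Y : Set} (g : X → Y) f xs → ∑ (map g xs) f ≡ ∑ xs (f ∘ g)
∑-map g f []       = refl
∑-map g f (x ∷ xs) = cong (ℤ._+_ (f (g x))) (∑-map g f xs)

∑-cartesian : ∀ {X Y Z : Set} (g : X → Y → Z) f xs ys →
              ∑ (cartesianProductWith g xs ys) f ≡ ∑ xs (λ x → ∑ ys (λ y → f (g x y)))
∑-cartesian g f []       ys = refl
∑-cartesian g f (x ∷ xs) ys =
  trans (∑-++ f (map (g x) ys) _) (cong₂ ℤ._+_ (∑-map (g x) f ys) (∑-cartesian g f xs ys))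

∑-swap : ∀ {X Y : Set} (f : X → Y → ℤ) xs ys →
         ∑ xs (λ x → ∑ ys (f x)) ≡ ∑ ys (λ y → ∑ xs (λ x → f x y))
∑-swap f []       ys = sym (trans (∑-const (pos 0) ys) (ℤ.*-zeroʳ (pos (length ys))))
∑-swap f (x ∷ xs) ys = trans (cong (ℤ._+_ (∑ ys (f x))) (∑-swap f xs ys)) (sym (∑-+ (f x) _ ys))

∣^∣ : ∀ i m → ℤ.∣ i ℤ.^ m ∣ ≡ ℤ.∣ i ∣ ^ m
∣^∣ i zero    = refl
∣^∣ i (suc m) = trans (ℤ.abs-* i (i ℤ.^ m)) (cong (ℤ.∣ i ∣ ℕ.*_) (∣^∣ i m))

sg : Bool → ℤ
sg true  = pos 1
sg false = -[1+ 0 ]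

infixr 6 _⇔ᵇ_
_⇔ᵇ_ : Bool → Bool → Bool
true  ⇔ᵇ c = c
false ⇔ᵇ c = not c

sg-⇔ᵇ : ∀ b c → sg (b ⇔ᵇ c) ≡ sg b ℤ.* sg c
sg-⇔ᵇ true  true  = refl
sg-⇔ᵇ true  false = refl
sg-⇔ᵇ false true  = refl
sg-⇔ᵇ false false = refl

∣sg∣ : ∀ b → ℤ.∣ sg b ∣ ≡ 1
∣sg∣ true  = refl
∣sg∣ false = refl

sg-agree : ∀ b c → pos 1 ℤ.+ sg b ℤ.* sg c ≢ pos 0 → c ≡ b
sg-agree true  true  _  = refl
sg-agree true  false ≢0 = contradiction refl ≢0
sg-agree false true  ≢0 = contradiction refl ≢0
sg-agree false false _  = refl

^-distribʳ-* : ∀ m a b → (a ℕ.* b) ^ m ≡ a ^ m ℕ.* b ^ m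
^-distribʳ-* zero    a b = refl
^-distribʳ-* (suc m) a b = trans (cong (λ z → a ℕ.* b ℕ.* z) (^-distribʳ-* m a b))
  (solve 4 (λ a b c d → a :* b :* (c :* d) := a :* c :* (b :* d)) refl a b (a ^ m) (b ^ m))
  where open +-*-Solver

module _ {X Y : Set} (β : Y → X → Bool) where

  -- Since `sg` turns `_⇔ᵇ_` into multiplication, this is the product of m independent tests, one
  -- for each entry of the tuple.
  iff-chain : ∀ {m} → Vec Y m → X → Bool
  iff-chain []      x = true
  iff-chain (y ∷ c) x = β y x ⇔ᵇ iff-chain c x

module _ {X Y : Set} (Ω : List Y) (β : Y → X → Bool) where

  correlation : List X → ℤ
  correlation S = ∑ Ω (λ y → ∏ S (sg ∘ β y))

  tuples : ∀ m → List (Vec Y m)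
  tuples zero    = [] ∷ []
  tuples (suc m) = cartesianProductWith _∷_ Ω (tuples m)

  -- For fixed `S` the summand is a product of functions of one coordinate of the tuple each, so the
  -- sum over tuples factors.
  correlation-power : ∀ m S → ∑ (tuples m) (λ c → ∏ S (sg ∘ iff-chain β c)) ≡ correlation S ℤ.^ m
  correlation-power zero    S = trans (ℤ.+-identityʳ _) (∏-one S)
    where
    ∏-one : ∀ S → ∏ S (λ _ → pos 1) ≡ pos 1
    ∏-one []      = refl
    ∏-one (_ ∷ S) = trans (ℤ.*-identityˡ _) (∏-one S)
  correlation-power (suc m) S = begin
    ∑ (tuples (suc m)) (λ c → ∏ S (sg ∘ iff-chain β c))
      ≡⟨ ∑-cartesian _∷_ _ Ω (tuples m) ⟩
    ∑ Ω (λ y → ∑ (tuples m) (λ c → ∏ S (sg ∘ iff-chain β (y ∷ c))))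
      ≡⟨ ∑-cong Ω (λ y → ∑-cong (tuples m) λ c → trans
           (∏-cong S (λ x _ → sg-⇔ᵇ (β y x) (iff-chain β c x)))
           (∏-* (sg ∘ β y) (sg ∘ iff-chain β c) S)) ⟩
    ∑ Ω (λ y → ∑ (tuples m) (λ c → ∏ S (sg ∘ β y) ℤ.* ∏ S (sg ∘ iff-chain β c)))
      ≡⟨ ∑-cong Ω (λ y → trans (∑-*ˡ (∏ S (sg ∘ β y)) _ (tuples m))
           (trans (cong (∏ S (sg ∘ β y) ℤ.*_) (correlation-power m S)) (ℤ.*-comm (∏ S (sg ∘ β y)) _))) ⟩
    ∑ Ω (λ y → correlation S ℤ.^ m ℤ.* ∏ S (sg ∘ β y))
      ≡⟨ ∑-*ˡ (correlation S ℤ.^ m) _ Ω ⟩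
    correlation S ℤ.^ m ℤ.* correlation S
      ≡⟨ ℤ.*-comm (correlation S ℤ.^ m) (correlation S) ⟩
    correlation S ℤ.^ suc m ∎
    where open ≡-Reasoning

  module _ {Z : Set} (Ω′ : List Z) (F : Z → X → Bool) (s : X → Bool) where

    factor : X → Z → ℤ
    factor a z = pos 1 ℤ.+ sg (s a) ℤ.* sg (F z a)

    -- 2 ^ length l times the weight of the z such that F z agrees with s on l
    agreement : List X → (Z → ℤ) → ℤ
    agreement l w = ∑ Ω′ (λ z → w z ℤ.* ∏ l (λ a → factor a z))

    twist : X → (Z → ℤ) → Z → ℤ
    twist a w z = w z ℤ.* sg (F z a)

    agreement-∷ : ∀ a l w → agreement (a ∷ l) w ≡ agreement l w ℤ.+ sg (s a) ℤ.* agreement l (twist a w)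
    agreement-∷ a l w = begin
      agreement (a ∷ l) w
        ≡⟨ ∑-cong Ω′ (λ z → solve 4 (λ w s f p → w :* ((con (pos 1) :+ s :* f) :* p) := w :* p :+ s :* (w :* f :* p))
             refl (w z) (sg (s a)) (sg (F z a)) (∏ l (λ a → factor a z))) ⟩
      ∑ Ω′ (λ z → w z ℤ.* ∏ l (λ a → factor a z) ℤ.+ sg (s a) ℤ.* (twist a w z ℤ.* ∏ l (λ a → factor a z)))
        ≡⟨ ∑-+ _ _ Ω′ ⟩
      agreement l w ℤ.+ ∑ Ω′ (λ z → sg (s a) ℤ.* (twist a w z ℤ.* ∏ l (λ a → factor a z)))
        ≡⟨ cong (ℤ._+_ (agreement l w)) (∑-*ˡ (sg (s a)) _ Ω′) ⟩
      agreement l w ℤ.+ sg (s a) ℤ.* agreement l (twist a w) ∎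
      where open ≡-Reasoning
            open IntegerSolver ℤ.+-*-commutativeRing

    ∣signed∣ : ∀ a i → ℤ.∣ sg (s a) ℤ.* i ∣ ≡ ℤ.∣ i ∣
    ∣signed∣ a i = trans (ℤ.abs-* (sg (s a)) i) (trans (cong (ℕ._* ℤ.∣ i ∣) (∣sg∣ (s a))) (ℕ.*-identityˡ _))

    private
      double : ∀ n b → 2 ^ n ℕ.* b ℕ.+ 2 ^ n ℕ.* b ≡ 2 ^ suc n ℕ.* b
      double n b = solve 2 (λ p b → p :* b :+ p :* b := con 2 :* p :* b) refl (2 ^ n) b
        where open +-*-Solver

    -- Each of the 2 ^ `length l` terms of the expanded product is, up to sign, a weighted
    -- correlation over some `S ⊑ l`. The weight absorbs the factors already chosen, so the
    -- induction hypothesis covers both halves of `agreement-∷`.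
    agreement-≤ : ∀ b l w → (∀ {S} → S ⊑ l → ℤ.∣ ∑ Ω′ (λ z → w z ℤ.* ∏ S (sg ∘ F z)) ∣ ≤ b) →
                  ℤ.∣ agreement l w ∣ ≤ 2 ^ length l ℕ.* b
    agreement-≤ b []      w small = ℕ.≤-trans (small []) (ℕ.≤-reflexive (sym (ℕ.*-identityˡ b)))
    agreement-≤ b (a ∷ l) w small = begin
      ℤ.∣ agreement (a ∷ l) w ∣
        ≡⟨ cong ℤ.∣_∣ (agreement-∷ a l w) ⟩
      ℤ.∣ agreement l w ℤ.+ sg (s a) ℤ.* agreement l (twist a w) ∣
        ≤⟨ ℤ.∣i+j∣≤∣i∣+∣j∣ (agreement l w) _ ⟩
      ℤ.∣ agreement l w ∣ ℕ.+ ℤ.∣ sg (s a) ℤ.* agreement l (twist a w) ∣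
        ≡⟨ cong (ℤ.∣ agreement l w ∣ ℕ.+_) (∣signed∣ a _) ⟩
      ℤ.∣ agreement l w ∣ ℕ.+ ℤ.∣ agreement l (twist a w) ∣
        ≤⟨ ℕ.+-mono-≤ (agreement-≤ b l w (small ∘ (a ∷ʳ_)))
                      (agreement-≤ b l (twist a w) λ {S} S⊑l → subst (λ i → ℤ.∣ i ∣ ≤ b)
                         (∑-cong Ω′ λ z → sym (ℤ.*-assoc (w z) _ _)) (small (refl ∷ S⊑l))) ⟩
      2 ^ length l ℕ.* b ℕ.+ 2 ^ length l ℕ.* b
        ≡⟨ double (length l) b ⟩
      2 ^ length (a ∷ l) ℕ.* b ∎
      where open ℕ.≤-Reasoning

    -- In `agreement-∷` the untwisted half still contains the main term ∑ w, while the twisted half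
    -- consists of products over sets containing `a`. The latter are nonempty, so `agreement-≤`
    -- bounds them by the hypothesis.
    agreement-≥ : ∀ b l w → (∀ {a S} → (a ∷ S) ⊑ l → ℤ.∣ ∑ Ω′ (λ z → w z ℤ.* ∏ (a ∷ S) (sg ∘ F z)) ∣ ≤ b) →
                  ℤ.∣ ∑ Ω′ w ∣ ≤ ℤ.∣ agreement l w ∣ ℕ.+ 2 ^ length l ℕ.* b
    agreement-≥ b []      w small = ℕ.≤-trans
      (ℕ.≤-reflexive (cong ℤ.∣_∣ (∑-cong Ω′ λ z → sym (ℤ.*-identityʳ (w z))))) (ℕ.m≤m+n _ _)
    agreement-≥ b (a ∷ l) w small = begin
      ℤ.∣ ∑ Ω′ w ∣
        ≤⟨ agreement-≥ b l w (small ∘ (a ∷ʳ_)) ⟩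
      ℤ.∣ agreement l w ∣ ℕ.+ 2 ^ length l ℕ.* b
        ≡⟨ cong (λ i → ℤ.∣ i ∣ ℕ.+ _) (solve 2 (λ x y → x := (x :+ y) :- y) refl
             (agreement l w) (sg (s a) ℤ.* agreement l (twist a w))) ⟩
      ℤ.∣ (agreement l w ℤ.+ sg (s a) ℤ.* agreement l (twist a w)) ℤ.- sg (s a) ℤ.* agreement l (twist a w) ∣ ℕ.+ 2 ^ length l ℕ.* b
        ≤⟨ ℕ.+-monoˡ-≤ (2 ^ length l ℕ.* b) (ℤ.∣i-j∣≤∣i∣+∣j∣ (agreement l w ℤ.+ _) _) ⟩
      (ℤ.∣ agreement l w ℤ.+ sg (s a) ℤ.* agreement l (twist a w) ∣ ℕ.+ ℤ.∣ sg (s a) ℤ.* agreement l (twist a w) ∣) ℕ.+ 2 ^ length l ℕ.* b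
        ≡⟨ cong₂ (λ i j → (i ℕ.+ j) ℕ.+ _) (cong ℤ.∣_∣ (sym (agreement-∷ a l w))) (∣signed∣ a _) ⟩
      (ℤ.∣ agreement (a ∷ l) w ∣ ℕ.+ ℤ.∣ agreement l (twist a w) ∣) ℕ.+ 2 ^ length l ℕ.* b
        ≤⟨ ℕ.+-monoˡ-≤ (2 ^ length l ℕ.* b) (ℕ.+-monoʳ-≤ ℤ.∣ agreement (a ∷ l) w ∣ (agreement-≤ b l (twist a w) λ {S} S⊑l → subst (λ i → ℤ.∣ i ∣ ≤ b)
             (∑-cong Ω′ λ z → sym (ℤ.*-assoc (w z) _ _)) (small (refl ∷ S⊑l)))) ⟩
      (ℤ.∣ agreement (a ∷ l) w ∣ ℕ.+ 2 ^ length l ℕ.* b) ℕ.+ 2 ^ length l ℕ.* b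
        ≡⟨ trans (ℕ.+-assoc ℤ.∣ agreement (a ∷ l) w ∣ _ _) (cong (ℤ.∣ agreement (a ∷ l) w ∣ ℕ.+_) (double (length l) b)) ⟩
      ℤ.∣ agreement (a ∷ l) w ∣ ℕ.+ 2 ^ length (a ∷ l) ℕ.* b ∎
      where open ℕ.≤-Reasoning
            open IntegerSolver ℤ.+-*-commutativeRing

  -- If no tuple agreed with `s` on `l`, the expanded sum would vanish. But its term for the empty
  -- set counts all tuples and exceeds the bound on the remaining terms. The relative bias of one
  -- copy is at most the fraction `suc n` / `k`.
  shatter : ∀ k n m l → 0 < length Ω →
            (∀ {a S} → (a ∷ S) ⊑ l → k ℕ.* ℤ.∣ correlation (a ∷ S) ∣ ≤ length Ω ℕ.* suc n) →
            suc n ^ m ℕ.* 2 ^ length l < k ^ m →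
            ∀ (s : X → Bool) → ∃[ c ] (∀ {x} → x ∈ˡ l → iff-chain β {m} c x ≡ s x)
  shatter k n m l 0<N small n<k s = c , λ x∈l →
    sg-agree (s _) _ (∏-nonzero {f = λ a → factor (tuples m) (iff-chain β) s a c} l (λ ≡0 → proj₂ found (trans (cong ((pos (k ^ m)) ℤ.*_) ≡0) (ℤ.*-zeroʳ (pos (k ^ m))))) x∈l)
    where
    N = length Ω
    b = (N ℕ.* suc n) ^ m

    all : ℤ.∣ ∑ (tuples m) (λ _ → pos 1) ∣ ≡ N ^ m
    all = begin
      ℤ.∣ ∑ (tuples m) (λ _ → pos 1) ∣   ≡⟨ cong ℤ.∣_∣ (correlation-power m []) ⟩
      ℤ.∣ correlation [] ℤ.^ m ∣       ≡⟨ ∣^∣ (correlation []) m ⟩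
      ℤ.∣ correlation [] ∣ ^ m         ≡⟨ cong (λ i → ℤ.∣ i ∣ ^ m) (trans (∑-const (pos 1) Ω) (ℤ.*-identityʳ (pos N))) ⟩
      N ^ m ∎
      where open ≡-Reasoning

    small′ : ∀ {a S} → (a ∷ S) ⊑ l →
             ℤ.∣ ∑ (tuples m) (λ c → (pos (k ^ m)) ℤ.* ∏ (a ∷ S) (sg ∘ iff-chain β c)) ∣ ≤ b
    small′ {a} {S} aS⊑l = begin
      ℤ.∣ ∑ (tuples m) (λ c → (pos (k ^ m)) ℤ.* ∏ (a ∷ S) (sg ∘ iff-chain β c)) ∣
        ≡⟨ cong ℤ.∣_∣ (trans (∑-*ˡ (pos (k ^ m)) _ (tuples m)) (cong ((pos (k ^ m)) ℤ.*_) (correlation-power m (a ∷ S)))) ⟩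
      ℤ.∣ (pos (k ^ m)) ℤ.* correlation (a ∷ S) ℤ.^ m ∣
        ≡⟨ trans (ℤ.abs-* (pos (k ^ m)) _) (cong (k ^ m ℕ.*_) (∣^∣ (correlation (a ∷ S)) m)) ⟩
      k ^ m ℕ.* ℤ.∣ correlation (a ∷ S) ∣ ^ m
        ≡⟨ ^-distribʳ-* m k _ ⟨
      (k ℕ.* ℤ.∣ correlation (a ∷ S) ∣) ^ m
        ≤⟨ ℕ.^-monoˡ-≤ m (small aS⊑l) ⟩
      b ∎
      where open ℕ.≤-Reasoning

    -- The constant weight k ^ m clears the denominator of the m-th power of the bias, so the
    -- computation stays in ℤ; the factor N ^ m cancels in the end.
    nonzero : agreement (tuples m) (iff-chain β) s l (λ _ → pos (k ^ m)) ≢ pos 0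
    nonzero ≡0 = ℕ.<⇒≱ n<k (ℕ.*-cancelʳ-≤ (k ^ m) _ (N ^ m) {{ℕ.m^n≢0 N m {{ℕ.>-nonZero 0<N}}}} (begin
      k ^ m ℕ.* N ^ m
        ≡⟨ cong (k ^ m ℕ.*_) all ⟨
      k ^ m ℕ.* ℤ.∣ ∑ (tuples m) (λ _ → pos 1) ∣
        ≡⟨ ℤ.abs-* (pos (k ^ m)) _ ⟨
      ℤ.∣ (pos (k ^ m)) ℤ.* ∑ (tuples m) (λ _ → pos 1) ∣
        ≡⟨ cong ℤ.∣_∣ (trans (sym (∑-*ˡ (pos (k ^ m)) (λ _ → pos 1) (tuples m))) (∑-cong (tuples m) λ _ → ℤ.*-identityʳ (pos (k ^ m)))) ⟩
      ℤ.∣ ∑ (tuples m) (λ _ → pos (k ^ m)) ∣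
        ≤⟨ agreement-≥ (tuples m) (iff-chain β) s b l (λ _ → pos (k ^ m)) small′ ⟩
      ℤ.∣ agreement (tuples m) (iff-chain β) s l (λ _ → pos (k ^ m)) ∣ ℕ.+ 2 ^ length l ℕ.* b
        ≡⟨ cong (λ i → ℤ.∣ i ∣ ℕ.+ 2 ^ length l ℕ.* b) ≡0 ⟩
      2 ^ length l ℕ.* b
        ≡⟨ cong (2 ^ length l ℕ.*_) (^-distribʳ-* m N (suc n)) ⟩
      2 ^ length l ℕ.* (N ^ m ℕ.* suc n ^ m)
        ≡⟨ solve 3 (λ x y z → x :* (y :* z) := z :* x :* y) refl (2 ^ length l) (N ^ m) (suc n ^ m) ⟩
      suc n ^ m ℕ.* 2 ^ length l ℕ.* N ^ m ∎))
      where open ℕ.≤-Reasoning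
            open +-*-Solver

    found = ∑-nonzero (λ c → (pos (k ^ m)) ℤ.* ∏ l (λ a → factor (tuples m) (iff-chain β) s a c)) (tuples m) nonzero
    c = proj₁ found

-- Finite fields

unique-⊆-length : ∀ {X : Set} {xs ys : List X} → Unique xs → (∀ {x} → x ∈ˡ xs → x ∈ˡ ys) → length xs ≤ length ys
unique-⊆-length []            xs⊆ys = z≤n
unique-⊆-length {xs = x ∷ xs} (x∉xs ∷ uniq) xs⊆ys with Mem.∈-∃++ (xs⊆ys (here refl))
... | ys₁ , ys₂ , refl = begin
  suc (length xs)                 ≤⟨ s≤s (unique-⊆-length uniq xs⊆ys′) ⟩
  suc (length (ys₁ ++ ys₂))       ≡⟨ cong suc (List.length-++ ys₁) ⟩
  suc (length ys₁ ℕ.+ length ys₂) ≡⟨ ℕ.+-suc (length ys₁) (length ys₂) ⟨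
  length ys₁ ℕ.+ suc (length ys₂) ≡⟨ List.length-++ ys₁ ⟨
  length (ys₁ ++ x ∷ ys₂)         ∎
  where
  open ℕ.≤-Reasoning
  xs⊆ys′ : ∀ {z} → z ∈ˡ xs → z ∈ˡ ys₁ ++ ys₂
  xs⊆ys′ z∈xs with Mem.∈-++⁻ ys₁ (xs⊆ys (there z∈xs))
  ... | inj₁ z∈ys₁         = Mem.∈-++⁺ˡ z∈ys₁
  ... | inj₂ (here refl)   = contradiction refl (All.lookup x∉xs z∈xs)
  ... | inj₂ (there z∈ys₂) = Mem.∈-++⁺ʳ ys₁ z∈ys₂

unique-set-↭ : ∀ {X : Set} {xs ys : List X} → Unique xs → Unique ys →
               (∀ {x} → x ∈ˡ xs → x ∈ˡ ys) → (∀ {x} → x ∈ˡ ys → x ∈ˡ xs) → xs ↭ ys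
unique-set-↭ u v to from = ∼bag⇒↭ (unique∧set⇒bag u v (mk⇔ to from))

parity : ∀ n → ∃[ a ] (n ≡ 2 ℕ.* a ⊎ n ≡ suc (2 ℕ.* a))
parity zero = 0 , inj₁ refl
parity (suc n) with parity n
... | a , inj₁ refl = a , inj₂ refl
... | a , inj₂ refl = suc a , inj₁ (cong suc (sym (ℕ.+-suc a (a ℕ.+ 0))))

length-cartesianProduct : ∀ {X Y : Set} (xs : List X) (ys : List Y) → length (cartesianProduct xs ys) ≡ length xs ℕ.* length ys
length-cartesianProduct []       ys = refl
length-cartesianProduct (x ∷ xs) ys = trans (List.length-++ (map (x ,_) ys))
  (cong₂ ℕ._+_ (List.length-map (x ,_) ys) (length-cartesianProduct xs ys))

Char2 : FiniteField → Set
Char2 K = 1# + 1# ≡ 0#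
  where open FiniteField K

module Field (K : FiniteField) where
  open FiniteField K public

  commutativeRing : CommutativeRing 0ℓ 0ℓ
  commutativeRing = record { isCommutativeRing = isCommutativeRing }

  open CommutativeRing commutativeRing public
    using (+-assoc; +-comm; +-identityˡ; +-identityʳ; -‿inverseˡ; -‿inverseʳ; *-assoc; *-comm; *-identityˡ; *-identityʳ; zeroˡ; zeroʳ; distribˡ; distribʳ; *-isCommutativeMonoid; commutativeSemiring; ring)
  open Exp commutativeSemiring public using (^-homo-*; ^-assocʳ; ^-distrib-*) renaming (_^_ to _↑_)
  open IntegerSolver commutativeRing public

  element : Fin order → Carrier
  element = Inverse.from enumeration

  element-index : ∀ x → element (index x) ≡ x
  element-index x = Inverse.strictlyInverseʳ enumeration x

  index-injective : ∀ {x y} → index x ≡ index y → x ≡ y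
  index-injective eq = trans (sym (element-index _)) (trans (cong element eq) (element-index _))

  infix 4 _≟_
  _≟_ : ∀ x y → Dec (x ≡ y)
  x ≟ y = map′ index-injective (cong index) (index x Fin.≟ index y)

  element-injective : ∀ {i j} → element i ≡ element j → i ≡ j
  element-injective eq = trans (sym (Inverse.strictlyInverseˡ enumeration _))
    (trans (cong index eq) (Inverse.strictlyInverseˡ enumeration _))

  abstract
    ∃? : ∀ {P : Carrier → Set} → (∀ x → Dec (P x)) → Dec (∃ P)
    ∃? {P} P? = map′ (λ (i , p) → element i , p) (λ (x , p) → index x , subst P (sym (element-index x)) p)
                     (Fin.any? (P? ∘ element))

  elements : List Carrier
  elements = map element (allFin order)

  ∈-elements : ∀ x → x ∈ˡ elements
  ∈-elements x = subst (_∈ˡ elements) (element-index x) (Mem.∈-map⁺ element (Mem.∈-allFin (index x)))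

  elements-unique : Unique elements
  elements-unique = Unique.map⁺ element-injective (Unique.allFin⁺ order)

  length-elements : length elements ≡ order
  length-elements = trans (List.length-map element (allFin order)) (List.length-tabulate id)

  pairs : List (Carrier × Carrier)
  pairs = cartesianProduct elements elements

  length-pairs : length pairs ≡ order ℕ.* order
  length-pairs = trans (length-cartesianProduct elements elements) (cong₂ ℕ._*_ length-elements length-elements)

  elements-↭ : ∀ (f g : Carrier → Carrier) → (∀ x → f (g x) ≡ x) → (∀ x → g (f x) ≡ x) → map f elements ↭ elements
  elements-↭ f g fg gf = unique-set-↭
    (Unique.map⁺ (λ {x} {y} eq → trans (sym (gf x)) (trans (cong g eq) (gf y))) elements-unique)
    elements-unique
    (λ {x} _ → ∈-elements x)
    (λ {x} _ → subst (_∈ˡ map f elements) (fg x) (Mem.∈-map⁺ f (∈-elements (g x))))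

  ∑-translate : ∀ c f → ∑ elements (λ x → f (x + c)) ≡ ∑ elements f
  ∑-translate c f = trans (sym (∑-map (_+ c) f elements))
    (∑-↭ f (elements-↭ (_+ c) (_+ - c)
      (λ x → solve 2 (λ x c → x :+ :- c :+ c := x) refl x c)
      (λ x → solve 2 (λ x c → x :+ c :+ :- c := x) refl x c)))

  inv : ∀ {x} → x ≢ 0# → Carrier
  inv x≢0 = proj₁ (inverse _ x≢0)

  *-inv : ∀ {x} (x≢0 : x ≢ 0#) → x * inv x≢0 ≡ 1#
  *-inv x≢0 = proj₂ (inverse _ x≢0)

  ∑-scale : ∀ {c} → c ≢ 0# → ∀ f → ∑ elements (λ x → f (x * c)) ≡ ∑ elements f
  ∑-scale {c} c≢0 f = trans (sym (∑-map (_* c) f elements))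
    (∑-↭ f (elements-↭ (_* c) (_* inv c≢0)
      (λ x → trans (solve 3 (λ x c d → x :* d :* c := x :* (c :* d)) refl x c (inv c≢0)) (trans (cong (x *_) (*-inv c≢0)) (*-identityʳ x)))
      (λ x → trans (*-assoc x c (inv c≢0)) (trans (cong (x *_) (*-inv c≢0)) (*-identityʳ x)))))

  *-cancelˡ : ∀ {x y z} → x ≢ 0# → x * y ≡ x * z → y ≡ z
  *-cancelˡ {x} {y} {z} x≢0 eq = trans (sym (expand y)) (trans (cong (inv x≢0 *_) eq) (expand z))
    where
    expand : ∀ y → inv x≢0 * (x * y) ≡ y
    expand y = trans (solve 3 (λ x y i → i :* (x :* y) := x :* i :* y) refl x y (inv x≢0))
                     (trans (cong (_* y) (*-inv x≢0)) (*-identityˡ y))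

  *≡0⇒ : ∀ x y → x * y ≡ 0# → x ≡ 0# ⊎ y ≡ 0#
  *≡0⇒ x y xy≡0 with x ≟ 0#
  ... | yes x≡0 = inj₁ x≡0
  ... | no x≢0  = inj₂ (*-cancelˡ x≢0 (trans xy≡0 (sym (zeroʳ x))))

  *≢0 : ∀ {x y} → x ≢ 0# → y ≢ 0# → x * y ≢ 0#
  *≢0 x≢0 y≢0 xy≡0 = [ x≢0 , y≢0 ]′ (*≡0⇒ _ _ xy≡0)

  1↑ : ∀ n → 1# ↑ n ≡ 1#
  1↑ zero    = refl
  1↑ (suc n) = trans (*-identityˡ _) (1↑ n)

  -‿≡0⇒≡ : ∀ {x y} → x + - y ≡ 0# → x ≡ y
  -‿≡0⇒≡ {x} {y} eq = begin
    x               ≡⟨ solve 2 (λ x y → x := x :+ :- y :+ y) refl x y ⟩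
    x + - y + y     ≡⟨ cong (_+ y) eq ⟩
    0# + y          ≡⟨ +-identityˡ y ⟩
    y               ∎
    where open ≡-Reasoning

  nonzeros : List Carrier
  nonzeros = filter (λ x → ¬? (x ≟ 0#)) elements

  ∈-nonzeros : ∀ {x} → x ≢ 0# → x ∈ˡ nonzeros
  ∈-nonzeros {x} = Mem.∈-filter⁺ (λ x → ¬? (x ≟ 0#)) (∈-elements x)

  ∈-nonzeros⁻ : ∀ {x} → x ∈ˡ nonzeros → x ≢ 0#
  ∈-nonzeros⁻ = proj₂ ∘ Mem.∈-filter⁻ (λ x → ¬? (x ≟ 0#)) {xs = elements}

  nonzeros-unique : Unique nonzeros
  nonzeros-unique = Unique.filter⁺ (λ x → ¬? (x ≟ 0#)) elements-unique

  order≡1+nonzeros : order ≡ suc (length nonzeros)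
  order≡1+nonzeros = trans (sym length-elements) (ℕ.≤-antisym
    (unique-⊆-length {ys = 0# ∷ nonzeros} elements-unique (λ {x} _ → case x ≟ 0# of λ
      { (yes x≡0) → here x≡0 ; (no x≢0) → there (∈-nonzeros x≢0) }))
    (unique-⊆-length {xs = 0# ∷ nonzeros} (All.tabulate (λ x∈ 0≡x → ∈-nonzeros⁻ x∈ (sym 0≡x)) ∷ nonzeros-unique) (λ {x} _ → ∈-elements x)))

  private
    product : List Carrier → Carrier
    product = foldr _*_ 1#

    product-scale : ∀ u xs → product (map (u *_) xs) ≡ u ↑ length xs * product xs
    product-scale u []       = sym (*-identityˡ 1#)
    product-scale u (x ∷ xs) = trans (cong (u * x *_) (product-scale u xs))
      (solve 4 (λ u x a b → u :* x :* (a :* b) := u :* a :* (x :* b)) refl u x (u ↑ length xs) (product xs))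

    product≢0 : ∀ xs → (∀ {x} → x ∈ˡ xs → x ≢ 0#) → product xs ≢ 0#
    product≢0 []       _   1≡0 = 0≢1 (sym 1≡0)
    product≢0 (x ∷ xs) ≢0 = *≢0 (≢0 (here refl)) (product≢0 xs (≢0 ∘ there))

  -- Multiplication by `u` permutes the nonzero elements. Comparing their product before and after
  -- leaves only the power of `u`.
  fermat : ∀ {u} → u ≢ 0# → u ↑ length nonzeros ≡ 1#
  fermat {u} u≢0 = *-cancelˡ (product≢0 nonzeros ∈-nonzeros⁻) (begin
    product nonzeros * u ↑ length nonzeros  ≡⟨ *-comm _ _ ⟩
    u ↑ length nonzeros * product nonzeros  ≡⟨ product-scale u nonzeros ⟨
    product (map (u *_) nonzeros)           ≡⟨ PermSetoid.foldr-commMonoid (setoid Carrier) *-isCommutativeMonoid (↭⇒↭ₛ scaled) ⟩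
    product nonzeros                        ≡⟨ *-identityʳ _ ⟨
    product nonzeros * 1#                   ∎)
    where
    open ≡-Reasoning
    scaled : map (u *_) nonzeros ↭ nonzeros
    scaled = unique-set-↭ (Unique.map⁺ (*-cancelˡ u≢0) nonzeros-unique) nonzeros-unique
      (λ x∈ → case Mem.∈-map⁻ (u *_) x∈ of λ { (y , y∈ , refl) → ∈-nonzeros (*≢0 u≢0 (∈-nonzeros⁻ y∈)) })
      (λ {x} x∈ → subst (_∈ˡ map (u *_) nonzeros)
        (trans (solve 3 (λ u v x → u :* (v :* x) := u :* v :* x) refl u (inv u≢0) x) (trans (cong (_* x) (*-inv u≢0)) (*-identityˡ x)))
        (Mem.∈-map⁺ (u *_) (∈-nonzeros (*≢0 inv≢0 (∈-nonzeros⁻ x∈)))))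
      where
      inv≢0 : inv u≢0 ≢ 0#
      inv≢0 eq = 0≢1 (trans (sym (zeroʳ u)) (trans (cong (u *_) (sym eq)) (*-inv u≢0)))

  frobenius : ∀ x → x ↑ order ≡ x
  frobenius x with x ≟ 0#
  ... | no x≢0   = trans (cong (x ↑_) order≡1+nonzeros) (trans (cong (x *_) (fermat x≢0)) (*-identityʳ x))
  ... | yes refl = trans (cong (0# ↑_) order≡1+nonzeros) (zeroˡ _)

  -- If the number of nonzero elements were odd, `fermat` at -1 would give -1 = 1.
  odd-order : ¬ Char2 K → ∃[ a ] (order ≡ suc (2 ℕ.* a) × length nonzeros ≡ 2 ℕ.* a)
  odd-order 2≢0 with parity (length nonzeros)
  ... | a , inj₁ even = a , trans order≡1+nonzeros (cong suc even) , even
  ... | a , inj₂ odd  = contradiction (begin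
    1# + 1#        ≡⟨ cong (1# +_) -1≡1 ⟨
    1# + - 1#      ≡⟨ -‿inverseʳ 1# ⟩
    0#             ∎) 2≢0
    where
    open ≡-Reasoning
    -1≢0 : - 1# ≢ 0#
    -1≢0 eq = 0≢1 (trans (sym (-‿inverseʳ 1#)) (trans (cong (1# +_) eq) (+-identityʳ 1#)))
    -1≡1 : - 1# ≡ 1#
    -1≡1 = begin
      - 1#                                  ≡⟨ *-identityʳ (- 1#) ⟨
      - 1# * 1#                             ≡⟨ cong (- 1# *_) (1↑ a) ⟨
      - 1# * 1# ↑ a                         ≡⟨ cong (λ z → - 1# * z ↑ a) (solve 0 (con (pos 1) := :- con (pos 1) :* (:- con (pos 1) :* con (pos 1))) refl) ⟩
      - 1# * ((- 1#) ↑ 2) ↑ a               ≡⟨ cong (- 1# *_) (^-assocʳ (- 1#) 2 a) ⟩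
      - 1# * (- 1#) ↑ (2 ℕ.* a)             ≡⟨ cong ((- 1#) ↑_) odd ⟨
      (- 1#) ↑ length nonzeros              ≡⟨ fermat -1≢0 ⟩
      1#                                    ∎

-- Power series and polynomials

module PowerSeries (K : FiniteField) where
  open Field K

  Series : Set
  Series = ℕ → Carrier

  constant : Carrier → Series
  constant c zero    = c
  constant c (suc k) = 0#

  V : Series
  V zero    = 0#
  V (suc k) = constant 1# k

  infixl 7 _⊛_
  -- The Cauchy product; splitting off the lowest coefficient of the left factor replaces the finite
  -- sum by a recursion on the index.
  _⊛_ : Series → Series → Series
  (p ⊛ q) zero    = p 0 * q 0
  (p ⊛ q) (suc k) = p 0 * q (suc k) + ((p ∘ suc) ⊛ q) k

  ⊛-cong : ∀ {p p′ q q′} k → (∀ i → i ≤ k → p i ≡ p′ i) → (∀ i → i ≤ k → q i ≡ q′ i) → (p ⊛ q) k ≡ (p′ ⊛ q′) k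
  ⊛-cong zero    p≗p′ q≗q′ = cong₂ _*_ (p≗p′ 0 z≤n) (q≗q′ 0 z≤n)
  ⊛-cong (suc k) p≗p′ q≗q′ = cong₂ _+_ (cong₂ _*_ (p≗p′ 0 z≤n) (q≗q′ (suc k) ℕ.≤-refl))
    (⊛-cong k (λ i i≤k → p≗p′ (suc i) (s≤s i≤k)) (λ i i≤k → q≗q′ i (ℕ.m≤n⇒m≤1+n i≤k)))

  ⊛-distribʳ : ∀ r p q k → ((λ i → p i + q i) ⊛ r) k ≡ (p ⊛ r) k + (q ⊛ r) k
  ⊛-distribʳ r p q zero    = distribʳ _ _ _
  ⊛-distribʳ r p q (suc k) = trans (cong ((p 0 + q 0) * r (suc k) +_) (⊛-distribʳ r (p ∘ suc) (q ∘ suc) k))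
    (solve 5 (λ p q r a b → (p :+ q) :* r :+ (a :+ b) := p :* r :+ a :+ (q :* r :+ b)) refl
      (p 0) (q 0) (r (suc k)) (((p ∘ suc) ⊛ r) k) (((q ∘ suc) ⊛ r) k))

  ⊛-scale : ∀ c p q k → ((λ i → c * p i) ⊛ q) k ≡ c * (p ⊛ q) k
  ⊛-scale c p q zero    = *-assoc _ _ _
  ⊛-scale c p q (suc k) = trans (cong (c * p 0 * q (suc k) +_) (⊛-scale c (p ∘ suc) q k))
    (solve 4 (λ c p q a → c :* p :* q :+ c :* a := c :* (p :* q :+ a)) refl c (p 0) (q (suc k)) (((p ∘ suc) ⊛ q) k))

  ⊛-suc : ∀ p q k → (p ⊛ q) (suc k) ≡ p (suc k) * q 0 + (p ⊛ (q ∘ suc)) k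
  ⊛-suc p q zero    = +-comm _ _
  ⊛-suc p q (suc k) = trans (cong (p 0 * q (suc (suc k)) +_) (⊛-suc (p ∘ suc) q k))
    (solve 3 (λ a b c → a :+ (b :+ c) := b :+ (a :+ c)) refl
      (p 0 * q (suc (suc k))) (p (suc (suc k)) * q 0) (((p ∘ suc) ⊛ (q ∘ suc)) k))

  ⊛-comm : ∀ p q k → (p ⊛ q) k ≡ (q ⊛ p) k
  ⊛-comm p q zero    = *-comm _ _
  ⊛-comm p q (suc k) = trans (cong₂ _+_ (*-comm (p 0) (q (suc k))) (⊛-comm (p ∘ suc) q k)) (sym (⊛-suc q p k))

  ⊛-assoc : ∀ p q r k → ((p ⊛ q) ⊛ r) k ≡ (p ⊛ (q ⊛ r)) k
  ⊛-assoc p q r zero    = *-assoc _ _ _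
  ⊛-assoc p q r (suc k) = begin
    p 0 * q 0 * r (suc k) + ((λ i → p 0 * q (suc i) + ((p ∘ suc) ⊛ q) i) ⊛ r) k
      ≡⟨ cong (p 0 * q 0 * r (suc k) +_) (⊛-distribʳ r (λ i → p 0 * q (suc i)) _ k) ⟩
    p 0 * q 0 * r (suc k) + (((λ i → p 0 * q (suc i)) ⊛ r) k + (((p ∘ suc) ⊛ q) ⊛ r) k)
      ≡⟨ cong (p 0 * q 0 * r (suc k) +_) (cong₂ _+_ (⊛-scale (p 0) (q ∘ suc) r k) (⊛-assoc (p ∘ suc) q r k)) ⟩
    p 0 * q 0 * r (suc k) + (p 0 * ((q ∘ suc) ⊛ r) k + ((p ∘ suc) ⊛ (q ⊛ r)) k)
      ≡⟨ solve 5 (λ p q r a b → p :* q :* r :+ (p :* a :+ b) := p :* (q :* r :+ a) :+ b) refl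
           (p 0) (q 0) (r (suc k)) (((q ∘ suc) ⊛ r) k) (((p ∘ suc) ⊛ (q ⊛ r)) k) ⟩
    p 0 * (q 0 * r (suc k) + ((q ∘ suc) ⊛ r) k) + ((p ∘ suc) ⊛ (q ⊛ r)) k ∎
    where open ≡-Reasoning

  ⊛-zeroˡ : ∀ p k → ((λ _ → 0#) ⊛ p) k ≡ 0#
  ⊛-zeroˡ p zero    = zeroˡ _
  ⊛-zeroˡ p (suc k) = trans (cong₂ _+_ (zeroˡ _) (⊛-zeroˡ p k)) (+-identityˡ 0#)

  constant-⊛ : ∀ c p k → (constant c ⊛ p) k ≡ c * p k
  constant-⊛ c p zero    = refl
  constant-⊛ c p (suc k) = trans (cong (c * p (suc k) +_) (⊛-zeroˡ p k)) (+-identityʳ _)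

  constant-+ : ∀ x y k → constant (x + y) k ≡ constant x k + constant y k
  constant-+ x y zero    = refl
  constant-+ x y (suc k) = sym (+-identityˡ 0#)

  constant-* : ∀ x y k → constant (x * y) k ≡ (constant x ⊛ constant y) k
  constant-* x y zero    = refl
  constant-* x y (suc k) = sym (trans (constant-⊛ x (constant y) (suc k)) (zeroʳ x))

  constant-0 : ∀ k → constant 0# k ≡ 0#
  constant-0 zero    = refl
  constant-0 (suc k) = refl

  V-⊛ : ∀ p k → (V ⊛ p) (suc k) ≡ p k
  V-⊛ p k = trans (cong₂ _+_ (zeroˡ (p (suc k))) (trans (constant-⊛ 1# p k) (*-identityˡ (p k)))) (+-identityˡ (p k))

  ⊛-identityˡ : ∀ p k → (constant 1# ⊛ p) k ≡ p k
  ⊛-identityˡ p k = trans (constant-⊛ 1# p k) (*-identityˡ (p k))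

  -- K[[V]] / (V ^ M)
  truncated : ℕ → CommutativeRing 0ℓ 0ℓ
  truncated M = record
    { Carrier = Series
    ; _≈_ = λ p q → ∀ k → k < M → p k ≡ q k
    ; _+_ = λ p q k → p k + q k
    ; _*_ = _⊛_
    ; -_  = λ p k → - p k
    ; 0#  = λ _ → 0#
    ; 1#  = constant 1#
    ; isCommutativeRing = record
      { isRing = record
        { +-isAbelianGroup = record
          { isGroup = record
            { isMonoid = record
              { isSemigroup = record
                { isMagma = record
                  { isEquivalence = record
                    { refl = λ _ _ → refl
                    ; sym = λ p≈q k k<M → sym (p≈q k k<M)
                    ; trans = λ p≈q q≈r k k<M → trans (p≈q k k<M) (q≈r k k<M) }
                  ; ∙-cong = λ p≈p′ q≈q′ k k<M → cong₂ _+_ (p≈p′ k k<M) (q≈q′ k k<M) }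
                ; assoc = λ p q r k _ → +-assoc (p k) (q k) (r k) }
              ; identity = (λ p k _ → +-identityˡ (p k)) , (λ p k _ → +-identityʳ (p k)) }
            ; inverse = (λ p k _ → -‿inverseˡ (p k)) , (λ p k _ → -‿inverseʳ (p k))
            ; ⁻¹-cong = λ p≈q k k<M → cong -_ (p≈q k k<M) }
          ; comm = λ p q k _ → +-comm (p k) (q k) }
        ; *-cong = λ p≈p′ q≈q′ k k<M → ⊛-cong k (λ i i≤k → p≈p′ i (ℕ.≤-<-trans i≤k k<M)) (λ i i≤k → q≈q′ i (ℕ.≤-<-trans i≤k k<M))
        ; *-assoc = λ p q r k _ → ⊛-assoc p q r k
        ; *-identity = (λ p k _ → ⊛-identityˡ p k) , (λ p k _ → trans (⊛-comm p (constant 1#) k) (⊛-identityˡ p k))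
        ; distrib = (λ p q r k _ → trans (⊛-comm p (λ i → q i + r i) k) (trans (⊛-distribʳ p q r k) (cong₂ _+_ (⊛-comm q p k) (⊛-comm r p k))))
                  , (λ p q r k _ → ⊛-distribʳ p q r k) }
      ; *-comm = λ p q k _ → ⊛-comm p q k } }

horner : {C D : Set} → (D → D → D) → (D → D → D) → D → (C → D) → List C → D → D
horner _+_ _*_ 0# ι []      x = 0#
horner _+_ _*_ 0# ι (c ∷ p) x = ι c + (x * horner _+_ _*_ 0# ι p x)

module Identities (A : CommutativeRing 0ℓ 0ℓ) where
  open CommutativeRing A using (Carrier; _≈_; _+_; _*_; _-_; 0#) renaming (refl to ≈-refl)
  open IntegerSolver A

  ⊞-step : ∀ a b x p q → a + b + x * (p + q) ≈ a + x * p + (b + x * q)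
  ⊞-step = solve 5 (λ a b x p q → a :+ b :+ x :* (p :+ q) := a :+ x :* p :+ (b :+ x :* q)) ≈-refl

  scale-step : ∀ c a x p → c * a + x * (c * p) ≈ c * (a + x * p)
  scale-step = solve 4 (λ c a x p → c :* a :+ x :* (c :* p) := c :* (a :+ x :* p)) ≈-refl

  ⊠-step : ∀ a x p q → a * q + x * (p * q) ≈ (a + x * p) * q
  ⊠-step = solve 4 (λ a x p q → a :* q :+ x :* (p :* q) := (a :+ x :* p) :* q) ≈-refl

  linear-step : ∀ b x p → b * p + x * p ≈ (x + b) * p
  linear-step = solve 3 (λ b x p → b :* p :+ x :* p := (x :+ b) :* p) ≈-refl

  zero-step : ∀ x → 0# + x * 0# ≈ 0#
  zero-step = solve 1 (λ x → con (pos 0) :+ x :* con (pos 0) := con (pos 0)) ≈-refl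

  division-base : ∀ c x t → c + x * 0# ≈ (x - t) * 0# + c
  division-base = solve 3 (λ c x t → c :+ x :* con (pos 0) := (x :- t) :* con (pos 0) :+ c) ≈-refl

  division-step : ∀ c x t q r → c + x * ((x - t) * q + r) ≈ (x - t) * (r + x * q) + (c + t * r)
  division-step = solve 5 (λ c x t q r → c :+ x :* ((x :- t) :* q :+ r) := (x :- t) :* (r :+ x :* q) :+ (c :+ t :* r)) ≈-refl

-- A polynomial is the list of its coefficients, lowest degree first.
module Polynomial (K : FiniteField) where
  open Field K
  open PowerSeries K

  coeff : List Carrier → ℕ → Carrier
  coeff []      i       = 0#
  coeff (c ∷ p) zero    = c
  coeff (c ∷ p) (suc i) = coeff p i

  infixl 6 _⊞_
  infixl 7 _⊠_
  _⊞_ _⊠_ : List Carrier → List Carrier → List Carrier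
  []      ⊞ q       = q
  (a ∷ p) ⊞ []      = a ∷ p
  (a ∷ p) ⊞ (b ∷ q) = (a + b) ∷ (p ⊞ q)

  scale : Carrier → List Carrier → List Carrier
  scale c = map (c *_)

  []      ⊠ q = []
  (a ∷ p) ⊠ q = scale a q ⊞ (0# ∷ p ⊠ q)

  shift : ℕ → List Carrier → List Carrier
  shift n p = replicate n 0# ++ p

  -- multiplication by X + b
  linear : Carrier → List Carrier → List Carrier
  linear b p = scale b p ⊞ shift 1 p

  length-⊞ : ∀ {n} p q → length p ≤ n → length q ≤ n → length (p ⊞ q) ≤ n
  length-⊞ []      q       p≤n       q≤n       = q≤n
  length-⊞ (a ∷ p) []      p≤n       q≤n       = p≤n
  length-⊞ (a ∷ p) (b ∷ q) (s≤s p≤n) (s≤s q≤n) = s≤s (length-⊞ p q p≤n q≤n)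

  length-scale : ∀ c p → length (scale c p) ≡ length p
  length-scale c p = List.length-map (c *_) p

  length-shift : ∀ n p → length (shift n p) ≡ n ℕ.+ length p
  length-shift n p = trans (List.length-++ (replicate n 0#)) (cong (ℕ._+ length p) (List.length-replicate n))

  length-linear : ∀ b p → length (linear b p) ≤ suc (length p)
  length-linear b p = length-⊞ (scale b p) (shift 1 p) (ℕ.m≤n⇒m≤1+n (ℕ.≤-reflexive (length-scale b p))) ℕ.≤-refl

  length-⊠ : ∀ {d e} p q → length p ≤ suc d → length q ≤ suc e → length (p ⊠ q) ≤ suc (d ℕ.+ e)
  length-⊠ []          q _         _   = z≤n
  length-⊠ {d} {e} (a ∷ p) q (s≤s p≤d) q≤e = length-⊞ (scale a q) (0# ∷ p ⊠ q)
    (ℕ.≤-trans (ℕ.≤-reflexive (length-scale a q)) (ℕ.≤-trans q≤e (s≤s (ℕ.m≤n+m e d))))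
    (s≤s (tail d p p≤d))
    where
    tail : ∀ d p → length p ≤ d → length (p ⊠ q) ≤ d ℕ.+ e
    tail zero    []      _   = z≤n
    tail (suc d) p       p≤d = length-⊠ p q p≤d q≤e

  coeff-⊞ : ∀ p q i → coeff (p ⊞ q) i ≡ coeff p i + coeff q i
  coeff-⊞ []      q       i       = sym (+-identityˡ _)
  coeff-⊞ (a ∷ p) []      i       = sym (+-identityʳ _)
  coeff-⊞ (a ∷ p) (b ∷ q) zero    = refl
  coeff-⊞ (a ∷ p) (b ∷ q) (suc i) = coeff-⊞ p q i

  coeff-scale : ∀ c p i → coeff (scale c p) i ≡ c * coeff p i
  coeff-scale c []      i       = sym (zeroʳ c)
  coeff-scale c (a ∷ p) zero    = refl
  coeff-scale c (a ∷ p) (suc i) = coeff-scale c p i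

  coeff-shift-< : ∀ n p {i} → i < n → coeff (shift n p) i ≡ 0#
  coeff-shift-< (suc n) p {zero}  _         = refl
  coeff-shift-< (suc n) p {suc i} (s≤s i<n) = coeff-shift-< n p i<n

  coeff-shift-+ : ∀ n p i → coeff (shift n p) (n ℕ.+ i) ≡ coeff p i
  coeff-shift-+ zero    p i = refl
  coeff-shift-+ (suc n) p i = coeff-shift-+ n p i

  coeff-≥ : ∀ p {i} → length p ≤ i → coeff p i ≡ 0#
  coeff-≥ []      _         = refl
  coeff-≥ (a ∷ p) (s≤s p≤i) = coeff-≥ p p≤i

  coeff-linear : ∀ b p i → coeff (linear b p) (suc i) ≡ b * coeff p (suc i) + coeff p i
  coeff-linear b p i = trans (coeff-⊞ (scale b p) (shift 1 p) (suc i)) (cong (_+ coeff p i) (coeff-scale b p (suc i)))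

  coeff-linear-0 : ∀ b p → coeff (linear b p) 0 ≡ b * coeff p 0
  coeff-linear-0 b p = trans (coeff-⊞ (scale b p) (shift 1 p) 0) (trans (+-identityʳ _) (coeff-scale b p 0))

  record IsHomomorphism (A : CommutativeRing 0ℓ 0ℓ) (ι : Carrier → CommutativeRing.Carrier A) : Set where
    private module A = CommutativeRing A
    field
      ι-+ : ∀ x y → ι (x + y) A.≈ ι x A.+ ι y
      ι-* : ∀ x y → ι (x * y) A.≈ ι x A.* ι y
      ι-0 : ι 0# A.≈ A.0#

  module Evaluation (A : CommutativeRing 0ℓ 0ℓ) (ι : Carrier → CommutativeRing.Carrier A) (hom : IsHomomorphism A ι) where
    private module A = CommutativeRing A
    open IsHomomorphism hom
    open A using (_≈_; +-cong; +-congˡ; +-congʳ; *-cong; *-congˡ; *-congʳ)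
    private module Id = Identities A
    open import Relation.Binary.Reasoning.Setoid A.setoid
    open Exp A.commutativeSemiring using () renaming (_^_ to _^ᴬ_)

    ⟦_⟧ : List Carrier → A.Carrier → A.Carrier
    ⟦_⟧ = horner A._+_ A._*_ A.0# ι

    ⟦⊞⟧ : ∀ p q x → ⟦ p ⊞ q ⟧ x ≈ ⟦ p ⟧ x A.+ ⟦ q ⟧ x
    ⟦⊞⟧ []      q       x = A.sym (A.+-identityˡ _)
    ⟦⊞⟧ (a ∷ p) []      x = A.sym (A.+-identityʳ _)
    ⟦⊞⟧ (a ∷ p) (b ∷ q) x = A.trans (+-cong (ι-+ a b) (*-congˡ (⟦⊞⟧ p q x)))
      (Id.⊞-step (ι a) (ι b) x (⟦ p ⟧ x) (⟦ q ⟧ x))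

    ⟦scale⟧ : ∀ c p x → ⟦ scale c p ⟧ x ≈ ι c A.* ⟦ p ⟧ x
    ⟦scale⟧ c []      x = A.sym (A.zeroʳ _)
    ⟦scale⟧ c (a ∷ p) x = A.trans (+-cong (ι-* c a) (*-congˡ (⟦scale⟧ c p x)))
      (Id.scale-step (ι c) (ι a) x (⟦ p ⟧ x))

    ⟦0∷⟧ : ∀ p x → ⟦ 0# ∷ p ⟧ x ≈ x A.* ⟦ p ⟧ x
    ⟦0∷⟧ p x = A.trans (+-congʳ ι-0) (A.+-identityˡ _)

    ⟦⊠⟧ : ∀ p q x → ⟦ p ⊠ q ⟧ x ≈ ⟦ p ⟧ x A.* ⟦ q ⟧ x
    ⟦⊠⟧ []      q x = A.sym (A.zeroˡ _)
    ⟦⊠⟧ (a ∷ p) q x = begin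
      ⟦ scale a q ⊞ (0# ∷ p ⊠ q) ⟧ x                  ≈⟨ ⟦⊞⟧ (scale a q) (0# ∷ p ⊠ q) x ⟩
      ⟦ scale a q ⟧ x A.+ ⟦ 0# ∷ p ⊠ q ⟧ x            ≈⟨ +-cong (⟦scale⟧ a q x) (A.trans (⟦0∷⟧ (p ⊠ q) x) (*-congˡ (⟦⊠⟧ p q x))) ⟩
      ι a A.* ⟦ q ⟧ x A.+ x A.* (⟦ p ⟧ x A.* ⟦ q ⟧ x) ≈⟨ Id.⊠-step (ι a) x (⟦ p ⟧ x) (⟦ q ⟧ x) ⟩
      (ι a A.+ x A.* ⟦ p ⟧ x) A.* ⟦ q ⟧ x             ∎

    ⟦shift⟧ : ∀ n p x → ⟦ shift n p ⟧ x ≈ x ^ᴬ n A.* ⟦ p ⟧ x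
    ⟦shift⟧ zero    p x = A.sym (A.*-identityˡ _)
    ⟦shift⟧ (suc n) p x = A.trans (⟦0∷⟧ (shift n p) x) (A.trans (*-congˡ (⟦shift⟧ n p x)) (A.sym (A.*-assoc _ _ _)))

    ⟦linear⟧ : ∀ b p x → ⟦ linear b p ⟧ x ≈ (x A.+ ι b) A.* ⟦ p ⟧ x
    ⟦linear⟧ b p x = A.trans (⟦⊞⟧ (scale b p) (shift 1 p) x) (A.trans (+-cong (⟦scale⟧ b p x) (⟦0∷⟧ p x))
      (Id.linear-step (ι b) x (⟦ p ⟧ x)))

    ⟦zero⟧ : ∀ p → (∀ i → coeff p i ≡ 0#) → ∀ x → ⟦ p ⟧ x ≈ A.0#
    ⟦zero⟧ []      p≡0 x = A.refl
    ⟦zero⟧ (c ∷ p) p≡0 x = begin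
      ι c A.+ x A.* ⟦ p ⟧ x   ≈⟨ +-cong (A.trans (A.reflexive (cong ι (p≡0 0))) ι-0) (*-congˡ (⟦zero⟧ p (p≡0 ∘ suc) x)) ⟩
      A.0# A.+ x A.* A.0#     ≈⟨ Id.zero-step x ⟩
      A.0#                    ∎

  id-hom : IsHomomorphism commutativeRing id
  id-hom = record { ι-+ = λ _ _ → refl ; ι-* = λ _ _ → refl ; ι-0 = refl }

  constant-hom : ∀ M → IsHomomorphism (truncated M) constant
  constant-hom M = record { ι-+ = λ x y k _ → constant-+ x y k ; ι-* = λ x y k _ → constant-* x y k ; ι-0 = λ k _ → constant-0 k }

  module Values = Evaluation commutativeRing id id-hom
  open Values public using (⟦_⟧)

  module Expansion (M : ℕ) = Evaluation (truncated M) constant (constant-hom M)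

  -- The truncation order enters only the equality of `truncated M`, never its operations.
  -- Evaluation at order 0 is therefore definitionally the evaluation at every order.
  ⟦_⟧ˢ : List Carrier → Series → Series
  ⟦_⟧ˢ = Expansion.⟦_⟧ 0

  ⟦⟧ˢ-0 : ∀ p x → ⟦ p ⟧ˢ x 0 ≡ ⟦ p ⟧ (x 0)
  ⟦⟧ˢ-0 []      x = refl
  ⟦⟧ˢ-0 (c ∷ p) x = cong (λ z → c + x 0 * z) (⟦⟧ˢ-0 p x)

  -- The values at t of the iterated quotients of p by X; without the first
  -- one they are the coefficients of the quotient of p by X - t.
  division : Carrier → List Carrier → List Carrier
  division t []      = []
  division t (c ∷ p) = ⟦ c ∷ p ⟧ t ∷ division t p

  length-division : ∀ t p → length (division t p) ≡ length p
  length-division t []      = refl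
  length-division t (c ∷ p) = cong suc (length-division t p)

  -- By induction the tail is the zero polynomial, so the first entry c + t · 0 of the quotient list
  -- is the lowest coefficient itself.
  coeff-division : ∀ t p → (∀ i → coeff (division t p) i ≡ 0#) → ∀ i → coeff p i ≡ 0#
  coeff-division t []      d≡0 i       = refl
  coeff-division t (c ∷ p) d≡0 (suc i) = coeff-division t p (d≡0 ∘ suc) i
  coeff-division t (c ∷ p) d≡0 zero    = begin
    c                   ≡⟨ solve 2 (λ c t → c := c :+ t :* con (pos 0)) refl c t ⟩
    c + t * 0#          ≡⟨ cong (λ z → c + t * z) (Values.⟦zero⟧ p (coeff-division t p (d≡0 ∘ suc)) t) ⟨
    c + t * ⟦ p ⟧ t     ≡⟨ d≡0 0 ⟩
    0#                  ∎
    where open ≡-Reasoning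

  -- Synthetic division, evaluated at a series. The induction step multiplies the identity for the
  -- tail by x and splits x r as (x - t) r + t r.
  division-correct : ∀ M t c p x → let module A = CommutativeRing (truncated M) in
    ⟦ c ∷ p ⟧ˢ x A.≈ (x A.- constant t) A.* ⟦ division t p ⟧ˢ x A.+ constant (⟦ c ∷ p ⟧ t)
  division-correct M t c [] x = begin
    constant c A.+ x A.* A.0#                                             ≈⟨ Id.division-base (constant c) x (constant t) ⟩
    (x A.- constant t) A.* A.0# A.+ constant c                            ≡⟨ cong (λ z → (x A.- constant t) A.* A.0# A.+ constant z) (solve 2 (λ c t → c := c :+ t :* con (pos 0)) refl c t) ⟩
    (x A.- constant t) A.* A.0# A.+ constant (c + t * 0#)                 ∎
    where
    module A = CommutativeRing (truncated M)
    module Id = Identities (truncated M)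
    open import Relation.Binary.Reasoning.Setoid A.setoid
  division-correct M t c (d ∷ p) x = begin
    constant c A.+ x A.* ⟦ d ∷ p ⟧ˢ x
      ≈⟨ A.+-congˡ {constant c} (A.*-congˡ {x} (division-correct M t d p x)) ⟩
    constant c A.+ x A.* ((x A.- constant t) A.* ⟦ division t p ⟧ˢ x A.+ constant r)
      ≈⟨ Id.division-step (constant c) x (constant t) (⟦ division t p ⟧ˢ x) (constant r) ⟩
    (x A.- constant t) A.* (constant r A.+ x A.* ⟦ division t p ⟧ˢ x) A.+ (constant c A.+ constant t A.* constant r)
      ≈⟨ A.+-congˡ {(x A.- constant t) A.* (constant r A.+ x A.* ⟦ division t p ⟧ˢ x)} (A.sym (ι-hom c t r)) ⟩
    (x A.- constant t) A.* (constant r A.+ x A.* ⟦ division t p ⟧ˢ x) A.+ constant (c + t * r) ∎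
    where
    module A = CommutativeRing (truncated M)
    module Id = Identities (truncated M)
    r = ⟦ d ∷ p ⟧ t
    ι-hom : ∀ c t r → constant (c + t * r) A.≈ constant c A.+ constant t A.* constant r
    ι-hom c t r k _ = trans (constant-+ c (t * r) k) (cong (constant c k +_) (constant-* t r k))
    open import Relation.Binary.Reasoning.Setoid A.setoid

  line : Carrier → Carrier → Series
  line t c k = constant t k + (constant c ⊛ V) k

  -- The order of vanishing at t, read off from the expansion at X = t + c V. It is meaningful in
  -- every characteristic, and rescaling V by a nonzero c does not change it; this freedom is later
  -- used with c = f(t).
  VanishesAt : Carrier → Carrier → List Carrier → ℕ → Set
  VanishesAt t c p m = ∀ k → k < m → ⟦ p ⟧ˢ (line t c) k ≡ 0#

  ⊛-lowest : ∀ p u k → (∀ i → i < k → p i ≡ 0#) → (p ⊛ u) k ≡ p k * u 0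
  ⊛-lowest p u zero    p≡0 = refl
  ⊛-lowest p u (suc k) p≡0 = begin
    p 0 * u (suc k) + ((p ∘ suc) ⊛ u) k    ≡⟨ cong₂ (λ a b → a * u (suc k) + b) (p≡0 0 (s≤s z≤n)) (⊛-lowest (p ∘ suc) u k (λ i i<k → p≡0 (suc i) (s≤s i<k))) ⟩
    0# * u (suc k) + p (suc k) * u 0       ≡⟨ solve 2 (λ a b → con (pos 0) :* a :+ b := b) refl (u (suc k)) (p (suc k) * u 0) ⟩
    p (suc k) * u 0                        ∎
    where open ≡-Reasoning

  -- The lowest nonzero coefficient of `p` would survive in the product, multiplied by `u 0`.
  ⊛-cancel-unit : ∀ p u m → u 0 ≢ 0# → (∀ k → k < m → (p ⊛ u) k ≡ 0#) → ∀ k → k < m → p k ≡ 0#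
  ⊛-cancel-unit p u m u₀≢0 pu≡0 k k<m = below (suc k) k<m k ℕ.≤-refl
    where
    below : ∀ k → k ≤ m → ∀ i → i < k → p i ≡ 0#
    below (suc k) k<m i i<1+k with ℕ.m≤n⇒m<n∨m≡n (ℕ.≤-pred i<1+k)
    ... | inj₁ i<k  = below k (ℕ.<⇒≤ k<m) i i<k
    ... | inj₂ refl = [ id , (λ u₀≡0 → contradiction u₀≡0 u₀≢0) ]′ (*≡0⇒ (p k) (u 0)
      (trans (sym (⊛-lowest p u k (below k (ℕ.<⇒≤ k<m)))) (pu≡0 k k<m)))

  line-0 : ∀ t c → line t c 0 ≡ t
  line-0 t c = solve 2 (λ t c → t :+ c :* con (pos 0) := t) refl t c

  ⟦line⟧-0 : ∀ t c p → ⟦ p ⟧ˢ (line t c) 0 ≡ ⟦ p ⟧ t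
  ⟦line⟧-0 t c p = trans (⟦⟧ˢ-0 p (line t c)) (cong ⟦ p ⟧ (line-0 t c))

  root-factor : ∀ {t a p₀} → ⟦ a ∷ p₀ ⟧ t ≡ 0# → ∀ x k →
                ⟦ a ∷ p₀ ⟧ˢ x k ≡ ((λ i → x i + - constant t i) ⊛ ⟦ division t p₀ ⟧ˢ x) k
  root-factor {t} {a} {p₀} r≡0 x k = begin
    ⟦ a ∷ p₀ ⟧ˢ x k                                                                         ≡⟨ division-correct (suc k) t a p₀ x k ℕ.≤-refl ⟩
    ((λ i → x i + - constant t i) ⊛ ⟦ division t p₀ ⟧ˢ x) k + constant (⟦ a ∷ p₀ ⟧ t) k     ≡⟨ cong (λ r → ((λ i → x i + - constant t i) ⊛ ⟦ division t p₀ ⟧ˢ x) k + constant r k) r≡0 ⟩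
    ((λ i → x i + - constant t i) ⊛ ⟦ division t p₀ ⟧ˢ x) k + constant 0# k                 ≡⟨ cong (((λ i → x i + - constant t i) ⊛ ⟦ division t p₀ ⟧ˢ x) k +_) (constant-0 k) ⟩
    ((λ i → x i + - constant t i) ⊛ ⟦ division t p₀ ⟧ˢ x) k + 0#                            ≡⟨ +-identityʳ _ ⟩
    ((λ i → x i + - constant t i) ⊛ ⟦ division t p₀ ⟧ˢ x) k                                 ∎
    where
    open ≡-Reasoning

  -- At X = t + c V the divisor X - t equals c V, so dividing by it costs exactly one order of
  -- vanishing.
  division-same : ∀ {t c a p₀ m} → c ≢ 0# → ⟦ a ∷ p₀ ⟧ t ≡ 0# →
                  VanishesAt t c (a ∷ p₀) (suc m) → VanishesAt t c (division t p₀) m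
  division-same {t} {c} {a} {p₀} {m} c≢0 r≡0 van k k<m = [ (λ c≡0 → contradiction c≡0 c≢0) , id ]′ (*≡0⇒ c (q k) (begin
    c * q k                                             ≡⟨ cong (c *_) (V-⊛ q k) ⟨
    c * (V ⊛ q) (suc k)                                 ≡⟨ constant-⊛ c (V ⊛ q) (suc k) ⟨
    (constant c ⊛ (V ⊛ q)) (suc k)                      ≡⟨ ⊛-assoc (constant c) V q (suc k) ⟨
    ((constant c ⊛ V) ⊛ q) (suc k)                      ≡⟨ ⊛-cong (suc k) (λ i _ → solve 2 (λ a b → b := a :+ b :+ :- a) refl (constant t i) ((constant c ⊛ V) i)) (λ _ _ → refl) ⟩
    ((λ i → line t c i + - constant t i) ⊛ q) (suc k)   ≡⟨ root-factor {t} {a} {p₀} r≡0 (line t c) (suc k) ⟨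
    ⟦ a ∷ p₀ ⟧ˢ (line t c) (suc k)                      ≡⟨ van (suc k) (s≤s k<m) ⟩
    0#                                                  ∎))
    where
    open ≡-Reasoning
    q = ⟦ division t p₀ ⟧ˢ (line t c)

  -- At X = s + c V the divisor X - t has the nonzero constant term s - t and can be cancelled.
  division-other : ∀ {s t c a p₀ m} → t ≢ s → ⟦ a ∷ p₀ ⟧ t ≡ 0# →
                   VanishesAt s c (a ∷ p₀) m → VanishesAt s c (division t p₀) m
  division-other {s} {t} {c} {a} {p₀} {m} t≢s r≡0 van = ⊛-cancel-unit q (λ i → line s c i + - constant t i) m
    (λ ≡0 → t≢s (sym (-‿≡0⇒≡ (trans (cong (_+ - t) (sym (line-0 s c))) ≡0))))
    (λ k k<m → trans (⊛-comm q _ k) (trans (sym (root-factor {t} {a} {p₀} r≡0 (line s c) k)) (van k k<m)))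
    where q = ⟦ division t p₀ ⟧ˢ (line s c)

  -- Each zero, counted with multiplicity, allows one division by a linear factor, which shortens
  -- the coefficient list by one. The zeros suffice to exhaust the list, and `coeff-division` then
  -- carries the vanishing back to `p`.
  multiplicity-bound : ∀ (c : Carrier → Carrier) p M T → Unique T → All (λ t → c t ≢ 0#) T →
                       All (λ t → VanishesAt t (c t) p M) T → length p ≤ length T ℕ.* M → ∀ i → coeff p i ≡ 0#
  multiplicity-bound c p M = start p
    where
    Regular : Carrier → Set
    Regular t = c t ≢ 0#

    go : ∀ p t m T → All (t ≢_) T → Unique T → Regular t → All Regular T → VanishesAt t (c t) p m →
         All (λ t → VanishesAt t (c t) p M) T → length p ≤ m ℕ.+ length T ℕ.* M → ∀ i → coeff p i ≡ 0#
    go []       t m       T         _   _         _   _         _   _         _   i = refl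
    go (a ∷ p₀) t (suc m) T         t∉T uniq      reg regs      van vans      len i =
      coeff-division t (a ∷ p₀) (λ { zero → root ; (suc i) → rest i }) i
      where
      root : ⟦ a ∷ p₀ ⟧ t ≡ 0#
      root = trans (sym (⟦line⟧-0 t (c t) (a ∷ p₀))) (van 0 (s≤s z≤n))
      rest : ∀ i → coeff (division t p₀) i ≡ 0#
      rest = go (division t p₀) t m T t∉T uniq reg regs (division-same {a = a} {p₀} reg root van)
        (All.zipWith (λ (t≢s , v) → division-other {a = a} {p₀} t≢s root v) (t∉T , vans))
        (ℕ.≤-trans (ℕ.≤-reflexive (length-division t p₀)) (ℕ.≤-pred len))
    -- The multiplicity at `t` is used up; the next point takes over with its full multiplicity `M`,
    -- untouched by the previous divisions.
    go (a ∷ p₀) t zero    (s ∷ T)   _   (s∉T ∷ u) _   (reg ∷ r) _   (van ∷ v) len = go (a ∷ p₀) s M T s∉T u reg r van v len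

    start : ∀ p T → Unique T → All Regular T → All (λ t → VanishesAt t (c t) p M) T → length p ≤ length T ℕ.* M → ∀ i → coeff p i ≡ 0#
    start []      []      _         _         _         _   i = refl
    start p       (t ∷ T) (t∉T ∷ u) (reg ∷ r) (van ∷ v) len = go p t M T t∉T u reg r van v len

  roots-bound : ∀ p T → Unique T → All (λ t → ⟦ p ⟧ t ≡ 0#) T → length p ≤ length T → ∀ i → coeff p i ≡ 0#
  roots-bound p T uniq roots len = multiplicity-bound (λ _ → 1#) p 1 T uniq
    (All.tabulate (λ _ 1≡0 → 0≢1 (sym 1≡0)))
    (All.map (λ {t} r k k<1 → subst (λ k → ⟦ p ⟧ˢ (line t 1#) k ≡ 0#) (sym (ℕ.n<1⇒n≡0 k<1)) (trans (⟦line⟧-0 t 1# p) r)) roots)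
    (ℕ.≤-trans len (ℕ.≤-reflexive (sym (ℕ.*-identityʳ (length T)))))

-- Series depending polynomially on the expansion point, and the Frobenius map

private
  degree-sum₀ : ∀ d e m → d ℕ.+ 0 ℕ.+ (e ℕ.+ m) ≡ d ℕ.+ e ℕ.+ m
  degree-sum₀ = solve 3 (λ d e m → d :+ con 0 :+ (e :+ m) := d :+ e :+ m) refl
    where open +-*-Solver

  degree-sum₁ : ∀ d e n m → d ℕ.+ n ℕ.+ e ℕ.+ m ≡ d ℕ.+ e ℕ.+ (n ℕ.+ m)
  degree-sum₁ = solve 4 (λ d e n m → d :+ n :+ e :+ m := d :+ e :+ (n :+ m)) refl
    where open +-*-Solver

module ExpansionIdentities (A : CommutativeRing 0ℓ 0ℓ) where
  open CommutativeRing A using (Carrier; _≈_; _+_; _*_; _-_; -_; 0#; 1#) renaming (refl to ≈-refl)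
  open IntegerSolver A

  powers-step : ∀ x t p y → (x + t) * (p - y) + y * (t + x * 0#) ≈ (x + t) * p - x * y
  powers-step = solve 4 (λ x t p y → (x :+ t) :* (p :- y) :+ y :* (t :+ x :* con (pos 0)) := (x :+ t) :* p :- x :* y) ≈-refl

  frobenius-step : ∀ p y t → p ≈ (p - y + (- t + y * 0#)) + (y + t)
  frobenius-step = solve 3 (λ p y t → p := (p :- y :+ (:- t :+ y :* con (pos 0))) :+ (y :+ t)) ≈-refl

  constant-step : ∀ p y t x → p - y + (- t + x * 0#) ≈ p - (y + t)
  constant-step = solve 4 (λ p y t x → p :- y :+ (:- t :+ x :* con (pos 0)) := p :- (y :+ t)) ≈-refl

  taylor-step : ∀ t y b p q → (t + y + b) * (p + y * q) ≈ (t + b) * p + y * ((t + y + b) * q + p)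
  taylor-step = solve 5 (λ t y b p q → (t :+ y :+ b) :* (p :+ y :* q) := (t :+ b) :* p :+ y :* ((t :+ y :+ b) :* q :+ p)) ≈-refl

  taylor-base : ∀ y → 1# ≈ 1# + y * 0#
  taylor-base = solve 1 (λ y → con (pos 1) := con (pos 1) :+ y :* con (pos 0)) ≈-refl

  factor-out : ∀ c v q → c + c * v * q ≈ c * (1# + v * q)
  factor-out = solve 3 (λ c v q → c :+ c :* v :* q := c :* (con (pos 1) :+ v :* q)) ≈-refl

module PolynomialFunctions (K : FiniteField) where
  open Field K
  open PowerSeries K
  open Polynomial K

  record IsPolynomial (d : ℕ) (φ : Carrier → Carrier) : Set where
    field
      poly    : List Carrier
      degree  : length poly ≤ suc d
      correct : ∀ t → ⟦ poly ⟧ t ≡ φ t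

  open IsPolynomial public

  weaken : ∀ {d e φ} → d ≤ e → IsPolynomial d φ → IsPolynomial e φ
  weaken d≤e P = record { poly = poly P ; degree = ℕ.≤-trans (degree P) (s≤s d≤e) ; correct = correct P }

  respects : ∀ {d φ ψ} → φ ≗ ψ → IsPolynomial d φ → IsPolynomial d ψ
  respects φ≗ψ P = record { poly = poly P ; degree = degree P ; correct = λ t → trans (correct P t) (φ≗ψ t) }

  const-poly : ∀ c → IsPolynomial 0 (λ _ → c)
  const-poly c = record { poly = c ∷ [] ; degree = ℕ.≤-refl ; correct = λ t → trans (cong (c +_) (zeroʳ t)) (+-identityʳ c) }

  var-poly : IsPolynomial 1 id
  var-poly = record { poly = 0# ∷ 1# ∷ [] ; degree = ℕ.≤-refl
                    ; correct = solve 1 (λ t → con (pos 0) :+ t :* (con (pos 1) :+ t :* con (pos 0)) := t) refl }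

  +-poly : ∀ {d φ ψ} → IsPolynomial d φ → IsPolynomial d ψ → IsPolynomial d (λ t → φ t + ψ t)
  +-poly P Q = record
    { poly = poly P ⊞ poly Q
    ; degree = length-⊞ (poly P) (poly Q) (degree P) (degree Q)
    ; correct = λ t → trans (Values.⟦⊞⟧ (poly P) (poly Q) t) (cong₂ _+_ (correct P t) (correct Q t)) }

  *-poly : ∀ {d e φ ψ} → IsPolynomial d φ → IsPolynomial e ψ → IsPolynomial (d ℕ.+ e) (λ t → φ t * ψ t)
  *-poly P Q = record
    { poly = poly P ⊠ poly Q
    ; degree = length-⊠ (poly P) (poly Q) (degree P) (degree Q)
    ; correct = λ t → trans (Values.⟦⊠⟧ (poly P) (poly Q) t) (cong₂ _*_ (correct P t) (correct Q t)) }

  -- V has weight n, since it comes with the factor f t of degree n in the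
  -- expansion point X = t + f t V.
  IsPolynomialSeries : ℕ → ℕ → (Carrier → Series) → Set
  IsPolynomialSeries n d Φ = ∀ k → IsPolynomial (d ℕ.+ k ℕ.* n) (λ t → Φ t k)

  module _ {n : ℕ} where
    weaken-series : ∀ {d e Φ} → d ≤ e → IsPolynomialSeries n d Φ → IsPolynomialSeries n e Φ
    weaken-series d≤e P k = weaken (ℕ.+-monoˡ-≤ (k ℕ.* n) d≤e) (P k)

    constant-series : ∀ {d φ} → IsPolynomial d φ → IsPolynomialSeries n d (λ t → constant (φ t))
    constant-series {d} P zero    = weaken (ℕ.m≤m+n d 0) P
    constant-series     P (suc k) = weaken z≤n (const-poly 0#)

    +-series : ∀ {d Φ Ψ} → IsPolynomialSeries n d Φ → IsPolynomialSeries n d Ψ → IsPolynomialSeries n d (λ t k → Φ t k + Ψ t k)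
    +-series P Q k = +-poly (P k) (Q k)

    ⊛-series : ∀ {d e Φ Ψ} → IsPolynomialSeries n d Φ → IsPolynomialSeries n e Ψ → IsPolynomialSeries n (d ℕ.+ e) (λ t → Φ t ⊛ Ψ t)
    ⊛-series {d} {e} P Q zero = weaken (ℕ.≤-reflexive (degree-sum₀ d e 0)) (*-poly (P 0) (Q 0))
    ⊛-series {d} {e} {Φ} {Ψ} P Q (suc k) = +-poly
      (weaken (ℕ.≤-reflexive (degree-sum₀ d e (suc k ℕ.* n))) (*-poly (P 0) (Q (suc k))))
      (weaken (ℕ.≤-reflexive (degree-sum₁ d e n (k ℕ.* n)))
        (⊛-series {d ℕ.+ n} {e} {λ t → Φ t ∘ suc} (λ k → weaken (ℕ.≤-reflexive (sym (ℕ.+-assoc d n (k ℕ.* n)))) (P (suc k))) Q k))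

    -- Multiplication by V moves every coefficient up by one place, which pays for n degrees. This
    -- is why 1 + V (...) can have weight 0, and with it all its powers, however large the exponent.
    V-⊛-series : ∀ {d Φ} → d ≤ n → IsPolynomialSeries n d Φ → IsPolynomialSeries n 0 (λ t → V ⊛ Φ t)
    V-⊛-series {Φ = Φ} d≤n P zero    = respects (λ t → sym (zeroˡ (Φ t 0))) (const-poly 0#)
    V-⊛-series {Φ = Φ} d≤n P (suc k) = respects (λ t → sym (V-⊛ (Φ t) k)) (weaken (ℕ.+-monoˡ-≤ (k ℕ.* n) d≤n) (P k))

    line-series : ∀ {φ} → IsPolynomial n φ → IsPolynomialSeries n 1 (λ t → line t (φ t))
    line-series {φ} P zero    = respects (λ t → sym (line-0 t (φ t))) var-poly
    line-series {φ} P (suc k) = respects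
      (λ t → sym (trans (+-identityˡ _) (constant-⊛ (φ t) V (suc k))))
      (weaken (ℕ.≤-trans (ℕ.≤-reflexive (ℕ.+-identityʳ n)) (ℕ.m≤n⇒m≤1+n (ℕ.m≤m+n n (k ℕ.* n)))) (*-poly P (const-poly (constant 1# k))))

    horner-series : ∀ {Φ} p → IsPolynomialSeries n 1 Φ → IsPolynomialSeries n (length p) (λ t → ⟦ p ⟧ˢ (Φ t))
    horner-series []      P k = weaken z≤n (const-poly 0#)
    horner-series (c ∷ p) P   = +-series (weaken-series z≤n (constant-series (const-poly c))) (⊛-series P (horner-series p P))

module Frobenius (K : FiniteField) where
  open Field K
  open PowerSeries K
  open Polynomial K

  0<order : 0 < order
  0<order = ℕ.≤-<-trans z≤n (Fin.toℕ<n (index 0#))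

  -- (X + t) ^ m - X ^ m
  powers : Carrier → ℕ → List Carrier
  powers t zero    = []
  powers t (suc m) = linear t (powers t m) ⊞ shift m (t ∷ [])

  length-powers : ∀ t m → length (powers t m) ≤ m
  length-powers t zero    = z≤n
  length-powers t (suc m) = length-⊞ (linear t (powers t m)) (shift m (t ∷ []))
    (ℕ.≤-trans (length-linear t (powers t m)) (s≤s (length-powers t m)))
    (ℕ.≤-reflexive (trans (length-shift m (t ∷ [])) (ℕ.+-comm m 1)))

  module _ (A : CommutativeRing 0ℓ 0ℓ) (ι : Carrier → CommutativeRing.Carrier A) (hom : IsHomomorphism A ι) where
    private module A = CommutativeRing A
    open Evaluation A ι hom renaming (⟦_⟧ to ⟦_⟧ᴬ)
    open Exp A.commutativeSemiring using () renaming (_^_ to _^ᴬ_)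
    private module Id = ExpansionIdentities A

    ⟦powers⟧ : ∀ t m x → ⟦ powers t m ⟧ᴬ x A.≈ (x A.+ ι t) ^ᴬ m A.- x ^ᴬ m
    ⟦powers⟧ t zero    x = A.sym (A.-‿inverseʳ A.1#)
    ⟦powers⟧ t (suc m) x = A.trans (⟦⊞⟧ (linear t (powers t m)) (shift m (t ∷ [])) x) (A.trans
      (A.+-cong (A.trans (⟦linear⟧ t (powers t m) x) (A.*-congˡ (⟦powers⟧ t m x))) (⟦shift⟧ m (t ∷ []) x))
      (Id.powers-step x (ι t) ((x A.+ ι t) ^ᴬ m) (x ^ᴬ m)))

  -- It has degree < q and all elements of K as roots, so (X + t) ^ q = X ^ q + t.
  defect : Carrier → List Carrier
  defect t = powers t order ⊞ (- t ∷ [])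

  defect-zero : ∀ t i → coeff (defect t) i ≡ 0#
  defect-zero t = roots-bound (defect t) elements elements-unique
    (All.tabulate λ {x} _ → root x)
    (ℕ.≤-trans (length-⊞ (powers t order) (- t ∷ []) (length-powers t order) 0<order) (ℕ.≤-reflexive (sym length-elements)))
    where
    open ≡-Reasoning
    module Id = ExpansionIdentities commutativeRing
    root : ∀ x → ⟦ defect t ⟧ x ≡ 0#
    root x = begin
      ⟦ defect t ⟧ x                                            ≡⟨ Values.⟦⊞⟧ (powers t order) (- t ∷ []) x ⟩
      ⟦ powers t order ⟧ x + (- t + x * 0#)                     ≡⟨ cong (_+ (- t + x * 0#)) (⟦powers⟧ commutativeRing id id-hom t order x) ⟩
      (x + t) ↑ order + - (x ↑ order) + (- t + x * 0#)          ≡⟨ Id.constant-step ((x + t) ↑ order) (x ↑ order) t x ⟩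
      (x + t) ↑ order + - (x ↑ order + t)                       ≡⟨ cong₂ (λ u v → u + - (v + t)) (frobenius (x + t)) (frobenius x) ⟩
      x + t + - (x + t)                                         ≡⟨ -‿inverseʳ (x + t) ⟩
      0#                                                        ∎

  module _ {M : ℕ} (M≤q : M ≤ order) where
    private module A = CommutativeRing (truncated M)
    open Exp A.commutativeSemiring using () renaming (_^_ to _^ᴬ_)

    high-power : ∀ c m k → k < m → ((constant c ⊛ V) ^ᴬ m) k ≡ 0#
    high-power c (suc m) k k<1+m = trans (⊛-assoc (constant c) V _ k) (trans (constant-⊛ c _ k) (lower k k<1+m))
      where
      lower : ∀ k → k < suc m → c * (V ⊛ (constant c ⊛ V) ^ᴬ m) k ≡ 0#
      lower zero    _         = trans (cong (c *_) (zeroˡ _)) (zeroʳ c)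
      lower (suc k) (s≤s k<m) = trans (cong (c *_) (trans (V-⊛ _ k) (high-power c m k k<m))) (zeroʳ c)

    -- Since (X + t) ^ q = X ^ q + t holds coefficientwise and not only for the values in K, the
    -- series c V may be substituted for X. Its q-th power vanishes modulo V ^ M because M ≤ q.
    frobenius-line : ∀ t c → line t c ^ᴬ order A.≈ constant t
    frobenius-line t c = begin
      line t c ^ᴬ order
        ≈⟨ ^-congˡ order (A.+-comm (constant t) w) ⟩
      (w A.+ constant t) ^ᴬ order
        ≈⟨ Id.frobenius-step ((w A.+ constant t) ^ᴬ order) (w ^ᴬ order) (constant t) ⟩
      ((w A.+ constant t) ^ᴬ order A.- w ^ᴬ order A.+ (A.- constant t A.+ w ^ᴬ order A.* A.0#)) A.+ (w ^ᴬ order A.+ constant t)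
        ≈⟨ A.+-congʳ {w ^ᴬ order A.+ constant t} vanishing ⟩
      A.0# A.+ (w ^ᴬ order A.+ constant t)
        ≈⟨ A.+-identityˡ (w ^ᴬ order A.+ constant t) ⟩
      w ^ᴬ order A.+ constant t
        ≈⟨ A.+-congʳ {constant t} (λ k k<M → high-power c order k (ℕ.<-≤-trans k<M M≤q)) ⟩
      A.0# A.+ constant t
        ≈⟨ A.+-identityˡ (constant t) ⟩
      constant t ∎
      where
      open import Relation.Binary.Reasoning.Setoid A.setoid
      open Exp A.commutativeSemiring using (^-congˡ)
      module Id = ExpansionIdentities (truncated M)
      module E = Expansion M
      w = constant c ⊛ V
      -constant : ∀ k → - constant t k ≡ constant (- t) k
      -constant zero    = refl
      -constant (suc k) = solve 0 (:- con (pos 0) := con (pos 0)) refl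
      vanishing : (w A.+ constant t) ^ᴬ order A.- w ^ᴬ order A.+ (A.- constant t A.+ w ^ᴬ order A.* A.0#) A.≈ A.0#
      vanishing = begin
        (w A.+ constant t) ^ᴬ order A.- w ^ᴬ order A.+ (A.- constant t A.+ w ^ᴬ order A.* A.0#)
          ≈⟨ A.+-cong (A.sym (⟦powers⟧ (truncated M) constant (constant-hom M) t order w)) (A.+-cong (λ k _ → -constant k) (A.trans (A.zeroʳ (w ^ᴬ order)) (A.sym (A.zeroʳ w)))) ⟩
        ⟦ powers t order ⟧ˢ w A.+ ⟦ - t ∷ [] ⟧ˢ w
          ≈⟨ A.sym (E.⟦⊞⟧ (powers t order) (- t ∷ []) w) ⟩
        ⟦ defect t ⟧ˢ w
          ≈⟨ E.⟦zero⟧ (defect t) (defect-zero t) w ⟩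
        A.0# ∎

-- Stepanov's method

-- Vectors of length n and m over a set of q elements are coded as numbers below q ^ n and q ^ m, so
-- a map to shorter vectors must repeat a value.
pigeonhole : ∀ {X : Set} {q m n} (index : X → Fin q) (element : Fin q → X) → (∀ x → element (index x) ≡ x) → 1 < q → m < n →
             (∀ {i j} → element i ≡ element j → i ≡ j) → (h : (Fin n → X) → Fin m → X) → ∃[ c ] ∃[ c′ ] (h c ≗ h c′ × ¬ c ≗ c′)
pigeonhole {X} {q} {m} {n} index element ei 1<q m<n inj h
  with Fin.pigeonhole (ℕ.^-monoʳ-< q 1<q m<n) (λ i → funToFin (index ∘ h (element ∘ finToFun {q} {n} i)))
... | i , j , i<j , eq = element ∘ finToFun i , element ∘ finToFun j , same , λ c≗c′ → ℕ.<⇒≢ i<j (cong toℕ (begin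
  i                        ≡⟨ Fin.funToFin-finToFin {n} {q} i ⟨
  funToFin (finToFun {q} {n} i)    ≡⟨ funToFin-cong (λ x → inj (c≗c′ x)) ⟩
  funToFin (finToFun {q} {n} j)    ≡⟨ Fin.funToFin-finToFin {n} {q} j ⟩
  j                        ∎))
  where
  open ≡-Reasoning
  funToFin-cong : ∀ {n} {f g : Fin n → Fin q} → f ≗ g → funToFin f ≡ funToFin g
  funToFin-cong {zero}  f≗g = refl
  funToFin-cong {suc n} f≗g = cong₂ combine (f≗g zero) (funToFin-cong (f≗g ∘ suc))
  same : h (element ∘ finToFun i) ≗ h (element ∘ finToFun j)
  same x = begin
    h (element ∘ finToFun i) x                                                      ≡⟨ ei _ ⟨
    element (index (h (element ∘ finToFun i) x))                                    ≡⟨ cong element (Fin.finToFun-funToFin (index ∘ h (element ∘ finToFun i)) x) ⟨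
    element (finToFun (funToFin (index ∘ h (element ∘ finToFun i))) x)              ≡⟨ cong (λ z → element (finToFun z x)) eq ⟩
    element (finToFun (funToFin (index ∘ h (element ∘ finToFun j))) x)              ≡⟨ cong element (Fin.finToFun-funToFin (index ∘ h (element ∘ finToFun j)) x) ⟩
    element (index (h (element ∘ finToFun j) x))                                    ≡⟨ ei _ ⟩
    h (element ∘ finToFun j) x                                                      ∎

-- The auxiliary polynomial

module Products (K : FiniteField) where
  open Field K
  open Polynomial K

  linears : List Carrier → List Carrier → List Carrier
  linears bs p = foldr linear p bs

  linears^ : List Carrier → ℕ → List Carrier → List Carrier
  linears^ bs zero    p = p
  linears^ bs (suc a) p = linears bs (linears^ bs a p)

  value : List Carrier → Carrier → Carrier
  value bs t = foldr (λ b z → (t + b) * z) 1# bs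

  value-roots : ∀ bs {x} → value bs x ≡ 0# → x ∈ˡ map -_ bs
  value-roots []       1≡0 = contradiction (sym 1≡0) 0≢1
  value-roots (b ∷ bs) {x} ≡0 with *≡0⇒ (x + b) (value bs x) ≡0
  ... | inj₁ x+b≡0 = here (-‿≡0⇒≡ (trans (cong (x +_) (solve 1 (λ b → :- (:- b) := b) refl b)) x+b≡0))
  ... | inj₂ v≡0   = there (value-roots bs v≡0)

  length-linears : ∀ bs p → length (linears bs p) ≤ length bs ℕ.+ length p
  length-linears []       p = ℕ.≤-refl
  length-linears (b ∷ bs) p = ℕ.≤-trans (length-linear b (linears bs p)) (s≤s (length-linears bs p))

  length-linears^ : ∀ bs a p → length (linears^ bs a p) ≤ a ℕ.* length bs ℕ.+ length p
  length-linears^ bs zero    p = ℕ.≤-refl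
  length-linears^ bs (suc a) p = ℕ.≤-trans (length-linears bs (linears^ bs a p))
    (ℕ.≤-trans (ℕ.+-monoʳ-≤ (length bs) (length-linears^ bs a p)) (ℕ.≤-reflexive (sym (ℕ.+-assoc (length bs) _ _))))

  Agree : ℕ → List Carrier → List Carrier → Set
  Agree m p p′ = ∀ i → i < m → coeff p i ≡ coeff p′ i

  agree-linear : ∀ b {m p p′} → Agree m p p′ → Agree m (linear b p) (linear b p′)
  agree-linear b {p = p} {p′} p≈p′ zero    0<m = trans (coeff-linear-0 b p) (trans (cong (b *_) (p≈p′ 0 0<m)) (sym (coeff-linear-0 b p′)))
  agree-linear b {p = p} {p′} p≈p′ (suc i) i<m = trans (coeff-linear b p i) (trans
    (cong₂ (λ u v → b * u + v) (p≈p′ (suc i) i<m) (p≈p′ i (ℕ.<-trans (ℕ.n<1+n i) i<m))) (sym (coeff-linear b p′ i)))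

  agree-linear⁻ : ∀ b → b ≢ 0# → ∀ {m p p′} → Agree m (linear b p) (linear b p′) → Agree m p p′
  agree-linear⁻ b b≢0 {p = p} {p′} lp≈ zero    0<m = *-cancelˡ b≢0 (trans (sym (coeff-linear-0 b p)) (trans (lp≈ 0 0<m) (coeff-linear-0 b p′)))
  agree-linear⁻ b b≢0 {p = p} {p′} lp≈ (suc i) i<m = *-cancelˡ b≢0 (begin
    b * coeff p (suc i)                                   ≡⟨ solve 2 (λ u v → u := u :+ v :- v) refl _ (coeff p i) ⟩
    b * coeff p (suc i) + coeff p i + - coeff p i         ≡⟨ cong₂ (λ u v → u + - v) (trans (sym (coeff-linear b p i)) (trans (lp≈ (suc i) i<m) (coeff-linear b p′ i)))
                                                               (agree-linear⁻ b b≢0 {p = p} {p′} lp≈ i (ℕ.<-trans (ℕ.n<1+n i) i<m)) ⟩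
    b * coeff p′ (suc i) + coeff p′ i + - coeff p′ i      ≡⟨ solve 2 (λ u v → u :+ v :- v := u) refl _ (coeff p′ i) ⟩
    b * coeff p′ (suc i)                                  ∎)
    where open ≡-Reasoning

  coeff-linear-zero : ∀ p i → coeff (linear 0# p) (suc i) ≡ coeff p i
  coeff-linear-zero p i = trans (coeff-linear 0# p i) (solve 2 (λ u v → con (pos 0) :* u :+ v := v) refl (coeff p (suc i)) (coeff p i))

  agree-linear-zero : ∀ {m p p′} → Agree m p p′ → Agree (suc m) (linear 0# p) (linear 0# p′)
  agree-linear-zero {p = p} {p′} p≈p′ zero    _         = trans (coeff-linear-0 0# p) (trans (zeroˡ _) (sym (trans (coeff-linear-0 0# p′) (zeroˡ _))))
  agree-linear-zero {p = p} {p′} p≈p′ (suc i) (s≤s i<m) = trans (coeff-linear-zero p i) (trans (p≈p′ i i<m) (sym (coeff-linear-zero p′ i)))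

  agree-linear-zero⁻ : ∀ {m p p′} → Agree (suc m) (linear 0# p) (linear 0# p′) → Agree m p p′
  agree-linear-zero⁻ {p = p} {p′} lp≈ i i<m = trans (sym (coeff-linear-zero p i)) (trans (lp≈ (suc i) (s≤s i<m)) (coeff-linear-zero p′ i))

  agree-linears : ∀ bs {m p p′} → Agree m p p′ → Agree m (linears bs p) (linears bs p′)
  agree-linears []       p≈p′ = p≈p′
  agree-linears (b ∷ bs) {p = p} {p′} p≈p′ = agree-linear b {p = linears bs p} {linears bs p′} (agree-linears bs {p = p} {p′} p≈p′)

  agree-linears⁻ : ∀ {bs} → All (_≢ 0#) bs → ∀ {m p p′} → Agree m (linears bs p) (linears bs p′) → Agree m p p′
  agree-linears⁻ []                        lp≈ = lp≈
  agree-linears⁻ {b ∷ bs} (b≢0 ∷ bs≢0) {p = p} {p′} lp≈ =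
    agree-linears⁻ bs≢0 {p = p} {p′} (agree-linear⁻ b b≢0 {p = linears bs p} {linears bs p′} lp≈)

  -- X ∏ (X + b), with all b nonzero, vanishes to order one at 0.
  agree-linears^ : ∀ bs a {m p p′} → Agree m p p′ → Agree (a ℕ.+ m) (linears^ (0# ∷ bs) a p) (linears^ (0# ∷ bs) a p′)
  agree-linears^ bs zero    p≈p′ = p≈p′
  agree-linears^ bs (suc a) {p = p} {p′} p≈p′ = agree-linear-zero {p = linears bs (linears^ (0# ∷ bs) a p)} {linears bs (linears^ (0# ∷ bs) a p′)}
    (agree-linears bs {p = linears^ (0# ∷ bs) a p} {linears^ (0# ∷ bs) a p′} (agree-linears^ bs a {p = p} {p′} p≈p′))

  -- Each X + b with b ≠ 0 has an invertible lowest coefficient and cancels without loss. Only the a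
  -- factors X cost one coefficient each.
  agree-linears^⁻ : ∀ {bs} → All (_≢ 0#) bs → ∀ a {m p p′} →
                    Agree (a ℕ.+ m) (linears^ (0# ∷ bs) a p) (linears^ (0# ∷ bs) a p′) → Agree m p p′
  agree-linears^⁻      bs≢0 zero    lp≈ = lp≈
  agree-linears^⁻ {bs} bs≢0 (suc a) {p = p} {p′} lp≈ = agree-linears^⁻ bs≢0 a {p = p} {p′}
    (agree-linears⁻ bs≢0 {p = linears^ (0# ∷ bs) a p} {linears^ (0# ∷ bs) a p′}
      (agree-linear-zero⁻ {p = linears bs (linears^ (0# ∷ bs) a p)} {linears bs (linears^ (0# ∷ bs) a p′)} lp≈))

  module _ (q : ℕ) where

    -- ∑ X ^ (j q) r j
    blocks : ∀ {k} → (Fin (suc k) → List Carrier) → List Carrier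
    blocks {zero}  r = r zero
    blocks {suc k} r = r zero ⊞ shift q (blocks (r ∘ suc))

    length-blocks : ∀ {k B} (r : Fin (suc k) → List Carrier) → B ≤ q → (∀ j → length (r j) ≤ B) → length (blocks r) ≤ k ℕ.* q ℕ.+ B
    length-blocks {zero}  r B≤q r≤B = r≤B zero
    length-blocks {suc k} {B} r B≤q r≤B = length-⊞ (r zero) (shift q (blocks (r ∘ suc)))
      (ℕ.≤-trans (r≤B zero) (ℕ.m≤n+m B (suc k ℕ.* q)))
      (ℕ.≤-trans (ℕ.≤-reflexive (length-shift q (blocks (r ∘ suc))))
        (ℕ.≤-trans (ℕ.+-monoʳ-≤ q (length-blocks (r ∘ suc) B≤q (r≤B ∘ suc))) (ℕ.≤-reflexive (sym (ℕ.+-assoc q (k ℕ.* q) B)))))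

    private
      assoc-index : ∀ j b → q ℕ.+ j ℕ.* q ℕ.+ b ≡ q ℕ.+ (j ℕ.* q ℕ.+ b)
      assoc-index j b = ℕ.+-assoc q (j ℕ.* q) b

    coeff-blocks-gap : ∀ {k B} (r : Fin (suc k) → List Carrier) → (∀ j → length (r j) ≤ B) →
                       ∀ j b → B ≤ b → b < q → coeff (blocks r) (j ℕ.* q ℕ.+ b) ≡ 0#
    coeff-blocks-gap {zero}  r r≤B j b B≤b b<q = coeff-≥ (r zero) (ℕ.≤-trans (r≤B zero) (ℕ.≤-trans B≤b (ℕ.m≤n+m b (j ℕ.* q))))
    coeff-blocks-gap {suc k} r r≤B j b B≤b b<q = trans (coeff-⊞ (r zero) (shift q (blocks (r ∘ suc))) (j ℕ.* q ℕ.+ b))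
      (trans (cong₂ _+_ (coeff-≥ (r zero) (ℕ.≤-trans (r≤B zero) (ℕ.≤-trans B≤b (ℕ.m≤n+m b (j ℕ.* q))))) (shifted j)) (+-identityˡ 0#))
      where
      shifted : ∀ j → coeff (shift q (blocks (r ∘ suc))) (j ℕ.* q ℕ.+ b) ≡ 0#
      shifted zero    = coeff-shift-< q (blocks (r ∘ suc)) b<q
      shifted (suc j) = trans (cong (coeff (shift q (blocks (r ∘ suc)))) (assoc-index j b))
        (trans (coeff-shift-+ q (blocks (r ∘ suc)) (j ℕ.* q ℕ.+ b)) (coeff-blocks-gap (r ∘ suc) (r≤B ∘ suc) j b B≤b b<q))

    coeff-blocks : ∀ {k} (r : Fin (suc k) → List Carrier) → (∀ j → length (r j) ≤ q) →
                   ∀ j b → b < q → coeff (blocks r) (toℕ j ℕ.* q ℕ.+ b) ≡ coeff (r j) b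
    coeff-blocks {zero}  r r≤q zero    b b<q = refl
    coeff-blocks {suc k} r r≤q zero    b b<q = trans (coeff-⊞ (r zero) (shift q (blocks (r ∘ suc))) b)
      (trans (cong (coeff (r zero) b +_) (coeff-shift-< q (blocks (r ∘ suc)) b<q)) (+-identityʳ _))
    coeff-blocks {suc k} r r≤q (suc j) b b<q = begin
      coeff (blocks r) (q ℕ.+ toℕ j ℕ.* q ℕ.+ b)
        ≡⟨ cong (coeff (blocks r)) (assoc-index (toℕ j) b) ⟩
      coeff (blocks r) (q ℕ.+ (toℕ j ℕ.* q ℕ.+ b))
        ≡⟨ coeff-⊞ (r zero) (shift q (blocks (r ∘ suc))) _ ⟩
      coeff (r zero) (q ℕ.+ (toℕ j ℕ.* q ℕ.+ b)) + coeff (shift q (blocks (r ∘ suc))) (q ℕ.+ (toℕ j ℕ.* q ℕ.+ b))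
        ≡⟨ cong₂ _+_ (coeff-≥ (r zero) (ℕ.≤-trans (r≤q zero) (ℕ.m≤m+n q _))) (coeff-shift-+ q (blocks (r ∘ suc)) _) ⟩
      0# + coeff (blocks (r ∘ suc)) (toℕ j ℕ.* q ℕ.+ b)
        ≡⟨ +-identityˡ _ ⟩
      coeff (blocks (r ∘ suc)) (toℕ j ℕ.* q ℕ.+ b)
        ≡⟨ coeff-blocks (r ∘ suc) (r≤q ∘ suc) j b b<q ⟩
      coeff (r (suc j)) b ∎
      where open ≡-Reasoning

    module _ {{_ : ℕ.NonZero q}} {k B a : ℕ} {bs : List Carrier} (bs≢0 : All (_≢ 0#) bs) (B≤a : B ≤ a) (a+B≤q : a ℕ.+ B ≤ q) where

      -- Stepanov's polynomial ∑ X ^ (j q) u j + f ^ a ∑ X ^ (j q) v j, with f = X ∏ (X + b). Its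
      -- degree is high, yet near a point t with f(t) ^ a = ε both X ^ q and f ^ a simplify, so that
      -- vanishing there imposes few conditions.
      auxiliary : (u v : Fin (suc k) → List Carrier) → List Carrier
      auxiliary u v = blocks u ⊞ linears^ (0# ∷ bs) a (blocks v)

      private
        B≤q : B ≤ q
        B≤q = ℕ.≤-trans (ℕ.m≤n+m B a) a+B≤q

        ⊞-agreeʳ : ∀ p p′ r r′ i → coeff p i ≡ coeff p′ i → coeff (p ⊞ r) i ≡ coeff (p′ ⊞ r′) i → coeff r i ≡ coeff r′ i
        ⊞-agreeʳ p p′ r r′ i p≡ pr≡ = begin
          coeff r i                                ≡⟨ solve 2 (λ u v → v := u :+ v :- u) refl (coeff p i) (coeff r i) ⟩
          coeff p i + coeff r i + - coeff p i      ≡⟨ cong₂ (λ u v → u + - v) (trans (sym (coeff-⊞ p r i)) (trans pr≡ (coeff-⊞ p′ r′ i))) p≡ ⟩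
          coeff p′ i + coeff r′ i + - coeff p′ i   ≡⟨ solve 2 (λ u v → u :+ v :- u := v) refl (coeff p′ i) (coeff r′ i) ⟩
          coeff r′ i                               ∎
          where open ≡-Reasoning

      length-auxiliary : ∀ u v → (∀ j → length (u j) ≤ B) → (∀ j → length (v j) ≤ B) →
                         length (auxiliary u v) ≤ a ℕ.* suc (length bs) ℕ.+ (k ℕ.* q ℕ.+ B)
      length-auxiliary u v u≤B v≤B = length-⊞ (blocks u) _
        (ℕ.≤-trans (length-blocks u B≤q u≤B) (ℕ.m≤n+m _ (a ℕ.* suc (length bs))))
        (ℕ.≤-trans (length-linears^ (0# ∷ bs) a (blocks v)) (ℕ.+-monoʳ-≤ (a ℕ.* suc (length bs)) (length-blocks v B≤q v≤B)))

      -- The exponents of blocks u and of X ^ a blocks v are disjoint modulo q.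
      auxiliary-injective : ∀ u v u′ v′ → (∀ j → length (u j) ≤ B) → (∀ j → length (v j) ≤ B) →
        (∀ j → length (u′ j) ≤ B) → (∀ j → length (v′ j) ≤ B) →
        (∀ i → coeff (auxiliary u v) i ≡ coeff (auxiliary u′ v′) i) →
        ∀ j b → b < q → coeff (u j) b ≡ coeff (u′ j) b × coeff (v j) b ≡ coeff (v′ j) b
      auxiliary-injective u v u′ v′ u≤B v≤B u′≤B v′≤B same j b b<q =
        entry u u′ u≤B u′≤B blocks-u , entry v v′ v≤B v′≤B (λ i → agree (suc i) i ℕ.≤-refl)
        where
        P  = linears^ (0# ∷ bs) a (blocks v)
        P′ = linears^ (0# ∷ bs) a (blocks v′)

        gap : ∀ r → (∀ j → length (r j) ≤ B) → ∀ i → B ≤ i ℕ.% q → coeff (blocks r) i ≡ 0#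
        gap r r≤B i B≤i = trans (cong (coeff (blocks r)) (trans (ℕ.m≡m%n+[m/n]*n i q) (ℕ.+-comm (i ℕ.% q) _)))
          (coeff-blocks-gap r r≤B (i ℕ./ q) (i ℕ.% q) B≤i (ℕ.m%n<n i q))

        shifted-gap : ∀ r → (∀ j → length (r j) ≤ B) → ∀ i → i ℕ.% q < B → coeff (blocks r) (a ℕ.+ i) ≡ 0#
        shifted-gap r r≤B i i<B = trans (cong (coeff (blocks r)) position)
          (coeff-blocks-gap r r≤B (i ℕ./ q) (a ℕ.+ i ℕ.% q) (ℕ.≤-trans B≤a (ℕ.m≤m+n a _)) (ℕ.<-≤-trans (ℕ.+-monoʳ-< a i<B) a+B≤q))
          where
          position : a ℕ.+ i ≡ (i ℕ./ q) ℕ.* q ℕ.+ (a ℕ.+ i ℕ.% q)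
          position = begin
            a ℕ.+ i                                       ≡⟨ cong (a ℕ.+_) (trans (ℕ.m≡m%n+[m/n]*n i q) (ℕ.+-comm (i ℕ.% q) _)) ⟩
            a ℕ.+ ((i ℕ./ q) ℕ.* q ℕ.+ i ℕ.% q)           ≡⟨ ℕ.+-assoc a _ _ ⟨
            a ℕ.+ (i ℕ./ q) ℕ.* q ℕ.+ i ℕ.% q             ≡⟨ cong (ℕ._+ i ℕ.% q) (ℕ.+-comm a _) ⟩
            (i ℕ./ q) ℕ.* q ℕ.+ a ℕ.+ i ℕ.% q             ≡⟨ ℕ.+-assoc ((i ℕ./ q) ℕ.* q) a _ ⟩
            (i ℕ./ q) ℕ.* q ℕ.+ (a ℕ.+ i ℕ.% q)           ∎
            where open ≡-Reasoning

        -- Induction on the exponent: once the blocks of `v` and `v′` agree below i, the products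
        -- with f ^ a agree below a + i, and only the next coefficient is in question.
        agree : ∀ m → Agree m (blocks v) (blocks v′)
        agree (suc m) i i<1+m with ℕ.m≤n⇒m<n∨m≡n (ℕ.≤-pred i<1+m)
        ... | inj₁ i<m  = agree m i i<m
        ... | inj₂ refl with B ℕ.≤? i ℕ.% q
        ...   | yes B≤i = trans (gap v v≤B i B≤i) (sym (gap v′ v′≤B i B≤i))
        -- Here a + i has a residue in [a, a + B), hence in [B, q), where the blocks of `u` and `u′`
        -- have a gap. The equality of the auxiliary polynomials thus shows the coefficients of `P`
        -- and `P′` at a + i, and cancelling f ^ a brings them down to i.
        ...   | no B≰i  = agree-linears^⁻ bs≢0 a {suc i} {blocks v} {blocks v′} extended i ℕ.≤-refl
          where
          i<B = ℕ.≰⇒> B≰i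
          extended : Agree (a ℕ.+ suc i) P P′
          extended n n< with ℕ.m≤n⇒m<n∨m≡n (ℕ.≤-pred (subst (n <_) (ℕ.+-suc a i) n<))
          ... | inj₁ n<a+i = agree-linears^ bs a {i} {blocks v} {blocks v′} (agree i) n n<a+i
          ... | inj₂ refl  = ⊞-agreeʳ (blocks u) (blocks u′) P P′ (a ℕ.+ i)
            (trans (shifted-gap u u≤B i i<B) (sym (shifted-gap u′ u′≤B i i<B))) (same (a ℕ.+ i))

        P≡P′ : ∀ i → coeff P i ≡ coeff P′ i
        P≡P′ i = agree-linears^ bs a {suc i} {blocks v} {blocks v′} (agree (suc i)) i (ℕ.m≤n+m (suc i) a)

        blocks-u : ∀ i → coeff (blocks u) i ≡ coeff (blocks u′) i
        blocks-u i = begin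
          coeff (blocks u) i                                        ≡⟨ solve 2 (λ u v → u := u :+ v :- v) refl _ (coeff P i) ⟩
          coeff (blocks u) i + coeff P i + - coeff P i              ≡⟨ cong₂ (λ u v → u + - v) (trans (sym (coeff-⊞ (blocks u) P i)) (trans (same i) (coeff-⊞ (blocks u′) P′ i))) (P≡P′ i) ⟩
          coeff (blocks u′) i + coeff P′ i + - coeff P′ i           ≡⟨ solve 2 (λ u v → u :+ v :- v := u) refl _ (coeff P′ i) ⟩
          coeff (blocks u′) i                                       ∎
          where open ≡-Reasoning

        entry : ∀ r r′ → (∀ j → length (r j) ≤ B) → (∀ j → length (r′ j) ≤ B) →
                (∀ i → coeff (blocks r) i ≡ coeff (blocks r′) i) → coeff (r j) b ≡ coeff (r′ j) b
        entry r r′ r≤B r′≤B eq = trans (sym (coeff-blocks r (λ j → ℕ.≤-trans (r≤B j) B≤q) j b b<q))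
          (trans (eq _) (coeff-blocks r′ (λ j → ℕ.≤-trans (r′≤B j) B≤q) j b b<q))

private
  width-split : ∀ k B n → 2 ℕ.* k ℕ.* suc (k ℕ.+ B ℕ.+ 2 ℕ.* k ℕ.* n) ≡ 2 ℕ.* (k ℕ.* (1 ℕ.+ k ℕ.+ 2 ℕ.* k ℕ.* n)) ℕ.+ 2 ℕ.* (k ℕ.* B)
  width-split = solve 3 (λ k B n → con 2 :* k :* (con 1 :+ (k :+ B :+ con 2 :* k :* n))
    := con 2 :* (k :* (con 1 :+ k :+ con 2 :* k :* n)) :+ con 2 :* (k :* B)) refl
    where open +-*-Solver

-- There are k + 1 blocks of length at most B on each side, and ε is the prescribed value of f ^ a
-- at the points to be counted. The inequality `large` makes the free coefficients outnumber the
-- conditions; the bounds on a + B and 2 k keep the exponents apart modulo q and make Frobenius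
-- applicable.
module Stepanov (K : FiniteField) {bs : List (FiniteField.Carrier K)} (bs≢0 : All (_≢ FiniteField.0# K) bs)
  {a k B : ℕ} (large : k ℕ.* (1 ℕ.+ k ℕ.+ 2 ℕ.* k ℕ.* suc (length bs)) < B) (B≤a : B ≤ a) (a+B≤q : a ℕ.+ B ≤ FiniteField.order K) (2k≤q : 2 ℕ.* k ≤ FiniteField.order K)
  (ε : FiniteField.Carrier K) (ε≢0 : ε ≢ FiniteField.0# K) (0<a : 0 < a) where

  open Field K
  open PowerSeries K
  open Polynomial K
  open PolynomialFunctions K
  open Products K

  f : Carrier → Carrier
  f = value (0# ∷ bs)

  n M : ℕ
  n = suc (length bs)
  -- The degree of the auxiliary polynomial is dominated by k q; dividing by a multiplicity of 2 k
  -- gives the main term q / 2 of the count.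
  M = 2 ℕ.* k

  private
    module A = CommutativeRing (truncated M)
    module E = Expansion M
    module Id = ExpansionIdentities (truncated M)
    open Exp A.commutativeSemiring using (^-congˡ) renaming (_^_ to _^ᴬ_; ^-distrib-* to ^ᴬ-distrib-*)

  valueˢ : List Carrier → Series → Series
  valueˢ bs x = foldr (λ b z → (x A.+ constant b) A.* z) A.1# bs

  ⟦linears⟧ : ∀ bs p x → ⟦ linears bs p ⟧ˢ x A.≈ valueˢ bs x A.* ⟦ p ⟧ˢ x
  ⟦linears⟧ []       p x = A.sym (A.*-identityˡ (⟦ p ⟧ˢ x))
  ⟦linears⟧ (b ∷ bs) p x = A.trans (E.⟦linear⟧ b (linears bs p) x)
    (A.trans (A.*-congˡ {x A.+ constant b} (⟦linears⟧ bs p x)) (A.sym (A.*-assoc (x A.+ constant b) (valueˢ bs x) (⟦ p ⟧ˢ x))))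

  ⟦linears^⟧ : ∀ bs a p x → ⟦ linears^ bs a p ⟧ˢ x A.≈ valueˢ bs x ^ᴬ a A.* ⟦ p ⟧ˢ x
  ⟦linears^⟧ bs zero    p x = A.sym (A.*-identityˡ (⟦ p ⟧ˢ x))
  ⟦linears^⟧ bs (suc a) p x = A.trans (⟦linears⟧ bs (linears^ bs a p) x)
    (A.trans (A.*-congˡ {valueˢ bs x} (⟦linears^⟧ bs a p x)) (A.sym (A.*-assoc (valueˢ bs x) (valueˢ bs x ^ᴬ a) (⟦ p ⟧ˢ x))))

  -- At X = t + f(t) V the factor f(t) splits off from f(X).
  tangent : Carrier → Series
  tangent t = line t (f t)

  remainder : List Carrier → Carrier → Series
  remainder []       t = A.0#
  remainder (b ∷ bs) t = (tangent t A.+ constant b) A.* remainder bs t A.+ constant (value bs t)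

  cofactor : Carrier → Series
  cofactor t = A.1# A.+ V A.* remainder (0# ∷ bs) t

  taylor : ∀ bs t → valueˢ bs (tangent t) A.≈ constant (value bs t) A.+ (constant (f t) A.* V) A.* remainder bs t
  taylor []       t = Id.taylor-base (constant (f t) A.* V)
  taylor (b ∷ bs) t = begin
    (tangent t A.+ constant b) A.* valueˢ bs (tangent t)
      ≈⟨ A.*-congˡ {tangent t A.+ constant b} (taylor bs t) ⟩
    (tangent t A.+ constant b) A.* (constant (value bs t) A.+ w A.* remainder bs t)
      ≈⟨ Id.taylor-step (constant t) w (constant b) (constant (value bs t)) (remainder bs t) ⟩
    (constant t A.+ constant b) A.* constant (value bs t) A.+ w A.* remainder (b ∷ bs) t
      ≈⟨ A.+-congʳ {w A.* remainder (b ∷ bs) t} (A.trans (A.*-congʳ {constant (value bs t)} (λ k _ → sym (constant-+ t b k)))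
           (λ k _ → sym (constant-* (t + b) (value bs t) k))) ⟩
    constant (value (b ∷ bs) t) A.+ w A.* remainder (b ∷ bs) t ∎
    where
    open import Relation.Binary.Reasoning.Setoid A.setoid
    w = constant (f t) A.* V

  constant-^ : ∀ x a → constant x ^ᴬ a A.≈ constant (x ↑ a)
  constant-^ x zero    = A.refl
  constant-^ x (suc a) = A.trans (A.*-congˡ {constant x} (constant-^ x a)) (λ k _ → sym (constant-* x (x ↑ a) k))

  -- Since f(X) = f(t) · `cofactor`, the factor f(t) ^ a of large degree in t becomes the constant
  -- ε, and what remains is a power of a series of weight 0.
  power-at-root : ∀ t → f t ↑ a ≡ ε → valueˢ (0# ∷ bs) (tangent t) ^ᴬ a A.≈ constant ε A.* cofactor t ^ᴬ a
  power-at-root t fᵃ≡ε = begin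
    valueˢ (0# ∷ bs) (tangent t) ^ᴬ a
      ≈⟨ ^-congˡ a (A.trans (taylor (0# ∷ bs) t) (Id.factor-out (constant (f t)) V (remainder (0# ∷ bs) t))) ⟩
    (constant (f t) A.* cofactor t) ^ᴬ a
      ≈⟨ ^ᴬ-distrib-* (constant (f t)) (cofactor t) a ⟩
    constant (f t) ^ᴬ a A.* cofactor t ^ᴬ a
      ≈⟨ A.*-congʳ {cofactor t ^ᴬ a} (A.trans (constant-^ (f t) a) (A.reflexive (cong constant fᵃ≡ε))) ⟩
    constant ε A.* cofactor t ^ᴬ a ∎
    where open import Relation.Binary.Reasoning.Setoid A.setoid

  blocksˢ : ∀ {k} → (Fin (suc k) → List Carrier) → Series → Series → Series
  blocksˢ {zero}  r x y = ⟦ r zero ⟧ˢ x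
  blocksˢ {suc k} r x y = ⟦ r zero ⟧ˢ x A.+ y A.* blocksˢ (r ∘ suc) x y

  ⟦blocks⟧ : ∀ {k} (r : Fin (suc k) → List Carrier) x y → x ^ᴬ order A.≈ y → ⟦ blocks order r ⟧ˢ x A.≈ blocksˢ r x y
  ⟦blocks⟧ {zero}  r x y x^q≈y = A.refl
  ⟦blocks⟧ {suc k} r x y x^q≈y = A.trans (E.⟦⊞⟧ (r zero) (shift order (blocks order (r ∘ suc))) x)
    (A.+-congˡ {⟦ r zero ⟧ˢ x} (A.trans (E.⟦shift⟧ order (blocks order (r ∘ suc)) x) (A.*-cong x^q≈y (⟦blocks⟧ (r ∘ suc) x y x^q≈y))))

  -- The expansion at X = t + f t V, where X ^ q = t and f X ^ a = ε (cofactor t) ^ a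
  -- modulo V ^ M: its coefficients are polynomials in t of low degree.
  localised : (u v : Fin (suc k) → List Carrier) → Carrier → Series
  localised u v t = blocksˢ u (tangent t) (constant t) A.+ (constant ε A.* cofactor t ^ᴬ a) A.* blocksˢ v (tangent t) (constant t)

  instance
    order-nonZero : ℕ.NonZero order
    order-nonZero = ℕ.>-nonZero (Frobenius.0<order K)

  aux : (u v : Fin (suc k) → List Carrier) → List Carrier
  aux = auxiliary order bs≢0 B≤a a+B≤q

  ⟦aux⟧ : ∀ u v t → f t ↑ a ≡ ε → ⟦ aux u v ⟧ˢ (tangent t) A.≈ localised u v t
  ⟦aux⟧ u v t fᵃ≡ε = A.trans (E.⟦⊞⟧ (blocks order u) (linears^ (0# ∷ bs) a (blocks order v)) (tangent t))
    (A.+-cong (⟦blocks⟧ u (tangent t) (constant t) frob)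
      (A.trans (⟦linears^⟧ (0# ∷ bs) a (blocks order v) (tangent t))
        (A.*-cong (power-at-root t fᵃ≡ε) (⟦blocks⟧ v (tangent t) (constant t) frob))))
    where frob = Frobenius.frobenius-line K 2k≤q t (f t)

  value-poly : ∀ bs → IsPolynomial (length bs) (value bs)
  value-poly []       = const-poly 1#
  value-poly (b ∷ bs) = *-poly (+-poly var-poly (weaken z≤n (const-poly b))) (value-poly bs)

  tangent-series : IsPolynomialSeries n 1 tangent
  tangent-series = line-series (value-poly (0# ∷ bs))

  remainder-series : ∀ bs → IsPolynomialSeries n (length bs) (remainder bs)
  remainder-series []       k = weaken z≤n (const-poly 0#)
  remainder-series (b ∷ bs) = +-series
    (⊛-series {Φ = λ t → tangent t A.+ constant b} {Ψ = remainder bs}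
      (+-series tangent-series (weaken-series z≤n (constant-series (const-poly b)))) (remainder-series bs))
    (weaken-series (ℕ.n≤1+n _) (constant-series (value-poly bs)))

  cofactor-series : IsPolynomialSeries n 0 cofactor
  cofactor-series = +-series (constant-series (const-poly 1#)) (V-⊛-series ℕ.≤-refl (remainder-series (0# ∷ bs)))

  ^-series : ∀ {Φ} a → IsPolynomialSeries n 0 Φ → IsPolynomialSeries n 0 (λ t → Φ t ^ᴬ a)
  ^-series zero    P = constant-series (const-poly 1#)
  ^-series {Φ} (suc a) P = ⊛-series {Φ = Φ} {Ψ = λ t → Φ t ^ᴬ a} P (^-series a P)

  -- The summand k comes from the powers t ^ j to which X ^ (j q) collapses, and B from the blocks
  -- themselves.
  blocks-series : ∀ {k} (r : Fin (suc k) → List Carrier) → (∀ j → length (r j) ≤ B) →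
                  IsPolynomialSeries n (k ℕ.+ B) (λ t → blocksˢ r (tangent t) (constant t))
  blocks-series {zero}  r r≤B = weaken-series (r≤B zero) (horner-series (r zero) tangent-series)
  blocks-series {suc k} r r≤B = +-series
    (weaken-series (ℕ.≤-trans (r≤B zero) (ℕ.m≤n+m B (suc k))) (horner-series (r zero) tangent-series))
    (⊛-series {Φ = constant} {Ψ = λ t → blocksˢ (r ∘ suc) (tangent t) (constant t)} (constant-series var-poly) (blocks-series (r ∘ suc) (r≤B ∘ suc)))

  localised-series : ∀ u v → (∀ j → length (u j) ≤ B) → (∀ j → length (v j) ≤ B) → IsPolynomialSeries n (k ℕ.+ B) (localised u v)
  localised-series u v u≤B v≤B = +-series (blocks-series u u≤B)
    (⊛-series {Φ = λ t → constant ε A.* cofactor t ^ᴬ a} {Ψ = λ t → blocksˢ v (tangent t) (constant t)}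
      (⊛-series {Φ = λ _ → constant ε} {Ψ = λ t → cofactor t ^ᴬ a} (constant-series (const-poly ε)) (^-series a cofactor-series))
      (blocks-series v v≤B))

  Coefficients : Set
  Coefficients = Fin (2 ℕ.* (suc k ℕ.* B)) → Carrier

  entry : Fin 2 → Fin (suc k) → Fin B → Fin (2 ℕ.* (suc k ℕ.* B))
  entry p j b = combine {2} {suc k ℕ.* B} p (combine {suc k} {B} j b)

  row : Coefficients → Fin 2 → Fin (suc k) → List Carrier
  row c p j = tabulate (λ b → c (entry p j b))

  length-row : ∀ c p j → length (row c p j) ≤ B
  length-row c p j = ℕ.≤-reflexive (List.length-tabulate (λ b → c (entry p j b)))

  coeff-row : ∀ c p j b → coeff (row c p j) (toℕ b) ≡ c (entry p j b)
  coeff-row c p j b = coeff-tabulate (λ b → c (entry p j b)) b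
    where
    coeff-tabulate : ∀ {B} (g : Fin B → Carrier) b → coeff (tabulate g) (toℕ b) ≡ g b
    coeff-tabulate g zero    = refl
    coeff-tabulate g (suc b) = coeff-tabulate (g ∘ suc) b

  R : Coefficients → List Carrier
  R c = aux (row c zero) (row c (suc zero))

  abstract
    conditions : ∀ c → IsPolynomialSeries n (k ℕ.+ B) (localised (row c zero) (row c (suc zero)))
    conditions c = localised-series (row c zero) (row c (suc zero)) (length-row c zero) (length-row c (suc zero))

  width : ℕ
  width = suc (k ℕ.+ B ℕ.+ M ℕ.* n)

  -- The coefficients, as polynomials in t, of the first M terms of the expansion. Equal hashes give
  -- equal expansions at all admissible t at once, which is why the number of conditions is
  -- independent of the number of points.
  hash : Coefficients → Fin (M ℕ.* width) → Carrier
  hash c i = coeff (poly (conditions c (toℕ (proj₁ (remQuot {M} width i))))) (toℕ (proj₂ (remQuot {M} width i)))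

  collision : ∃[ c ] ∃[ c′ ] (hash c ≗ hash c′ × ¬ c ≗ c′)
  collision = pigeonhole index element element-index 1<q enough element-injective hash
    where
    1<q : 1 < order
    1<q with order | index 0# | index 1# | index-injective {0#} {1#}
    ... | suc zero    | zero | zero | inj = contradiction (inj refl) 0≢1
    ... | suc (suc m) | _    | _    | _   = s≤s (s≤s z≤n)

    -- There are 2 (k + 1) B unknowns, against M · `width` conditions. The common part 2 k B cancels
    -- and leaves k (1 + k + 2 k n) < B.
    enough : M ℕ.* width < 2 ℕ.* (suc k ℕ.* B)
    enough = begin-strict
      M ℕ.* width                                                   ≡⟨ width-split k B n ⟩
      2 ℕ.* (k ℕ.* (1 ℕ.+ k ℕ.+ 2 ℕ.* k ℕ.* n)) ℕ.+ 2 ℕ.* (k ℕ.* B) <⟨ ℕ.+-monoˡ-< (2 ℕ.* (k ℕ.* B)) (ℕ.*-monoʳ-< 2 large) ⟩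
      2 ℕ.* B ℕ.+ 2 ℕ.* (k ℕ.* B)                                   ≡⟨ ℕ.*-distribˡ-+ 2 B (k ℕ.* B) ⟨
      2 ℕ.* (suc k ℕ.* B)                                           ∎
      where open ℕ.≤-Reasoning

  values-agree : ∀ p p′ → (∀ i → coeff p i ≡ coeff p′ i) → ∀ t → ⟦ p ⟧ t ≡ ⟦ p′ ⟧ t
  values-agree []      p′       p≡p′ t = sym (Values.⟦zero⟧ p′ (λ i → sym (p≡p′ i)) t)
  values-agree (c ∷ p) []       p≡p′ t = Values.⟦zero⟧ (c ∷ p) p≡p′ t
  values-agree (c ∷ p) (d ∷ p′) p≡p′ t = cong₂ (λ u v → u + t * v) (p≡p′ 0) (values-agree p p′ (p≡p′ ∘ suc) t)

  -- The difference `D` of the two auxiliary polynomials vanishes to order `M` at every point of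
  -- `T`. With that many points its degree forces it to be zero, and the coefficients can be
  -- recovered from the polynomial by `auxiliary-injective`.
  collision-injective : ∀ c c′ → hash c ≗ hash c′ → ∀ {T} → Unique T → All (λ t → f t ↑ a ≡ ε) T →
                        a ℕ.* n ℕ.+ (k ℕ.* order ℕ.+ B) < length T ℕ.* M → c ≗ c′
  collision-injective c c′ same {T} uniq roots many = c≗c′
    where
    D = R c ⊞ scale (- 1#) (R c′)

    length-R : ∀ c → length (R c) ≤ a ℕ.* n ℕ.+ (k ℕ.* order ℕ.+ B)
    length-R c = length-auxiliary order bs≢0 B≤a a+B≤q (row c zero) (row c (suc zero)) (length-row c zero) (length-row c (suc zero))

    f≢0 : ∀ {t} → f t ↑ a ≡ ε → f t ≢ 0#
    f≢0 eq f≡0 = ε≢0 (trans (sym eq) (zero-power 0<a f≡0))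
      where
      zero-power : ∀ {a x} → 0 < a → x ≡ 0# → x ↑ a ≡ 0#
      zero-power {suc a} _ refl = zeroˡ _

    same-poly : ∀ {j} → j < M → ∀ i → coeff (poly (conditions c j)) i ≡ coeff (poly (conditions c′ j)) i
    same-poly {j} j<M i with i ℕ.<? width
    ... | yes i<w = begin
      coeff (poly (conditions c j)) i          ≡⟨ at c ⟨
      hash c position                          ≡⟨ same position ⟩
      hash c′ position                         ≡⟨ at c′ ⟩
      coeff (poly (conditions c′ j)) i         ∎
      where
      open ≡-Reasoning
      position = combine (fromℕ< j<M) (fromℕ< i<w)
      at : ∀ c → hash c position ≡ coeff (poly (conditions c j)) i
      at c = trans (cong (λ (x , y) → coeff (poly (conditions c (toℕ x))) (toℕ y)) (Fin.remQuot-combine {M} {width} (fromℕ< j<M) (fromℕ< i<w)))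
        (cong₂ (λ x y → coeff (poly (conditions c x)) y) (Fin.toℕ-fromℕ< j<M) (Fin.toℕ-fromℕ< i<w))
    ... | no i≮w = trans (beyond c) (sym (beyond c′))
      where
      beyond : ∀ c → coeff (poly (conditions c j)) i ≡ 0#
      beyond c = coeff-≥ (poly (conditions c j)) (ℕ.≤-trans (degree (conditions c j))
        (ℕ.≤-trans (s≤s (ℕ.+-monoʳ-≤ (k ℕ.+ B) (ℕ.*-monoˡ-≤ n (ℕ.<⇒≤ j<M)))) (ℕ.≮⇒≥ i≮w)))

    same-expansion : ∀ {t} → f t ↑ a ≡ ε → ∀ j → j < M → ⟦ R c ⟧ˢ (tangent t) j ≡ ⟦ R c′ ⟧ˢ (tangent t) j
    same-expansion {t} eq j j<M = begin
      ⟦ R c ⟧ˢ (tangent t) j                                   ≡⟨ ⟦aux⟧ (row c zero) (row c (suc zero)) t eq j j<M ⟩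
      localised (row c zero) (row c (suc zero)) t j            ≡⟨ correct (conditions c j) t ⟨
      ⟦ poly (conditions c j) ⟧ t                              ≡⟨ values-agree (poly (conditions c j)) (poly (conditions c′ j)) (same-poly j<M) t ⟩
      ⟦ poly (conditions c′ j) ⟧ t                             ≡⟨ correct (conditions c′ j) t ⟩
      localised (row c′ zero) (row c′ (suc zero)) t j          ≡⟨ ⟦aux⟧ (row c′ zero) (row c′ (suc zero)) t eq j j<M ⟨
      ⟦ R c′ ⟧ˢ (tangent t) j                                  ∎
      where open ≡-Reasoning

    vanishes : ∀ {t} → f t ↑ a ≡ ε → VanishesAt t (f t) D M
    vanishes {t} eq j j<M = begin
      ⟦ D ⟧ˢ (tangent t) j
        ≡⟨ E.⟦⊞⟧ (R c) (scale (- 1#) (R c′)) (tangent t) j j<M ⟩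
      ⟦ R c ⟧ˢ (tangent t) j + ⟦ scale (- 1#) (R c′) ⟧ˢ (tangent t) j
        ≡⟨ cong₂ _+_ (same-expansion eq j j<M) (trans (E.⟦scale⟧ (- 1#) (R c′) (tangent t) j j<M) (constant-⊛ (- 1#) (⟦ R c′ ⟧ˢ (tangent t)) j)) ⟩
      ⟦ R c′ ⟧ˢ (tangent t) j + - 1# * ⟦ R c′ ⟧ˢ (tangent t) j
        ≡⟨ solve 1 (λ x → x :+ :- con (pos 1) :* x := con (pos 0)) refl (⟦ R c′ ⟧ˢ (tangent t) j) ⟩
      0# ∎
      where open ≡-Reasoning

    D≡0 : ∀ i → coeff D i ≡ 0#
    D≡0 = multiplicity-bound f D M T uniq (All.map f≢0 roots) (All.map vanishes roots)
      (ℕ.≤-trans (length-⊞ (R c) (scale (- 1#) (R c′)) (length-R c) (ℕ.≤-trans (ℕ.≤-reflexive (length-scale (- 1#) (R c′))) (length-R c′))) (ℕ.<⇒≤ many))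

    R≡R′ : ∀ i → coeff (R c) i ≡ coeff (R c′) i
    R≡R′ i = -‿≡0⇒≡ (begin
      coeff (R c) i + - coeff (R c′) i                      ≡⟨ solve 2 (λ x y → x :+ :- y := x :+ :- con (pos 1) :* y) refl (coeff (R c) i) (coeff (R c′) i) ⟩
      coeff (R c) i + - 1# * coeff (R c′) i                 ≡⟨ cong (coeff (R c) i +_) (coeff-scale (- 1#) (R c′) i) ⟨
      coeff (R c) i + coeff (scale (- 1#) (R c′)) i         ≡⟨ coeff-⊞ (R c) (scale (- 1#) (R c′)) i ⟨
      coeff D i                                             ≡⟨ D≡0 i ⟩
      0#                                                    ∎)
      where open ≡-Reasoning

    same-rows : ∀ j b → b < order → coeff (row c zero j) b ≡ coeff (row c′ zero j) b × coeff (row c (suc zero) j) b ≡ coeff (row c′ (suc zero) j) b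
    same-rows = auxiliary-injective order bs≢0 B≤a a+B≤q (row c zero) (row c (suc zero)) (row c′ zero) (row c′ (suc zero))
      (length-row c zero) (length-row c (suc zero)) (length-row c′ zero) (length-row c′ (suc zero)) R≡R′

    same-entry : ∀ p j b → c (entry p j b) ≡ c′ (entry p j b)
    same-entry p j b = trans (sym (coeff-row c p j b)) (trans (by-cases p) (coeff-row c′ p j b))
      where
      b<q : toℕ b < order
      b<q = ℕ.<-≤-trans (Fin.toℕ<n b) (ℕ.≤-trans (ℕ.m≤n+m B a) a+B≤q)
      by-cases : ∀ p → coeff (row c p j) (toℕ b) ≡ coeff (row c′ p j) (toℕ b)
      by-cases zero       = proj₁ (same-rows j (toℕ b) b<q)
      by-cases (suc zero) = proj₂ (same-rows j (toℕ b) b<q)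

    c≗c′ : c ≗ c′
    c≗c′ i with Fin.combine-surjective {2} {suc k ℕ.* B} i
    ... | p , i′ , refl with Fin.combine-surjective {suc k} {B} i′
    ...   | j , b , refl = same-entry p j b

  stepanov : ∀ {T} → Unique T → All (λ t → f t ↑ a ≡ ε) T → length T ℕ.* M ≤ a ℕ.* n ℕ.+ (k ℕ.* order ℕ.+ B)
  stepanov uniq roots = ℕ.≮⇒≥ λ many → proj₂ (proj₂ (proj₂ collision))
    (collision-injective (proj₁ collision) (proj₁ (proj₂ collision)) (proj₁ (proj₂ (proj₂ collision))) uniq roots many)

-- Quadratic characters in odd characteristic

split-filter : ∀ {X : Set} {P : X → Set} (P? : ∀ x → Dec (P x)) xs →
               length xs ≡ length (filter P? xs) ℕ.+ length (filter (¬? ∘ P?) xs)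
split-filter P? [] = refl
split-filter P? (x ∷ xs) with P? x
... | yes _ = cong suc (split-filter P? xs)
... | no _  = trans (cong suc (split-filter P? xs)) (sym (ℕ.+-suc (length (filter P? xs)) _))

module _ {X : Set} (D : X → Bool) where

  fibre : Bool → List X → List X
  fibre b = filter (λ x → D x Bool.≟ b)

  ∑-sg : ∀ xs → ∑ xs (sg ∘ D) ≡ length (fibre true xs) ℤ.⊖ length (fibre false xs)
  ∑-sg []       = refl
  ∑-sg (x ∷ xs) with D x
  ... | true  = trans (cong (ℤ._+_ (pos 1)) (∑-sg xs)) (ℤ.distribʳ-⊖-+-pos 1 (length (fibre true xs)) (length (fibre false xs)))
  ... | false = trans (cong (ℤ._+_ -[1+ 0 ]) (∑-sg xs)) (ℤ.distribʳ-⊖-+-neg 0 (length (fibre true xs)) (length (fibre false xs)))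

  length-fibres : ∀ xs → length (fibre true xs) ℕ.+ length (fibre false xs) ≡ length xs
  length-fibres []       = refl
  length-fibres (x ∷ xs) with D x
  ... | true  = cong suc (length-fibres xs)
  ... | false = trans (ℕ.+-suc (length (fibre true xs)) _) (cong suc (length-fibres xs))

  -- For fibres of sizes m ≥ n one has k (m - n) + k (m + n) = 2 k m. A bound slightly above half
  -- the length for the larger fibre therefore bounds the difference.
  ∑-sg-bound : ∀ k c xs → (∀ b → length (fibre b xs) ℕ.* (2 ℕ.* k) ≤ c ℕ.+ k ℕ.* length xs) → k ℕ.* ℤ.∣ ∑ xs (sg ∘ D) ∣ ≤ c
  ∑-sg-bound k c xs fibre≤ = ℕ.+-cancelʳ-≤ (k ℕ.* length xs) _ c
    (subst₂ (λ i l → k ℕ.* ℤ.∣ i ∣ ℕ.+ k ℕ.* l ≤ c ℕ.+ k ℕ.* length xs) (sym (∑-sg xs)) (length-fibres xs)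
      (difference (length (fibre true xs)) (length (fibre false xs)) (fibre≤ true) (fibre≤ false)))
    where
    open ℕ.≤-Reasoning
    excess : ∀ {m n} → n ≤ m → k ℕ.* (m ∸ n) ℕ.+ k ℕ.* (m ℕ.+ n) ≡ m ℕ.* (2 ℕ.* k)
    excess {m} {n} n≤m = trans (cong (λ z → k ℕ.* (m ∸ n) ℕ.+ k ℕ.* (z ℕ.+ n)) (sym (ℕ.m∸n+n≡m n≤m)))
      (trans (solve 3 (λ k d n → k :* d :+ k :* (d :+ n :+ n) := (d :+ n) :* (con 2 :* k)) refl k (m ∸ n) n)
             (cong (ℕ._* (2 ℕ.* k)) (ℕ.m∸n+n≡m n≤m)))
      where open +-*-Solver
    difference : ∀ m n → m ℕ.* (2 ℕ.* k) ≤ c ℕ.+ k ℕ.* length xs → n ℕ.* (2 ℕ.* k) ≤ c ℕ.+ k ℕ.* length xs →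
                 k ℕ.* ℤ.∣ m ℤ.⊖ n ∣ ℕ.+ k ℕ.* (m ℕ.+ n) ≤ c ℕ.+ k ℕ.* length xs
    difference m n m≤ n≤ with ℕ.≤-total n m
    ... | inj₁ n≤m = begin
      k ℕ.* ℤ.∣ m ℤ.⊖ n ∣ ℕ.+ k ℕ.* (m ℕ.+ n)  ≡⟨ cong (λ z → k ℕ.* z ℕ.+ k ℕ.* (m ℕ.+ n)) (cong ℤ.∣_∣ (ℤ.⊖-≥ n≤m)) ⟩
      k ℕ.* (m ∸ n) ℕ.+ k ℕ.* (m ℕ.+ n)        ≡⟨ excess n≤m ⟩
      m ℕ.* (2 ℕ.* k)                          ≤⟨ m≤ ⟩
      c ℕ.+ k ℕ.* length xs                    ∎
    ... | inj₂ m≤n = begin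
      k ℕ.* ℤ.∣ m ℤ.⊖ n ∣ ℕ.+ k ℕ.* (m ℕ.+ n)  ≡⟨ cong₂ (λ z w → k ℕ.* z ℕ.+ k ℕ.* w) (ℤ.∣⊖∣-≤ m≤n) (ℕ.+-comm m n) ⟩
      k ℕ.* (n ∸ m) ℕ.+ k ℕ.* (n ℕ.+ m)        ≡⟨ excess m≤n ⟩
      n ℕ.* (2 ℕ.* k)                          ≤⟨ n≤ ⟩
      c ℕ.+ k ℕ.* length xs                    ∎

module Squares (K : FiniteField) (2≢0 : ¬ Char2 K) where
  open Field K
  open Polynomial K
  open Products K using (value; value-roots)

  abstract
    a : ℕ
    a = proj₁ (odd-order 2≢0)

    order≡1+2a : order ≡ suc (2 ℕ.* a)
    order≡1+2a = proj₁ (proj₂ (odd-order 2≢0))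

    nonzeros≡2a : length nonzeros ≡ 2 ℕ.* a
    nonzeros≡2a = proj₂ (proj₂ (odd-order 2≢0))

  isSquare? : ∀ x → Dec (∃[ z ] z * z ≡ x)
  isSquare? x = ∃? (λ z → z * z ≟ x)

  isSquare : Carrier → Bool
  isSquare x = does (isSquare? x)

  κ : Bool → Carrier
  κ true  = 1#
  κ false = - 1#

  κ-⇔ᵇ : ∀ b c → κ (b ⇔ᵇ c) ≡ κ b * κ c
  κ-⇔ᵇ true  c     = sym (*-identityˡ (κ c))
  κ-⇔ᵇ false true  = sym (*-identityʳ (- 1#))
  κ-⇔ᵇ false false = solve 0 (con (pos 1) := :- con (pos 1) :* :- con (pos 1)) refl

  κ≢0 : ∀ b → κ b ≢ 0#
  κ≢0 true  1≡0  = 0≢1 (sym 1≡0)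
  κ≢0 false -1≡0 = 0≢1 (trans (sym (-‿inverseʳ 1#)) (trans (cong (1# +_) -1≡0) (+-identityʳ 1#)))

  square-roots : ∀ {x y} → x * x ≡ y * y → x ≡ y ⊎ x ≡ - y
  square-roots {x} {y} eq with *≡0⇒ (x + - y) (x + - (- y)) (trans
    (solve 2 (λ x y → (x :+ :- y) :* (x :+ :- (:- y)) := x :* x :+ :- (y :* y)) refl x y)
    (trans (cong (_+ - (y * y)) eq) (-‿inverseʳ (y * y))))
  ... | inj₁ x-y≡0 = inj₁ (-‿≡0⇒≡ x-y≡0)
  ... | inj₂ x+y≡0 = inj₂ (-‿≡0⇒≡ x+y≡0)

  private
    ↑-double : ∀ x n → x ↑ n * x ↑ n ≡ x ↑ (2 ℕ.* n)
    ↑-double x n = trans (sym (^-homo-* x n n)) (cong (λ m → x ↑ (n ℕ.+ m)) (sym (ℕ.+-identityʳ n)))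

    fermat-2a : ∀ {u} → u ≢ 0# → u ↑ (2 ℕ.* a) ≡ 1#
    fermat-2a {u} u≢0 = trans (cong (u ↑_) (sym nonzeros≡2a)) (fermat u≢0)

  0<a : 0 < a
  0<a = positive a nonzeros nonzeros≡2a (∈-nonzeros (λ 1≡0 → 0≢1 (sym 1≡0)))
    where
    positive : ∀ a xs → length xs ≡ 2 ℕ.* a → 1# ∈ˡ xs → 0 < a
    positive (suc a) xs _  _  = s≤s z≤n
    positive zero    [] _  ()

  square-power : ∀ {u} → u ≢ 0# → (∃[ z ] z * z ≡ u) → u ↑ a ≡ 1#
  square-power u≢0 (z , refl) = trans (^-distrib-* z z a) (trans (↑-double z a)
    (fermat-2a (λ z≡0 → u≢0 (trans (cong (_* z) z≡0) (zeroˡ z)))))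

  sqrt : Carrier → Carrier
  sqrt x with isSquare? x
  ... | yes (z , _) = z
  ... | no _        = 0#

  sqrt-correct : ∀ {x} → (∃[ z ] z * z ≡ x) → sqrt x * sqrt x ≡ x
  sqrt-correct {x} square with isSquare? x
  ... | yes (_ , eq) = eq
  ... | no ¬square   = contradiction square ¬square

  squares : List Carrier
  squares = filter isSquare? nonzeros

  -- Every nonzero z is one of the two elements ± `sqrt` (z²), so the 2 a nonzero elements are
  -- covered by pairs indexed by the squares.
  a≤squares : a ≤ length squares
  a≤squares = ℕ.*-cancelˡ-≤ 2 (begin
    2 ℕ.* a                                  ≡⟨ nonzeros≡2a ⟨
    length nonzeros                          ≤⟨ unique-⊆-length nonzeros-unique (λ {z} z∈ → Mem.∈-concatMap⁺ ± (covered z z∈)) ⟩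
    length (concatMap ± squares)             ≡⟨ length-± squares ⟩
    2 ℕ.* length squares                     ∎)
    where
    open ℕ.≤-Reasoning
    ± : Carrier → List Carrier
    ± r = sqrt r ∷ - sqrt r ∷ []
    length-± : ∀ xs → length (concatMap ± xs) ≡ 2 ℕ.* length xs
    length-± []       = refl
    length-± (x ∷ xs) = trans (cong (2 ℕ.+_) (length-± xs)) (sym (ℕ.*-suc 2 (length xs)))
    covered : ∀ z → z ∈ˡ nonzeros → Any (λ r → z ∈ˡ ± r) squares
    covered z z∈ = Any.map (λ { {r} refl → [ here , there ∘ here ]′ (square-roots (sym (sqrt-correct (z , refl)))) })
      (Mem.∈-filter⁺ isSquare? (∈-nonzeros (*≢0 (∈-nonzeros⁻ z∈) (∈-nonzeros⁻ z∈))) (z , refl))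

  -- The squares already exhaust the roots of X ^ a - 1.
  nonsquare-power : ∀ {u} → u ≢ 0# → ¬ (∃[ z ] z * z ≡ u) → u ↑ a ≢ 1#
  nonsquare-power {u} u≢0 nonsquare uᵃ≡1 = 0≢1 (trans (sym (roots-bound P (u ∷ squares)
      (All.tabulate (λ s∈ u≡s → nonsquare (subst (λ s → ∃[ z ] z * z ≡ s) (sym u≡s) (proj₂ (∈-squares⁻ s∈)))) ∷ Unique.filter⁺ isSquare? nonzeros-unique)
      (root uᵃ≡1 ∷ All.tabulate (λ s∈ → root (square-power (∈-nonzeros⁻ (proj₁ (∈-squares⁻ s∈))) (proj₂ (∈-squares⁻ s∈)))))
      (ℕ.≤-trans length-P (s≤s a≤squares)) a)) leading)
    where
    P = (- 1# ∷ []) ⊞ shift a (1# ∷ [])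
    length-P : length P ≤ suc a
    length-P = length-⊞ (- 1# ∷ []) (shift a (1# ∷ [])) (s≤s z≤n) (ℕ.≤-reflexive (trans (length-shift a (1# ∷ [])) (ℕ.+-comm a 1)))
    ∈-squares⁻ : ∀ {s} → s ∈ˡ squares → s ∈ˡ nonzeros × ∃[ z ] z * z ≡ s
    ∈-squares⁻ = Mem.∈-filter⁻ isSquare? {xs = nonzeros}
    root : ∀ {x} → x ↑ a ≡ 1# → ⟦ P ⟧ x ≡ 0#
    root {x} xᵃ≡1 = trans (Values.⟦⊞⟧ (- 1# ∷ []) (shift a (1# ∷ [])) x) (trans (cong ((- 1# + x * 0#) +_)
      (trans (Values.⟦shift⟧ a (1# ∷ []) x) (cong (_* (1# + x * 0#)) xᵃ≡1)))
      (solve 1 (λ x → :- con (pos 1) :+ x :* con (pos 0) :+ con (pos 1) :* (con (pos 1) :+ x :* con (pos 0)) := con (pos 0)) refl x))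
    leading : coeff P a ≡ 1#
    leading = trans (coeff-⊞ (- 1# ∷ []) (shift a (1# ∷ [])) a) (trans (cong₂ _+_ (coeff-≥ (- 1# ∷ []) 0<a)
      (trans (cong (coeff (shift a (1# ∷ []))) (sym (ℕ.+-identityʳ a))) (coeff-shift-+ a (1# ∷ []) 0))) (+-identityˡ 1#))

  euler : ∀ {u} → u ≢ 0# → u ↑ a ≡ κ (isSquare u)
  euler {u} u≢0 = by-cases (isSquare? u)
    where
    by-cases : (square : Dec (∃[ z ] z * z ≡ u)) → u ↑ a ≡ κ (does square)
    by-cases (yes square)   = square-power u≢0 square
    by-cases (no nonsquare) = [ (λ uᵃ≡1 → contradiction uᵃ≡1 (nonsquare-power u≢0 nonsquare)) , id ]′
      (square-roots (trans (trans (↑-double u a) (fermat-2a u≢0)) (sym (*-identityˡ 1#))))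

  signs : List Carrier → Carrier → Bool
  signs bs x = foldr (λ b c → isSquare (x + b) ⇔ᵇ c) true bs

  ∏-signs : ∀ bs x → ∏ bs (λ b → sg (isSquare (x + b))) ≡ sg (signs bs x)
  ∏-signs []       x = refl
  ∏-signs (b ∷ bs) x = trans (cong (sg (isSquare (x + b)) ℤ.*_) (∏-signs bs x)) (sym (sg-⇔ᵇ (isSquare (x + b)) (signs bs x)))

  value-power : ∀ bs x → value bs x ≢ 0# → value bs x ↑ a ≡ κ (signs bs x)
  value-power []       x _ = 1↑ a
  value-power (b ∷ bs) x v≢0 = begin
    ((x + b) * value bs x) ↑ a                   ≡⟨ ^-distrib-* (x + b) (value bs x) a ⟩
    (x + b) ↑ a * value bs x ↑ a                 ≡⟨ cong₂ _*_ (euler (λ ≡0 → v≢0 (trans (cong (_* value bs x) ≡0) (zeroˡ _))))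
                                                      (value-power bs x (λ ≡0 → v≢0 (trans (cong ((x + b) *_) ≡0) (zeroʳ _)))) ⟩
    κ (isSquare (x + b)) * κ (signs bs x)        ≡⟨ κ-⇔ᵇ (isSquare (x + b)) (signs bs x) ⟨
    κ (signs (b ∷ bs) x)                         ∎
    where open ≡-Reasoning

  translate-∏ : ∀ c S x → ∏ S (λ s → sg (isSquare (s + (x + c)))) ≡ ∏ (map (_+ c) S) (λ b → sg (isSquare (x + b)))
  translate-∏ c []      x = refl
  translate-∏ c (s ∷ S) x = cong₂ ℤ._*_ (cong (sg ∘ isSquare) (solve 3 (λ s x c → s :+ (x :+ c) := x :+ (s :+ c)) refl s x c)) (translate-∏ c S x)

  module _ (k N : ℕ) (k-small : suc (k ℕ.* (1 ℕ.+ k ℕ.+ 2 ℕ.* k ℕ.* N)) ≤ a) where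

    private
      -- The smallest block length that the condition `large` permits for a product of N factors.
      B : ℕ
      B = suc (k ℕ.* (1 ℕ.+ k ℕ.+ 2 ℕ.* k ℕ.* N))

      2k≤a : 2 ℕ.* k ≤ a
      2k≤a = ℕ.≤-trans (bound k) (ℕ.≤-trans (ℕ.n≤1+n _) k-small)
        where
        bound : ∀ k → 2 ℕ.* k ≤ k ℕ.* (1 ℕ.+ k ℕ.+ 2 ℕ.* k ℕ.* N)
        bound zero      = z≤n
        bound k@(suc _) = ℕ.≤-trans (ℕ.≤-reflexive (ℕ.*-comm 2 k)) (ℕ.*-monoʳ-≤ k (s≤s (s≤s z≤n)))

      2a≤q : 2 ℕ.* a ≤ order
      2a≤q = ℕ.≤-trans (ℕ.n≤1+n _) (ℕ.≤-reflexive (sym order≡1+2a))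

    -- Stepanov's bound gives each fibre at most q / 2 + (a n + B) / (2 k) points off the roots of
    -- the product, and there are at most n roots. Both fibres together have q points, so neither
    -- can be much smaller than q / 2.
    signs-bound : ∀ bs → All (_≢ 0#) bs → suc (length bs) ≤ N →
                  k ℕ.* ℤ.∣ ∑ elements (sg ∘ signs (0# ∷ bs)) ∣ ≤ order ℕ.* suc N
    signs-bound bs bs≢0 n≤N = ℕ.≤-trans (∑-sg-bound (signs (0# ∷ bs)) k (a ℕ.* n ℕ.+ B ℕ.+ n ℕ.* (2 ℕ.* k)) elements fibre-bound) final
      where
      open ℕ.≤-Reasoning
      n = suc (length bs)

      fibre-bound : ∀ b → length (fibre (signs (0# ∷ bs)) b elements) ℕ.* (2 ℕ.* k) ≤ a ℕ.* n ℕ.+ B ℕ.+ n ℕ.* (2 ℕ.* k) ℕ.+ k ℕ.* length elements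
      fibre-bound b = begin
        length L ℕ.* (2 ℕ.* k)
          ≡⟨ cong (ℕ._* (2 ℕ.* k)) (split-filter root? L) ⟩
        (length Z ℕ.+ length T) ℕ.* (2 ℕ.* k)
          ≡⟨ ℕ.*-distribʳ-+ (2 ℕ.* k) (length Z) (length T) ⟩
        length Z ℕ.* (2 ℕ.* k) ℕ.+ length T ℕ.* (2 ℕ.* k)
          ≤⟨ ℕ.+-mono-≤ (ℕ.*-monoˡ-≤ (2 ℕ.* k) few-roots) (St.stepanov T-unique (All.tabulate T-power)) ⟩
        n ℕ.* (2 ℕ.* k) ℕ.+ (a ℕ.* n ℕ.+ (k ℕ.* order ℕ.+ B))
          ≡⟨ solveℕ (n ℕ.* (2 ℕ.* k)) (a ℕ.* n) (k ℕ.* order) B ⟩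
        a ℕ.* n ℕ.+ B ℕ.+ n ℕ.* (2 ℕ.* k) ℕ.+ k ℕ.* order
          ≡⟨ cong (λ q → a ℕ.* n ℕ.+ B ℕ.+ n ℕ.* (2 ℕ.* k) ℕ.+ k ℕ.* q) length-elements ⟨
        a ℕ.* n ℕ.+ B ℕ.+ n ℕ.* (2 ℕ.* k) ℕ.+ k ℕ.* length elements ∎
        where
        -- Zero counts as a square, so `signs` is governed by Euler's criterion only off the roots
        -- of the product. The roots are split off and counted separately.
        root? : ∀ x → Dec (value (0# ∷ bs) x ≡ 0#)
        root? x = value (0# ∷ bs) x ≟ 0#
        L = fibre (signs (0# ∷ bs)) b elements
        Z = filter root? L
        T = filter (¬? ∘ root?) L
        L-unique : Unique L
        L-unique = Unique.filter⁺ _ elements-unique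
        T-unique : Unique T
        T-unique = Unique.filter⁺ _ L-unique
        few-roots : length Z ≤ n
        few-roots = ℕ.≤-trans (unique-⊆-length (Unique.filter⁺ root? L-unique)
          (λ z∈ → value-roots (0# ∷ bs) (proj₂ (Mem.∈-filter⁻ root? {xs = L} z∈)))) (ℕ.≤-reflexive (List.length-map -_ (0# ∷ bs)))
        T-power : ∀ {t} → t ∈ˡ T → value (0# ∷ bs) t ↑ a ≡ κ b
        T-power t∈T = case Mem.∈-filter⁻ (¬? ∘ root?) {xs = L} t∈T of λ (t∈L , v≢0) →
          trans (value-power (0# ∷ bs) _ v≢0) (cong κ (proj₂ (Mem.∈-filter⁻ (λ x → signs (0# ∷ bs) x Bool.≟ b) {xs = elements} t∈L)))
        module St = Stepanov K bs≢0 {a} {k} {B}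
          (s≤s (ℕ.*-monoʳ-≤ k (ℕ.+-monoʳ-≤ (1 ℕ.+ k) (ℕ.*-monoʳ-≤ (2 ℕ.* k) n≤N))))
          k-small
          (ℕ.≤-trans (ℕ.+-monoʳ-≤ a k-small) (ℕ.≤-trans (ℕ.≤-reflexive (cong (a ℕ.+_) (sym (ℕ.+-identityʳ a)))) 2a≤q))
          (ℕ.≤-trans 2k≤a (ℕ.≤-trans (ℕ.m≤m+n a _) 2a≤q)) (κ b) (κ≢0 b) 0<a
        solveℕ : ∀ x y z w → x ℕ.+ (y ℕ.+ (z ℕ.+ w)) ≡ y ℕ.+ w ℕ.+ x ℕ.+ z
        solveℕ x y z w = trans (ℕ.+-comm x _) (trans (cong (ℕ._+ x) (trans (cong (y ℕ.+_) (ℕ.+-comm z w)) (sym (ℕ.+-assoc y w z))))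
          (trans (ℕ.+-assoc (y ℕ.+ w) z x) (trans (cong (y ℕ.+ w ℕ.+_) (ℕ.+-comm z x)) (sym (ℕ.+-assoc (y ℕ.+ w) x z)))))

      final : a ℕ.* n ℕ.+ B ℕ.+ n ℕ.* (2 ℕ.* k) ≤ order ℕ.* suc N
      final = begin
        a ℕ.* n ℕ.+ B ℕ.+ n ℕ.* (2 ℕ.* k)   ≤⟨ ℕ.+-mono-≤ (ℕ.+-mono-≤ (ℕ.*-monoʳ-≤ a n≤N) k-small) (ℕ.*-mono-≤ n≤N 2k≤a) ⟩
        a ℕ.* N ℕ.+ a ℕ.+ N ℕ.* a           ≡⟨ cong₂ ℕ._+_ (trans (ℕ.+-comm (a ℕ.* N) a) (sym (ℕ.*-suc a N))) (ℕ.*-comm N a) ⟩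
        a ℕ.* suc N ℕ.+ a ℕ.* N             ≤⟨ ℕ.+-monoʳ-≤ (a ℕ.* suc N) (ℕ.*-monoʳ-≤ a (ℕ.n≤1+n N)) ⟩
        a ℕ.* suc N ℕ.+ a ℕ.* suc N         ≡⟨ ℕ.*-distribʳ-+ (suc N) a a ⟨
        (a ℕ.+ a) ℕ.* suc N                 ≡⟨ cong (λ m → (a ℕ.+ m) ℕ.* suc N) (ℕ.+-identityʳ a) ⟨
        (2 ℕ.* a) ℕ.* suc N                 ≤⟨ ℕ.*-monoˡ-≤ (suc N) 2a≤q ⟩
        order ℕ.* suc N                     ∎

    -- Replacing d by d - c moves the root belonging to c to 0, and the other shifts stay nonzero
    -- because the elements are distinct: the simple root at 0 that the auxiliary polynomial relies
    -- on.
    translates-bound : ∀ c S → Unique (c ∷ S) → length (c ∷ S) ≤ N →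
                       k ℕ.* ℤ.∣ ∑ elements (λ d → ∏ (c ∷ S) (λ x → sg (isSquare (x + d)))) ∣ ≤ order ℕ.* suc N
    translates-bound c S (c∉S ∷ _) len = subst (λ i → k ℕ.* ℤ.∣ i ∣ ≤ order ℕ.* suc N) (sym (begin
      ∑ elements (λ d → ∏ (c ∷ S) (λ x → sg (isSquare (x + d))))
        ≡⟨ ∑-translate (- c) (λ d → ∏ (c ∷ S) (λ x → sg (isSquare (x + d)))) ⟨
      ∑ elements (λ d → ∏ (c ∷ S) (λ x → sg (isSquare (x + (d + - c)))))
        ≡⟨ ∑-cong elements (λ d → trans (translate-∏ (- c) (c ∷ S) d)
             (trans (cong (λ z → ∏ (z ∷ map (_+ - c) S) (λ b → sg (isSquare (d + b)))) (-‿inverseʳ c)) (∏-signs (0# ∷ map (_+ - c) S) d))) ⟩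
      ∑ elements (sg ∘ signs (0# ∷ map (_+ - c) S)) ∎))
      (signs-bound (map (_+ - c) S) (All.map⁺ (All.map (λ c≢s ≡0 → c≢s (sym (-‿≡0⇒≡ ≡0))) c∉S))
        (subst (λ l → suc l ≤ N) (sym (List.length-map (_+ - c) S)) len))
      where open ≡-Reasoning

    -- Pairs are the parameters common to both characteristics. The sum over the first component
    -- contributes a factor q on either side of the bound for translates.
    odd-bias : ∀ {c S} → Unique (c ∷ S) → length (c ∷ S) ≤ N →
               k ℕ.* ℤ.∣ correlation pairs (λ (y , d) x → isSquare (x + d)) (c ∷ S) ∣ ≤ length pairs ℕ.* suc N
    odd-bias {c} {S} uniq len = begin
      k ℕ.* ℤ.∣ correlation pairs (λ (y , d) x → isSquare (x + d)) (c ∷ S) ∣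
        ≡⟨ cong (λ i → k ℕ.* ℤ.∣ i ∣) (trans (∑-cartesian _,_ _ elements elements) (∑-const translates elements)) ⟩
      k ℕ.* ℤ.∣ pos (length elements) ℤ.* translates ∣
        ≡⟨ cong (k ℕ.*_) (ℤ.abs-* (pos (length elements)) translates) ⟩
      k ℕ.* (length elements ℕ.* ℤ.∣ translates ∣)
        ≡⟨ trans (sym (ℕ.*-assoc k _ _)) (trans (cong (ℕ._* ℤ.∣ translates ∣) (ℕ.*-comm k (length elements))) (ℕ.*-assoc (length elements) k _)) ⟩
      length elements ℕ.* (k ℕ.* ℤ.∣ translates ∣)
        ≤⟨ ℕ.*-monoʳ-≤ (length elements) (translates-bound c S uniq len) ⟩
      length elements ℕ.* (order ℕ.* suc N)
        ≡⟨ ℕ.*-assoc (length elements) order (suc N) ⟨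
      length elements ℕ.* order ℕ.* suc N
        ≡⟨ cong (ℕ._* suc N) (trans (cong (ℕ._* order) length-elements) (sym length-pairs)) ⟩
      length pairs ℕ.* suc N ∎
      where
      open ℕ.≤-Reasoning
      translates = ∑ elements (λ d → ∏ (c ∷ S) (λ x → sg (isSquare (x + d))))

-- Artin–Schreier characters in characteristic two

module ArtinSchreier (K : FiniteField) (2≡0 : Char2 K) where
  open Field K
  open Polynomial K
  open Products K using (value; value-roots; linears; length-linears)

  x+x≡0 : ∀ x → x + x ≡ 0#
  x+x≡0 x = trans (solve 1 (λ x → x :+ x := (con (pos 1) :+ con (pos 1)) :* x) refl x) (trans (cong (_* x) 2≡0) (zeroˡ x))

  ℘ : Carrier → Carrier
  ℘ z = z * z + z

  ℘-+ : ∀ z w → ℘ (z + w) ≡ ℘ z + ℘ w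
  ℘-+ z w = begin
    (z + w) * (z + w) + (z + w)            ≡⟨ solve 2 (λ z w → (z :+ w) :* (z :+ w) :+ (z :+ w) := (z :* w :+ z :* w) :+ (z :* z :+ z :+ (w :* w :+ w))) refl z w ⟩
    (z * w + z * w) + (℘ z + ℘ w)          ≡⟨ cong (_+ (℘ z + ℘ w)) (x+x≡0 (z * w)) ⟩
    0# + (℘ z + ℘ w)                       ≡⟨ +-identityˡ _ ⟩
    ℘ z + ℘ w                              ∎
    where open ≡-Reasoning

  InImage : Carrier → Set
  InImage x = ∃[ z ] ℘ z ≡ x

  inImage? : ∀ x → Dec (InImage x)
  inImage? x = ∃? (λ z → ℘ z ≟ x)

  ℘0 : ℘ 0# ≡ 0#
  ℘0 = solve 0 (con (pos 0) :* con (pos 0) :+ con (pos 0) := con (pos 0)) refl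

  image-+ : ∀ {x y} → InImage x → InImage y → InImage (x + y)
  image-+ (z , refl) (w , refl) = z + w , ℘-+ z w

  +-cancel₂ : ∀ x y → x + (x + y) ≡ y
  +-cancel₂ x y = trans (sym (+-assoc x x y)) (trans (cong (_+ y) (x+x≡0 x)) (+-identityˡ y))

  image-cancel : ∀ {x y} → InImage x → InImage (x + y) → InImage y
  image-cancel {x} {y} hx hxy = subst InImage (+-cancel₂ x y) (image-+ hx hxy)

  ℘-fibre : ∀ {z w} → ℘ z ≡ ℘ w → z ≡ w ⊎ z ≡ w + 1#
  ℘-fibre {z} {w} eq with *≡0⇒ (z + - w) (z + (w + 1#)) (trans
    (solve 2 (λ z w → (z :+ :- w) :* (z :+ (w :+ con (pos 1))) := z :* z :+ z :+ :- (w :* w :+ w)) refl z w)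
    (trans (cong (_+ - ℘ w) eq) (-‿inverseʳ (℘ w))))
  ... | inj₁ z-w≡0 = inj₁ (-‿≡0⇒≡ z-w≡0)
  ... | inj₂ sum≡0 = inj₂ (trans (sym (+-identityʳ z)) (trans (cong (z +_) (sym (x+x≡0 (w + 1#))))
    (trans (sym (+-assoc z _ _)) (trans (cong (_+ (w + 1#)) sum≡0) (+-identityˡ _)))))

  image : List Carrier
  image = filter inImage? elements

  image-unique : Unique image
  image-unique = Unique.filter⁺ inImage? elements-unique

  ∈-image⁻ : ∀ {x} → x ∈ˡ image → InImage x
  ∈-image⁻ = proj₂ ∘ Mem.∈-filter⁻ inImage? {xs = elements}

  preimage : ∀ {x} → Dec (InImage x) → Carrier
  preimage (yes (z , _)) = z
  preimage (no _)        = 0#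

  preimage-correct : ∀ {x} (d : Dec (InImage x)) → InImage x → ℘ (preimage d) ≡ x
  preimage-correct (yes (_ , eq)) _ = eq
  preimage-correct (no ¬h)        h = contradiction h ¬h

  order≤2image : order ≤ 2 ℕ.* length image
  order≤2image = begin
    order                                ≡⟨ length-elements ⟨
    length elements                      ≤⟨ unique-⊆-length elements-unique (λ {z} _ → Mem.∈-concatMap⁺ fibres (covered z)) ⟩
    length (concatMap fibres image)      ≡⟨ length-concat image ⟩
    2 ℕ.* length image                   ∎
    where
    open ℕ.≤-Reasoning
    fibres : Carrier → List Carrier
    fibres h = preimage (inImage? h) ∷ preimage (inImage? h) + 1# ∷ []
    length-concat : ∀ xs → length (concatMap fibres xs) ≡ 2 ℕ.* length xs
    length-concat []       = refl
    length-concat (x ∷ xs) = trans (cong (2 ℕ.+_) (length-concat xs)) (sym (ℕ.*-suc 2 (length xs)))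
    covered : ∀ z → Any (λ h → z ∈ˡ fibres h) image
    covered z = Any.map (λ { {h} refl → [ here , there ∘ here ]′ (℘-fibre (sym (preimage-correct (inImage? h) (z , refl)))) })
      (Mem.∈-filter⁺ inImage? (∈-elements (℘ z)) (z , refl))

  -- Three distinct cosets would not fit into K.
  index-two : ∀ {x y} → ¬ InImage x → ¬ InImage y → InImage (x + y)
  index-two {x} {y} ¬hx ¬hy with inImage? (x + y)
  ... | yes h = h
  ... | no ¬hxy = contradiction three-cosets (ℕ.<⇒≱ (begin-strict
    2 ℕ.* length image                                         ≡⟨ cong (length image ℕ.+_) (ℕ.+-identityʳ (length image)) ⟩
    length image ℕ.+ length image                              <⟨ ℕ.+-monoʳ-< (length image) (ℕ.m<m+n (length image) 0<image) ⟩
    length image ℕ.+ (length image ℕ.+ length image)           ≡⟨ length-cosets ⟨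
    length (image ++ (map (x +_) image ++ map (y +_) image))   ∎))
    where
    open ℕ.≤-Reasoning
    0<image : 0 < length image
    0<image = nonempty (Mem.∈-filter⁺ inImage? (∈-elements 0#) (0# , ℘0))
      where
      nonempty : ∀ {xs : List Carrier} → 0# ∈ˡ xs → 0 < length xs
      nonempty (here _)  = s≤s z≤n
      nonempty (there _) = s≤s z≤n
    length-cosets : length (image ++ (map (x +_) image ++ map (y +_) image)) ≡ length image ℕ.+ (length image ℕ.+ length image)
    length-cosets = trans (List.length-++ image) (cong (length image ℕ.+_) (trans (List.length-++ (map (x +_) image))
      (cong₂ ℕ._+_ (List.length-map (x +_) image) (List.length-map (y +_) image))))
    +-injective : ∀ u {v w} → u + v ≡ u + w → v ≡ w
    +-injective u {v} {w} eq = trans (sym (+-cancel₂ u v)) (trans (cong (u +_) eq) (+-cancel₂ u w))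
    coset : ∀ u {v} → v ∈ˡ map (u +_) image → InImage (u + v)
    coset u v∈ = case Mem.∈-map⁻ (u +_) v∈ of λ { (h , h∈ , refl) → subst InImage (sym (+-cancel₂ u h)) (∈-image⁻ h∈) }
    cosets-unique : Unique (image ++ (map (x +_) image ++ map (y +_) image))
    cosets-unique = Unique.++⁺ image-unique
      (Unique.++⁺ (Unique.map⁺ (+-injective x) image-unique) (Unique.map⁺ (+-injective y) image-unique)
        λ {v} (v∈x , v∈y) → ¬hxy (subst InImage
          (trans (solve 3 (λ x y v → (x :+ v) :+ (y :+ v) := x :+ y :+ (v :+ v)) refl x y v) (trans (cong (x + y +_) (x+x≡0 v)) (+-identityʳ _)))
          (image-+ (coset x v∈x) (coset y v∈y))))
      λ {v} (v∈ , v∈′) → [ (λ v∈x → ¬hx (image-cancel (∈-image⁻ v∈) (subst InImage (+-comm x v) (coset x v∈x))))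
                         , (λ v∈y → ¬hy (image-cancel (∈-image⁻ v∈) (subst InImage (+-comm y v) (coset y v∈y)))) ]′
                         (Mem.∈-++⁻ (map (x +_) image) v∈′)
    three-cosets : length (image ++ (map (x +_) image ++ map (y +_) image)) ≤ 2 ℕ.* length image
    three-cosets = ℕ.≤-trans (unique-⊆-length cosets-unique (λ {v} _ → ∈-elements v)) (ℕ.≤-trans (ℕ.≤-reflexive length-elements) order≤2image)

  -- ℘ identifies 0 and 1, so it is not surjective.
  outside : ∃[ x ] ¬ InImage x
  outside with ∃? (λ x → ¬? (inImage? x))
  ... | yes found = found
  ... | no none   = contradiction (begin
    suc (length nonzeros)           ≡⟨ trans (sym order≡1+nonzeros) (sym length-elements) ⟩
    length elements                 ≤⟨ unique-⊆-length elements-unique (λ {x} _ → onto (Dec.decidable-stable (inImage? x) (λ ¬h → none (x , ¬h)))) ⟩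
    length (map ℘ nonzeros)         ≡⟨ List.length-map ℘ nonzeros ⟩
    length nonzeros                 ∎) (ℕ.<-irrefl refl)
    where
    open ℕ.≤-Reasoning
    ℘1 : ℘ 1# ≡ 0#
    ℘1 = trans (cong (_+ 1#) (*-identityˡ 1#)) 2≡0
    onto : ∀ {x} → InImage x → x ∈ˡ map ℘ nonzeros
    onto (z , refl) with z ≟ 0#
    ... | no z≢0   = Mem.∈-map⁺ ℘ (∈-nonzeros z≢0)
    ... | yes refl = subst (_∈ˡ map ℘ nonzeros) (trans ℘1 (sym ℘0)) (Mem.∈-map⁺ ℘ (∈-nonzeros (λ 1≡0 → 0≢1 (sym 1≡0))))

  ψ : Carrier → ℤ
  ψ x = sg (does (inImage? x))

  ψ-true : ∀ {x} → InImage x → ψ x ≡ pos 1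
  ψ-true {x} h = cong sg (Dec.dec-true (inImage? x) h)

  ψ-false : ∀ {x} → ¬ InImage x → ψ x ≡ -[1+ 0 ]
  ψ-false {x} ¬h = cong sg (Dec.dec-false (inImage? x) ¬h)

  ψ-+ : ∀ x y → ψ (x + y) ≡ ψ x ℤ.* ψ y
  ψ-+ x y = by-cases (inImage? x) (inImage? y)
    where
    by-cases : Dec (InImage x) → Dec (InImage y) → ψ (x + y) ≡ ψ x ℤ.* ψ y
    by-cases (yes hx) (yes hy) = trans (ψ-true (image-+ hx hy)) (sym (cong₂ ℤ._*_ (ψ-true hx) (ψ-true hy)))
    by-cases (yes hx) (no ¬hy) = trans (ψ-false (¬hy ∘ image-cancel hx)) (sym (cong₂ ℤ._*_ (ψ-true hx) (ψ-false ¬hy)))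
    by-cases (no ¬hx) (yes hy) = trans (ψ-false (¬hx ∘ image-cancel hy ∘ subst InImage (+-comm x y))) (sym (cong₂ ℤ._*_ (ψ-false ¬hx) (ψ-true hy)))
    by-cases (no ¬hx) (no ¬hy) = trans (ψ-true (index-two ¬hx ¬hy)) (sym (cong₂ ℤ._*_ (ψ-false ¬hx) (ψ-false ¬hy)))

  -- Translation by an element outside the image permutes the summands and reverses their signs.
  ∑ψ≡0 : ∑ elements ψ ≡ pos 0
  ∑ψ≡0 = self-negative (begin
    ∑ elements ψ                              ≡⟨ ∑-translate h ψ ⟨
    ∑ elements (λ x → ψ (x + h))              ≡⟨ ∑-cong elements (λ x → trans (ψ-+ x h) (trans (cong (ψ x ℤ.*_) (ψ-false ¬h)) (ℤ.*-comm (ψ x) -[1+ 0 ]))) ⟩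
    ∑ elements (λ x → -[1+ 0 ] ℤ.* ψ x)       ≡⟨ ∑-*ˡ -[1+ 0 ] ψ elements ⟩
    -[1+ 0 ] ℤ.* ∑ elements ψ                 ≡⟨ ℤ.-1*i≡-i _ ⟩
    ℤ.- ∑ elements ψ                          ∎)
    where
    open ≡-Reasoning
    h = proj₁ outside
    ¬h = proj₂ outside
    self-negative : ∀ {i} → i ≡ ℤ.- i → i ≡ pos 0
    self-negative {pos zero}    _  = refl
    self-negative {pos (suc n)} ()
    self-negative { -[1+ n ] }  ()

  inverse₀ : Carrier → Carrier
  inverse₀ x with x ≟ 0#
  ... | yes _  = 0#
  ... | no x≢0 = inv x≢0

  *-inverse₀ : ∀ {x} → x ≢ 0# → x * inverse₀ x ≡ 1#
  *-inverse₀ {x} x≢0 with x ≟ 0#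
  ... | yes x≡0 = contradiction x≡0 x≢0
  ... | no x≢0  = *-inv x≢0

  -- The condition y / (x + d) = ℘ z with its denominator cleared, as the language of rings
  -- requires.
  test? : ∀ y d x → Dec (∃[ z ] ℘ z * (x + d) ≡ y)
  test? y d x = ∃? (λ z → ℘ z * (x + d) ≟ y)

  test : Carrier × Carrier → Carrier → Bool
  test (y , d) x = does (test? y d x)

  test-ψ : ∀ y d x → x + d ≢ 0# → sg (test (y , d) x) ≡ ψ (y * inverse₀ (x + d))
  test-ψ y d x ≢0 = cong sg (Dec.does-⇔ (mk⇔
    (λ { (z , refl) → z , sym (trans (*-assoc _ _ _) (trans (cong (℘ z *_) (*-inverse₀ ≢0)) (*-identityʳ _))) })
    (λ { (z , eq) → z , trans (cong (_* (x + d)) eq) (trans (solve 3 (λ y i x → y :* i :* x := y :* (x :* i)) refl y (inverse₀ (x + d)) (x + d))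
      (trans (cong (y *_) (*-inverse₀ ≢0)) (*-identityʳ y))) })) (test? y d x) (inImage? (y * inverse₀ (x + d))))

  reciprocals : List Carrier → Carrier → Carrier
  reciprocals S d = foldr (λ x s → inverse₀ (x + d) + s) 0# S

  factor≢0 : ∀ {x S d} → value (x ∷ S) d ≢ 0# → x + d ≢ 0# × value S d ≢ 0#
  factor≢0 {x} {S} {d} v≢0 = (λ ≡0 → v≢0 (trans (cong (_* value S d) (trans (+-comm d x) ≡0)) (zeroˡ _))) , (λ ≡0 → v≢0 (trans (cong ((d + x) *_) ≡0) (zeroʳ _)))

  ∏-test : ∀ S y d → value S d ≢ 0# → ∏ S (sg ∘ test (y , d)) ≡ ψ (y * reciprocals S d)
  ∏-test []      y d _   = sym (ψ-true (0# , trans ℘0 (sym (zeroʳ y))))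
  ∏-test (x ∷ S) y d v≢0 = begin
    sg (test (y , d) x) ℤ.* ∏ S (sg ∘ test (y , d))              ≡⟨ cong₂ ℤ._*_ (test-ψ y d x (proj₁ nz)) (∏-test S y d (proj₂ nz)) ⟩
    ψ (y * inverse₀ (x + d)) ℤ.* ψ (y * reciprocals S d)         ≡⟨ ψ-+ _ _ ⟨
    ψ (y * inverse₀ (x + d) + y * reciprocals S d)               ≡⟨ cong ψ (distribˡ y _ _) ⟨
    ψ (y * reciprocals (x ∷ S) d)                                ∎
    where
    open ≡-Reasoning
    nz = factor≢0 {x} {S} {d} v≢0

  -- the numerator of ∑ 1 / (X + x), x ∈ S
  derivative : List Carrier → List Carrier
  derivative []      = []
  derivative (x ∷ S) = linear x (derivative S) ⊞ linears S (1# ∷ [])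

  length-derivative : ∀ S → length (derivative S) ≤ length S
  length-derivative []      = z≤n
  length-derivative (x ∷ S) = length-⊞ (linear x (derivative S)) (linears S (1# ∷ []))
    (ℕ.≤-trans (length-linear x (derivative S)) (s≤s (length-derivative S)))
    (ℕ.≤-trans (length-linears S (1# ∷ [])) (ℕ.≤-reflexive (ℕ.+-comm (length S) 1)))

  ⟦linears-1⟧ : ∀ S t → ⟦ linears S (1# ∷ []) ⟧ t ≡ value S t
  ⟦linears-1⟧ []      t = solve 1 (λ t → con (pos 1) :+ t :* con (pos 0) := con (pos 1)) refl t
  ⟦linears-1⟧ (x ∷ S) t = trans (Values.⟦linear⟧ x (linears S (1# ∷ [])) t) (cong ((t + x) *_) (⟦linears-1⟧ S t))

  ⟦derivative-∷⟧ : ∀ x S t → ⟦ derivative (x ∷ S) ⟧ t ≡ (t + x) * ⟦ derivative S ⟧ t + value S t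
  ⟦derivative-∷⟧ x S t = trans (Values.⟦⊞⟧ (linear x (derivative S)) (linears S (1# ∷ [])) t)
    (cong₂ _+_ (Values.⟦linear⟧ x (derivative S) t) (⟦linears-1⟧ S t))

  ⟦derivative⟧ : ∀ S d → value S d ≢ 0# → ⟦ derivative S ⟧ d ≡ value S d * reciprocals S d
  ⟦derivative⟧ []      d _   = sym (zeroʳ 1#)
  ⟦derivative⟧ (x ∷ S) d v≢0 = begin
    ⟦ derivative (x ∷ S) ⟧ d                                               ≡⟨ ⟦derivative-∷⟧ x S d ⟩
    (d + x) * ⟦ derivative S ⟧ d + value S d                               ≡⟨ cong₂ (λ u v → (d + x) * u + v) (⟦derivative⟧ S d (proj₂ nz)) (sym (*-identityˡ _)) ⟩
    (d + x) * (value S d * reciprocals S d) + 1# * value S d               ≡⟨ cong (λ u → (d + x) * (value S d * reciprocals S d) + u * value S d) (*-inverse₀ (proj₁ nz)) ⟨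
    (d + x) * (value S d * reciprocals S d) + (x + d) * inverse₀ (x + d) * value S d
      ≡⟨ solve 5 (λ d x v r i → (d :+ x) :* (v :* r) :+ (x :+ d) :* i :* v := (d :+ x) :* v :* (i :+ r)) refl d x (value S d) (reciprocals S d) (inverse₀ (x + d)) ⟩
    value (x ∷ S) d * reciprocals (x ∷ S) d                                ∎
    where
    open ≡-Reasoning
    nz = factor≢0 {x} {S} {d} v≢0

  Exceptional : List Carrier → Carrier → Set
  Exceptional S d = value S d ≡ 0# ⊎ ⟦ derivative S ⟧ d ≡ 0#

  exceptional? : ∀ S d → Dec (Exceptional S d)
  exceptional? S d = (value S d ≟ 0#) ⊎-dec (⟦ derivative S ⟧ d ≟ 0#)

  critical? : ∀ S d → Dec (⟦ derivative S ⟧ d ≡ 0#)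
  critical? S d = ⟦ derivative S ⟧ d ≟ 0#

  -- At - c only the summand of `derivative` that omits the factor X + c survives, and it is nonzero
  -- because the elements are distinct. So `derivative` is a nonzero polynomial of degree below the
  -- size of the set.
  few-critical : ∀ c S → Unique (c ∷ S) → length (filter (critical? (c ∷ S)) elements) ≤ length (c ∷ S)
  few-critical c S (c∉S ∷ _) = ℕ.≮⇒≥ λ many → value≢0 (begin
    value S (- c)
      ≡⟨ solve 3 (λ c v w → v := (:- c :+ c) :* w :+ v) refl c (value S (- c)) (⟦ derivative S ⟧ (- c)) ⟩
    (- c + c) * ⟦ derivative S ⟧ (- c) + value S (- c)
      ≡⟨ ⟦derivative-∷⟧ c S (- c) ⟨
    ⟦ derivative (c ∷ S) ⟧ (- c)
      ≡⟨ Values.⟦zero⟧ (derivative (c ∷ S)) (roots-bound (derivative (c ∷ S)) (filter (critical? (c ∷ S)) elements)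
           (Unique.filter⁺ (critical? (c ∷ S)) elements-unique)
           (All.tabulate (λ d∈ → proj₂ (Mem.∈-filter⁻ (critical? (c ∷ S)) {xs = elements} d∈)))
           (ℕ.≤-trans (length-derivative (c ∷ S)) (ℕ.<⇒≤ many))) (- c) ⟩
    0# ∎)
    where
    open ≡-Reasoning
    value≢0 : value S (- c) ≢ 0#
    value≢0 ≡0 = case Mem.∈-map⁻ -_ (value-roots S ≡0) of λ (x , x∈S , -c≡-x) →
      All.lookup c∉S x∈S (trans (solve 1 (λ c → c := :- (:- c)) refl c) (trans (cong -_ -c≡-x) (solve 1 (λ c → :- (:- c) := c) refl x)))

  few-exceptional : ∀ c S → Unique (c ∷ S) → length (filter (exceptional? (c ∷ S)) elements) ≤ 2 ℕ.* length (c ∷ S)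
  few-exceptional c S uniq = begin
    length (filter (exceptional? (c ∷ S)) elements)
      ≤⟨ unique-⊆-length (Unique.filter⁺ (exceptional? (c ∷ S)) elements-unique)
           (λ d∈ → [ Mem.∈-++⁺ˡ ∘ value-roots (c ∷ S)
                   , Mem.∈-++⁺ʳ (map -_ (c ∷ S)) ∘ Mem.∈-filter⁺ (critical? (c ∷ S)) (∈-elements _) ]′
                   (proj₂ (Mem.∈-filter⁻ (exceptional? (c ∷ S)) {xs = elements} d∈))) ⟩
    length (map -_ (c ∷ S) ++ filter (critical? (c ∷ S)) elements)
      ≡⟨ List.length-++ (map -_ (c ∷ S)) ⟩
    length (map -_ (c ∷ S)) ℕ.+ length (filter (critical? (c ∷ S)) elements)
      ≤⟨ ℕ.+-mono-≤ (ℕ.≤-reflexive (List.length-map -_ (c ∷ S))) (ℕ.≤-trans (few-critical c S uniq) (ℕ.m≤m+n _ 0)) ⟩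
    2 ℕ.* length (c ∷ S) ∎
    where open ℕ.≤-Reasoning

  ∣∏-sg∣ : ∀ (g : Carrier → Bool) S → ℤ.∣ ∏ S (sg ∘ g) ∣ ≡ 1
  ∣∏-sg∣ g []      = refl
  ∣∏-sg∣ g (x ∷ S) = trans (ℤ.abs-* (sg (g x)) _) (cong₂ ℕ._*_ (∣sg∣ (g x)) (∣∏-sg∣ g S))

  column : List Carrier → Carrier → ℤ
  column S d = ∑ elements (λ y → ∏ S (sg ∘ test (y , d)))

  ∣column∣ : ∀ S d → ℤ.∣ column S d ∣ ≤ order
  ∣column∣ S d = begin
    ℤ.∣ column S d ∣
      ≤⟨ ∑-bound (λ y → ∏ S (sg ∘ test (y , d))) 1 (λ _ → yes tt) elements (λ y → ℕ.≤-reflexive (∣∏-sg∣ (test (y , d)) S)) (λ _ ¬⊤ → contradiction tt ¬⊤) ⟩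
    length (filter (λ _ → yes tt) elements) ℕ.* 1
      ≤⟨ ℕ.*-monoˡ-≤ 1 (List.length-filter (λ _ → yes tt) elements) ⟩
    length elements ℕ.* 1
      ≡⟨ trans (ℕ.*-identityʳ _) length-elements ⟩
    order ∎
    where open ℕ.≤-Reasoning

  -- Off the poles the product is the character ψ at y times the sum of reciprocals. When that sum
  -- is nonzero, y runs over all of K after scaling, and ψ sums to zero.
  column≡0 : ∀ S d → ¬ Exceptional S d → column S d ≡ pos 0
  column≡0 S d regular = begin
    column S d                                          ≡⟨ ∑-cong elements (λ y → ∏-test S y d value≢0) ⟩
    ∑ elements (λ y → ψ (y * reciprocals S d))          ≡⟨ ∑-scale reciprocals≢0 ψ ⟩
    ∑ elements ψ                                        ≡⟨ ∑ψ≡0 ⟩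
    pos 0                                               ∎
    where
    open ≡-Reasoning
    value≢0 : value S d ≢ 0#
    value≢0 = regular ∘ inj₁
    reciprocals≢0 : reciprocals S d ≢ 0#
    reciprocals≢0 ≡0 = regular (inj₂ (trans (⟦derivative⟧ S d value≢0) (trans (cong (value S d *_) ≡0) (zeroʳ _))))

  -- At most 2 N values of d are exceptional, and each contributes at most q to a sum over q² pairs;
  -- this is a relative bias of 2 N / q, to be compared with (N + 1) / k.
  even-bias : ∀ k N → 2 ℕ.* k ≤ order → ∀ {c S} → Unique (c ∷ S) → length (c ∷ S) ≤ N →
              k ℕ.* ℤ.∣ correlation pairs test (c ∷ S) ∣ ≤ length pairs ℕ.* suc N
  even-bias k N 2k≤q {c} {S} uniq len = begin
    k ℕ.* ℤ.∣ correlation pairs test (c ∷ S) ∣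
      ≡⟨ cong (λ i → k ℕ.* ℤ.∣ i ∣) (trans (∑-cartesian _,_ _ elements elements) (∑-swap _ elements elements)) ⟩
    k ℕ.* ℤ.∣ ∑ elements (column (c ∷ S)) ∣
      ≤⟨ ℕ.*-monoʳ-≤ k (ℕ.≤-trans (∑-bound (column (c ∷ S)) order (exceptional? (c ∷ S)) elements (∣column∣ (c ∷ S)) (column≡0 (c ∷ S)))
           (ℕ.*-monoˡ-≤ order (ℕ.≤-trans (few-exceptional c S uniq) (ℕ.*-monoʳ-≤ 2 len)))) ⟩
    k ℕ.* (2 ℕ.* N ℕ.* order)
      ≡⟨ +-*-Solver.solve 3 (λ k N q → k +-*-Solver.:* (+-*-Solver.con 2 +-*-Solver.:* N +-*-Solver.:* q) +-*-Solver.:= q +-*-Solver.:* (+-*-Solver.con 2 +-*-Solver.:* k +-*-Solver.:* N)) refl k N order ⟩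
    order ℕ.* (2 ℕ.* k ℕ.* N)
      ≤⟨ ℕ.*-monoʳ-≤ order (ℕ.*-mono-≤ 2k≤q (ℕ.n≤1+n N)) ⟩
    order ℕ.* (order ℕ.* suc N)
      ≡⟨ ℕ.*-assoc order order (suc N) ⟨
    order ℕ.* order ℕ.* suc N
      ≡⟨ cong (ℕ._* suc N) length-pairs ⟨
    length pairs ℕ.* suc N ∎
    where open ℕ.≤-Reasoning

-- 2 ^ n ≤ q ^ (e + 1) says that n is O(log q).  For k = 2 ^ ⌊n / r⌋ the relative
-- bias (n + 1) / k then beats 2 ^ - n after `copies` repetitions, while k ^ 4 ≤ q.
module Parameters (e : ℕ) where

  r copies threshold : ℕ
  -- With k = 2 ^ ⌊n / r⌋ this gives k ^ r ≤ 2 ^ n ≤ q ^ (e + 1), hence k ^ 4 ≤ q.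
  r         = 4 ℕ.* suc e
  -- Since (n + 1) ² ≤ k, half of the 4 r factors k absorb the power of n + 1, and the other half
  -- exceed 2 ^ n.
  copies    = 2 ℕ.* r ℕ.+ 2 ℕ.* r
  -- This makes ⌊n / r⌋ at least 12 r and half of it at least 6 r, the range in which `exponential`
  -- yields (n + 1) ² ≤ k.
  threshold = 12 ℕ.* r ℕ.* r

  private
    open ℕ.≤-Reasoning

    1+7r≤8^r : ∀ r → 1 ℕ.+ 7 ℕ.* r ≤ 8 ^ r
    1+7r≤8^r zero    = ℕ.≤-refl
    1+7r≤8^r (suc r) = begin
      1 ℕ.+ 7 ℕ.* suc r                       ≡⟨ solve 1 (λ r → con 1 :+ con 7 :* (con 1 :+ r) := (con 1 :+ con 7 :* r) :+ con 7) refl r ⟩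
      (1 ℕ.+ 7 ℕ.* r) ℕ.+ 7                   ≤⟨ ℕ.+-mono-≤ (1+7r≤8^r r) (ℕ.*-monoʳ-≤ 7 (ℕ.m^n>0 8 r)) ⟩
      8 ^ r ℕ.+ 7 ℕ.* 8 ^ r                   ∎
      where open +-*-Solver

    base-case : ∀ r → 1 ≤ r → 2 ℕ.* r ℕ.* suc (6 ℕ.* r) ≤ 2 ^ (6 ℕ.* r)
    base-case r 1≤r = begin
      2 ℕ.* r ℕ.* suc (6 ℕ.* r)         ≤⟨ ℕ.*-mono-≤ (ℕ.≤-trans (ℕ.≤-trans (ℕ.*-monoˡ-≤ r {2} {7} (s≤s (s≤s z≤n))) (ℕ.n≤1+n _)) (1+7r≤8^r r))
                                            (ℕ.≤-trans (s≤s (ℕ.*-monoˡ-≤ r {6} {7} (ℕ.n≤1+n 6))) (1+7r≤8^r r)) ⟩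
      8 ^ r ℕ.* 8 ^ r                   ≡⟨ cong₂ ℕ._*_ (ℕ.^-*-assoc 2 3 r) (ℕ.^-*-assoc 2 3 r) ⟩
      2 ^ (3 ℕ.* r) ℕ.* 2 ^ (3 ℕ.* r)   ≡⟨ ℕ.^-distribˡ-+-* 2 (3 ℕ.* r) (3 ℕ.* r) ⟨
      2 ^ (3 ℕ.* r ℕ.+ 3 ℕ.* r)         ≡⟨ cong (2 ^_) (ℕ.*-distribʳ-+ r 3 3) ⟨
      2 ^ (6 ℕ.* r)                     ∎

    exponential : ∀ r d → 1 ≤ r → 2 ℕ.* r ℕ.* suc (6 ℕ.* r ℕ.+ d) ≤ 2 ^ (6 ℕ.* r ℕ.+ d)
    exponential r zero    1≤r = subst (λ i → 2 ℕ.* r ℕ.* suc i ≤ 2 ^ i) (sym (ℕ.+-identityʳ (6 ℕ.* r))) (base-case r 1≤r)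
    exponential r (suc d) 1≤r = subst (λ i → 2 ℕ.* r ℕ.* suc i ≤ 2 ^ i) (sym (ℕ.+-suc (6 ℕ.* r) d)) (begin
      2 ℕ.* r ℕ.* suc (suc i)                                 ≡⟨ ℕ.*-suc (2 ℕ.* r) (suc i) ⟩
      2 ℕ.* r ℕ.+ 2 ℕ.* r ℕ.* suc i                           ≤⟨ ℕ.+-monoˡ-≤ _ (ℕ.m≤m*n (2 ℕ.* r) (suc i)) ⟩
      2 ℕ.* r ℕ.* suc i ℕ.+ 2 ℕ.* r ℕ.* suc i                 ≤⟨ ℕ.+-mono-≤ (exponential r d 1≤r) (exponential r d 1≤r) ⟩
      2 ^ i ℕ.+ 2 ^ i                                         ≡⟨ cong (2 ^ i ℕ.+_) (ℕ.+-identityʳ _) ⟨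
      2 ^ suc i                                               ∎)
      where i = 6 ℕ.* r ℕ.+ d

  module _ {n q : ℕ} (large : threshold ≤ n) (log-bound : 2 ^ n ≤ q ^ suc e) where

    j k : ℕ
    j = n ℕ./ r
    k = 2 ^ j

    private
      12r≤j : 12 ℕ.* r ≤ j
      12r≤j = ℕ.≤-trans (ℕ.≤-reflexive (sym (ℕ.m*n/n≡m (12 ℕ.* r) r))) (ℕ./-monoˡ-≤ r large)

      n<r[1+j] : n < r ℕ.* suc j
      n<r[1+j] = begin-strict
        n                           ≡⟨ ℕ.m≡m%n+[m/n]*n n r ⟩
        n ℕ.% r ℕ.+ j ℕ.* r         <⟨ ℕ.+-monoˡ-< (j ℕ.* r) (ℕ.m%n<n n r) ⟩
        suc j ℕ.* r                 ≡⟨ ℕ.*-comm (suc j) r ⟩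
        r ℕ.* suc j                 ∎

      i : ℕ
      i = j ℕ./ 2

      6r≤i : 6 ℕ.* r ≤ i
      6r≤i = begin
        6 ℕ.* r                 ≡⟨ ℕ.m*n/n≡m (6 ℕ.* r) 2 ⟨
        6 ℕ.* r ℕ.* 2 ℕ./ 2     ≤⟨ ℕ./-monoˡ-≤ 2 (ℕ.≤-trans (ℕ.≤-reflexive (trans (ℕ.*-comm (6 ℕ.* r) 2) (sym (ℕ.*-assoc 2 6 r)))) 12r≤j) ⟩
        i                       ∎

      1+j≤2[1+i] : suc j ≤ 2 ℕ.* suc i
      1+j≤2[1+i] = begin
        suc j                           ≡⟨ cong suc (ℕ.m≡m%n+[m/n]*n j 2) ⟩
        suc (j ℕ.% 2 ℕ.+ i ℕ.* 2)       ≤⟨ ℕ.+-monoˡ-≤ (i ℕ.* 2) (ℕ.m%n<n j 2) ⟩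
        suc i ℕ.* 2                     ≡⟨ ℕ.*-comm (suc i) 2 ⟩
        2 ℕ.* suc i                     ∎

      1+n≤2^i : suc n ≤ 2 ^ i
      1+n≤2^i = begin
        suc n                           ≤⟨ n<r[1+j] ⟩
        r ℕ.* suc j                     ≤⟨ ℕ.*-monoʳ-≤ r 1+j≤2[1+i] ⟩
        r ℕ.* (2 ℕ.* suc i)             ≡⟨ trans (sym (ℕ.*-assoc r 2 (suc i))) (cong (ℕ._* suc i) (ℕ.*-comm r 2)) ⟩
        2 ℕ.* r ℕ.* suc i               ≡⟨ cong (λ i → 2 ℕ.* r ℕ.* suc i) (ℕ.m+[n∸m]≡n 6r≤i) ⟨
        2 ℕ.* r ℕ.* suc (6 ℕ.* r ℕ.+ (i ∸ 6 ℕ.* r))   ≤⟨ exponential r (i ∸ 6 ℕ.* r) (s≤s z≤n) ⟩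
        2 ^ (6 ℕ.* r ℕ.+ (i ∸ 6 ℕ.* r)) ≡⟨ cong (2 ^_) (ℕ.m+[n∸m]≡n 6r≤i) ⟩
        2 ^ i                           ∎

      [1+n]²≤k : suc n ℕ.* suc n ≤ k
      [1+n]²≤k = begin
        suc n ℕ.* suc n       ≤⟨ ℕ.*-mono-≤ 1+n≤2^i 1+n≤2^i ⟩
        2 ^ i ℕ.* 2 ^ i       ≡⟨ ℕ.^-distribˡ-+-* 2 i i ⟨
        2 ^ (i ℕ.+ i)         ≤⟨ ℕ.^-monoʳ-≤ 2 (ℕ.≤-trans (ℕ.≤-reflexive (trans (cong (i ℕ.+_) (sym (ℕ.+-identityʳ i))) (ℕ.*-comm 2 i))) (ℕ.m/n*n≤m j 2)) ⟩
        k                     ∎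

      1+n≤k : suc n ≤ k
      1+n≤k = ℕ.≤-trans (ℕ.m≤m*n (suc n) (suc n)) [1+n]²≤k

      8≤k : 8 ≤ k
      8≤k = ℕ.^-monoʳ-≤ 2 (ℕ.≤-trans (ℕ.*-mono-≤ {3} {12} {1} {r} (s≤s (s≤s (s≤s z≤n))) (s≤s z≤n)) 12r≤j)

      k⁴≤q : k ^ 4 ≤ q
      k⁴≤q = ℕ.≮⇒≥ λ q<k⁴ → ℕ.<⇒≱ (ℕ.^-monoˡ-< (suc e) q<k⁴) (begin
        (k ^ 4) ^ suc e           ≡⟨ ℕ.^-*-assoc k 4 (suc e) ⟩
        k ^ r                     ≡⟨ ℕ.^-*-assoc 2 j r ⟩
        2 ^ (j ℕ.* r)             ≤⟨ ℕ.^-monoʳ-≤ 2 (ℕ.m/n*n≤m n r) ⟩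
        2 ^ n                     ≤⟨ log-bound ⟩
        q ^ suc e                 ∎)

      8k³≤q : 8 ℕ.* (k ℕ.* k ℕ.* k) ≤ q
      8k³≤q = begin
        8 ℕ.* (k ℕ.* k ℕ.* k)     ≤⟨ ℕ.*-monoˡ-≤ (k ℕ.* k ℕ.* k) 8≤k ⟩
        k ℕ.* (k ℕ.* k ℕ.* k)     ≡⟨ solve 1 (λ k → k :* (k :* k :* k) := k :* (k :* (k :* (k :* con 1)))) refl k ⟩
        k ^ 4                     ≤⟨ k⁴≤q ⟩
        q                         ∎
        where open +-*-Solver

      0<k : 0 < k
      0<k = ℕ.≤-trans (s≤s z≤n) 8≤k

      instance
        k-nonZero : ℕ.NonZero k
        k-nonZero = ℕ.>-nonZero 0<k

      k≤k³ : k ≤ k ℕ.* k ℕ.* k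
      k≤k³ = ℕ.≤-trans (ℕ.m≤m*n k k) (ℕ.m≤m*n (k ℕ.* k) k)

    2k≤q : 2 ℕ.* k ≤ q
    2k≤q = ℕ.≤-trans (ℕ.*-mono-≤ {2} {8} (s≤s (s≤s z≤n)) k≤k³) 8k³≤q

    -- In odd characteristic, where q = 1 + 2 a, this says B ≤ a for the block length B. As n < k,
    -- that length is of order k ³; the fourth power of k below q leaves room for the constant.
    enough-room : suc (2 ℕ.* suc (k ℕ.* (1 ℕ.+ k ℕ.+ 2 ℕ.* k ℕ.* n))) ≤ q
    enough-room = begin
      suc (2 ℕ.* suc (k ℕ.* (1 ℕ.+ k ℕ.+ 2 ℕ.* k ℕ.* n)))     ≤⟨ s≤s (ℕ.*-monoʳ-≤ 2 (s≤s (ℕ.*-monoʳ-≤ k inner))) ⟩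
      suc (2 ℕ.* suc (k ℕ.* (2 ℕ.* k ℕ.* k)))                 ≡⟨ solve 1 (λ k → con 1 :+ con 2 :* (con 1 :+ k :* (con 2 :* k :* k)) := con 3 :* con 1 :+ con 4 :* (k :* k :* k)) refl k ⟩
      3 ℕ.* 1 ℕ.+ 4 ℕ.* (k ℕ.* k ℕ.* k)                       ≤⟨ ℕ.+-monoˡ-≤ (4 ℕ.* (k ℕ.* k ℕ.* k)) (ℕ.*-mono-≤ {3} {4} (s≤s (s≤s (s≤s z≤n))) (ℕ.≤-trans 0<k k≤k³)) ⟩
      4 ℕ.* (k ℕ.* k ℕ.* k) ℕ.+ 4 ℕ.* (k ℕ.* k ℕ.* k)         ≡⟨ ℕ.*-distribʳ-+ (k ℕ.* k ℕ.* k) 4 4 ⟨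
      8 ℕ.* (k ℕ.* k ℕ.* k)                                   ≤⟨ 8k³≤q ⟩
      q                                                       ∎
      where
      open +-*-Solver
      inner : 1 ℕ.+ k ℕ.+ 2 ℕ.* k ℕ.* n ≤ 2 ℕ.* k ℕ.* k
      inner = begin
        1 ℕ.+ k ℕ.+ 2 ℕ.* k ℕ.* n         ≤⟨ ℕ.+-monoˡ-≤ (2 ℕ.* k ℕ.* n) (ℕ.+-mono-≤ 0<k (ℕ.m≤m+n k 0)) ⟩
        2 ℕ.* k ℕ.+ 2 ℕ.* k ℕ.* n         ≡⟨ ℕ.*-suc (2 ℕ.* k) n ⟨
        2 ℕ.* k ℕ.* suc n                 ≤⟨ ℕ.*-monoʳ-≤ (2 ℕ.* k) 1+n≤k ⟩
        2 ℕ.* k ℕ.* k                     ∎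

    beats : suc n ^ copies ℕ.* 2 ^ n < k ^ copies
    beats = begin-strict
      suc n ^ copies ℕ.* 2 ^ n                                    ≡⟨ cong (ℕ._* 2 ^ n) (trans (ℕ.^-distribˡ-+-* (suc n) (2 ℕ.* r) (2 ℕ.* r)) (sym (^-distribʳ-* (2 ℕ.* r) (suc n) (suc n)))) ⟩
      (suc n ℕ.* suc n) ^ (2 ℕ.* r) ℕ.* 2 ^ n                     ≤⟨ ℕ.*-monoˡ-≤ (2 ^ n) (ℕ.^-monoˡ-≤ (2 ℕ.* r) [1+n]²≤k) ⟩
      k ^ (2 ℕ.* r) ℕ.* 2 ^ n                                     <⟨ ℕ.*-monoʳ-< (k ^ (2 ℕ.* r)) {{ℕ.m^n≢0 k (2 ℕ.* r)}} (ℕ.^-monoʳ-< 2 (s≤s (s≤s z≤n)) n<2rj) ⟩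
      k ^ (2 ℕ.* r) ℕ.* 2 ^ (j ℕ.* (2 ℕ.* r))                     ≡⟨ cong (k ^ (2 ℕ.* r) ℕ.*_) (ℕ.^-*-assoc 2 j (2 ℕ.* r)) ⟨
      k ^ (2 ℕ.* r) ℕ.* k ^ (2 ℕ.* r)                             ≡⟨ ℕ.^-distribˡ-+-* k (2 ℕ.* r) (2 ℕ.* r) ⟨
      k ^ copies                                                  ∎
      where
      n<2rj : n < j ℕ.* (2 ℕ.* r)
      n<2rj = begin-strict
        n                         <⟨ n<r[1+j] ⟩
        r ℕ.* suc j               ≤⟨ ℕ.*-monoʳ-≤ r (ℕ.+-monoˡ-≤ j (ℕ.≤-trans (ℕ.*-mono-≤ {1} {12} {1} {r} (s≤s z≤n) (s≤s z≤n)) 12r≤j)) ⟩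
        r ℕ.* (j ℕ.+ j)           ≡⟨ solve 2 (λ r j → r :* (j :+ j) := j :* (con 2 :* r)) refl r j ⟩
        j ℕ.* (2 ℕ.* r)           ∎
        where open +-*-Solver

-- Definability in the ultraproduct

unique-⊑ : ∀ {X : Set} {S l : List X} → S ⊑ l → Unique l → Unique S
unique-⊑ []          []          = []
unique-⊑ (y ∷ʳ S⊑l)  (_ ∷ u)     = unique-⊑ S⊑l u
unique-⊑ (refl ∷ S⊑l) (x∉l ∷ u)  = Sublist.All-resp-⊆ S⊑l x∉l ∷ unique-⊑ S⊑l u

module Coding (K : FiniteField) (e : ℕ) where
  open Field K
  open Parameters e

  -- The number of copies depends on `e` alone and neither on the field nor on the set, which keeps
  -- the formula uniform.
  Shatters : (Carrier × Carrier → Carrier → Bool) → Set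
  Shatters β = ∀ {n l} → Unique l → length l ≤ n → threshold ≤ n → 2 ^ n ≤ order ^ suc e →
               ∀ (s : Carrier → Bool) → ∃[ c ] (∀ {x : Carrier} → x ∈ˡ l → iff-chain β {copies} c x ≡ s x)

  shatters-by-bias : ∀ β → (∀ {n} (large : threshold ≤ n) (log-bound : 2 ^ n ≤ order ^ suc e) → ∀ {c S} → Unique (c ∷ S) → length (c ∷ S) ≤ n →
                     k {q = order} large log-bound ℕ.* ℤ.∣ correlation pairs β (c ∷ S) ∣ ≤ length pairs ℕ.* suc n) → Shatters β
  shatters-by-bias β bias {n} {l} uniq l≤n large log-bound = shatter pairs β (k {q = order} large log-bound) n copies l 0<pairs
    (λ S⊑l → bias large log-bound (unique-⊑ S⊑l uniq) (ℕ.≤-trans (Sublist.length-mono-≤ S⊑l) l≤n))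
    (ℕ.≤-<-trans (ℕ.*-monoʳ-≤ (suc n ^ copies) (ℕ.^-monoʳ-≤ 2 l≤n)) (beats {q = order} large log-bound))
    where
    0<pairs : 0 < length pairs
    0<pairs = ℕ.≤-trans (ℕ.*-mono-≤ (Frobenius.0<order K) (Frobenius.0<order K)) (ℕ.≤-reflexive (sym length-pairs))

  odd-shatters : (2≢0 : ¬ Char2 K) → Shatters (λ (y , d) x → Squares.isSquare K 2≢0 (x + d))
  odd-shatters 2≢0 = shatters-by-bias _ λ {n} large log-bound → odd-bias (k {q = order} large log-bound) n
    (ℕ.*-cancelˡ-≤ 2 (ℕ.≤-pred (ℕ.≤-trans (enough-room {q = order} large log-bound) (ℕ.≤-reflexive order≡1+2a))))
    where open Squares K 2≢0

  even-shatters : (2≡0 : Char2 K) → Shatters (ArtinSchreier.test K 2≡0)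
  even-shatters 2≡0 = shatters-by-bias _ λ {n} large log-bound → ArtinSchreier.even-bias K 2≡0 (k {q = order} large log-bound) n (2k≤q {q = order} large log-bound)

-- The formulas and their meaning in finite structures

infixr 5 _⇔̇_
_⇔̇_ : ∀ {n} → Formula ⊤ n → Formula ⊤ n → Formula ⊤ n
φ ⇔̇ ψ = (φ ∧̇ ψ) ∨̇ ((φ ⇒̇ ⊥̇) ∧̇ (ψ ⇒̇ ⊥̇))

oddTest evenTest : ∀ {n} → (x y d : Fin n) → Formula ⊤ n
oddTest  x y d = ∃̇ ((var zero ⊗ var zero) ≐ (var (suc x) ⊕ var (suc d)))
evenTest x y d = ∃̇ ((((var zero ⊗ var zero) ⊕ var zero) ⊗ (var (suc x) ⊕ var (suc d))) ≐ var (suc y))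

-- It holds iff an even number of the m tests fail.
chain : (∀ {n} → (x y d : Fin n) → Formula ⊤ n) → ∀ m {n} → Fin n → (Fin (m ℕ.* 2) → Fin n) → Formula ⊤ n
chain φ zero    x v = ⊥̇ ⇒̇ ⊥̇
chain φ (suc m) x v = φ x (v zero) (v (suc zero)) ⇔̇ chain φ m x (λ j → v (suc (suc j)))

flatten : ∀ {X : Set} {m} → Vec (X × X) m → Vec X (m ℕ.* 2)
flatten []            = []
flatten ((y , d) ∷ c) = y ∷ d ∷ flatten c

⇔-⇔ᵇ : ∀ {P Q : Set} {b c} → P ⇔ (b ≡ true) → Q ⇔ (c ≡ true) → ((P × Q) ⊎ ((P → ⊥) × (Q → ⊥))) ⇔ ((b ⇔ᵇ c) ≡ true)
⇔-⇔ᵇ {P} {Q} {b} {c} P⇔b Q⇔c = mk⇔ to from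
  where
  module P⇔b = Equivalence P⇔b
  module Q⇔c = Equivalence Q⇔c
  not-true : ∀ {b} → ¬ (b ≡ true) → b ≡ false
  not-true {true}  ¬t = contradiction refl ¬t
  not-true {false} ¬t = refl
  to : (P × Q) ⊎ ((P → ⊥) × (Q → ⊥)) → (b ⇔ᵇ c) ≡ true
  to (inj₁ (p , q))   rewrite P⇔b.to p = Q⇔c.to q
  to (inj₂ (¬p , ¬q)) rewrite not-true (¬p ∘ P⇔b.from) | not-true (¬q ∘ Q⇔c.from) = refl
  from : (b ⇔ᵇ c) ≡ true → (P × Q) ⊎ ((P → ⊥) × (Q → ⊥))
  from = go b c refl refl
    where
    go : ∀ b′ c′ → b ≡ b′ → c ≡ c′ → (b′ ⇔ᵇ c′) ≡ true → (P × Q) ⊎ ((P → ⊥) × (Q → ⊥))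
    go true  true  b≡ c≡ _ = inj₁ (P⇔b.from b≡ , Q⇔c.from c≡)
    go false false b≡ c≡ _ = inj₂ ((λ p → case trans (sym b≡) (P⇔b.to p) of λ ()) , (λ q → case trans (sym c≡) (Q⇔c.to q) of λ ()))

module FiniteStructure (K : FiniteField) (A : SubsetOf K) where
  open Field K
  open Semantics rawRing (λ (_ : ⊤) x → index x Subset.∈ A) public

  -- Finite search decides satisfaction in each factor. This supplies the counterexamples and
  -- witnesses for Łoś's theorem by computation instead of by choice.
  sat? : ∀ {n} (φ : Formula ⊤ n) ρ → Dec (Sat φ ρ)
  sat? (s ≐ t)    ρ = eval ρ s ≟ eval ρ t
  sat? (pred p t) ρ = index (eval ρ t) Subset.∈? A
  sat? ⊥̇          ρ = no id
  sat? (φ ∧̇ ψ)    ρ = sat? φ ρ ×-dec sat? ψ ρ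
  sat? (φ ∨̇ ψ)    ρ = sat? φ ρ ⊎-dec sat? ψ ρ
  sat? (φ ⇒̇ ψ)    ρ = sat? φ ρ →-dec sat? ψ ρ
  sat? (∀̇ φ)      ρ = map′ (λ none x → Dec.decidable-stable (sat? φ (x ∷ ρ)) (λ ¬s → none (x , ¬s)))
                           (λ all (x , ¬s) → ¬s (all x)) (¬? (∃? (λ x → ¬? (sat? φ (x ∷ ρ)))))
  sat? (∃̇ φ)      ρ = ∃? (λ x → sat? φ (x ∷ ρ))

  module _ {φ : ∀ {n} → (x y d : Fin n) → Formula ⊤ n} {β : Carrier × Carrier → Carrier → Bool}
    (sat-φ : ∀ {n} (ρ : Vec Carrier n) x y d → Sat (φ x y d) ρ ⇔ (β (lookup ρ y , lookup ρ d) (lookup ρ x) ≡ true)) where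

    sat-chain : ∀ m {n} (ρ : Vec Carrier n) x v (c : Vec (Carrier × Carrier) m) →
                (∀ j → lookup ρ (v j) ≡ lookup (flatten c) j) → Sat (chain φ m x v) ρ ⇔ (iff-chain β c (lookup ρ x) ≡ true)
    sat-chain zero    ρ x v []            _  = mk⇔ (λ _ → refl) (λ _ ff → ff)
    sat-chain (suc m) ρ x v ((y , d) ∷ c) eq = ⇔-⇔ᵇ
      (subst₂ (λ y d → Sat (φ x (v zero) (v (suc zero))) ρ ⇔ (β (y , d) (lookup ρ x) ≡ true)) (eq zero) (eq (suc zero)) (sat-φ ρ x (v zero) (v (suc zero))))
      (sat-chain m ρ x (λ j → v (suc (suc j))) c (λ j → eq (suc (suc j))))

  does-⇔-true : ∀ {P : Set} (P? : Dec P) → P ⇔ (does P? ≡ true)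
  does-⇔-true (yes p) = mk⇔ (λ _ → refl) (λ _ → p)
  does-⇔-true (no ¬p) = mk⇔ (λ p → contradiction p ¬p) (λ ())

  sat-oddTest : ∀ 2≢0 {n} (ρ : Vec Carrier n) x y d →
                Sat (oddTest x y d) ρ ⇔ (Squares.isSquare K 2≢0 (lookup ρ x + lookup ρ d) ≡ true)
  sat-oddTest 2≢0 ρ x y d = does-⇔-true (Squares.isSquare? K 2≢0 (lookup ρ x + lookup ρ d))

  sat-evenTest : ∀ 2≡0 {n} (ρ : Vec Carrier n) x y d →
                 Sat (evenTest x y d) ρ ⇔ (ArtinSchreier.test K 2≡0 (lookup ρ y , lookup ρ d) (lookup ρ x) ≡ true)
  sat-evenTest 2≡0 ρ x y d = does-⇔-true (ArtinSchreier.test? K 2≡0 (lookup ρ y) (lookup ρ d) (lookup ρ x))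

members : ∀ {n} → Subset.Subset n → List (Fin n)
members []                   = []
members (Subset.inside  ∷ p) = zero ∷ map suc (members p)
members (Subset.outside ∷ p) = map suc (members p)

length-members : ∀ {n} (p : Subset.Subset n) → length (members p) ≡ ∣ p ∣
length-members []                   = refl
length-members (Subset.inside  ∷ p) = cong suc (trans (List.length-map suc (members p)) (length-members p))
length-members (Subset.outside ∷ p) = trans (List.length-map suc (members p)) (length-members p)

∈-members : ∀ {n x} {p : Subset.Subset n} → x Subset.∈ p → x ∈ˡ members p
∈-members {p = Subset.inside  ∷ p} Vec.here        = here refl
∈-members {p = Subset.inside  ∷ p} (Vec.there x∈p) = there (Mem.∈-map⁺ suc (∈-members x∈p))
∈-members {p = Subset.outside ∷ p} (Vec.there x∈p) = Mem.∈-map⁺ suc (∈-members x∈p)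

members-unique : ∀ {n} (p : Subset.Subset n) → Unique (members p)
members-unique []                   = []
members-unique (Subset.inside  ∷ p) = All.map⁺ (All.tabulate (λ _ ())) ∷ Unique.map⁺ Fin.suc-injective (members-unique p)
members-unique (Subset.outside ∷ p) = Unique.map⁺ Fin.suc-injective (members-unique p)

-- Łoś's theorem and transfer to the ultraproduct

module Łoś {I : Set} (𝓤 : Ultrafilter I) (K : I → FiniteField) (A : ∀ i → SubsetOf (K i)) where
  open Ultrafilter 𝓤 using (large-⊆; large-∩; ¬large-∅; large-or-∁)
  module 𝕂 i = Field (K i)
  module 𝕊 i = FiniteStructure (K i) (A i)

  F : RawRing 0ℓ 0ℓ
  F = ultraproduct 𝓤 K

  |F| : Set
  |F| = RawRing.Carrier F

  A* : Pred |F| 0ℓ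
  A* = ultraproductSubset 𝓤 K A

  module 𝔽 = Semantics F (λ (_ : ⊤) → A*)

  at : ∀ i {n} → Vec |F| n → Vec (𝕂.Carrier i) n
  at i = Vec.map (λ x → x i)

  eval-at : ∀ {n} (t : Term n) ρ i → 𝔽.eval ρ t i ≡ 𝕊.eval i (at i ρ) t
  eval-at (var x) ρ i = sym (Vec.lookup-map x (λ x → x i) ρ)
  eval-at (s ⊕ t) ρ i = cong₂ (𝕂._+_ i) (eval-at s ρ i) (eval-at t ρ i)
  eval-at (s ⊗ t) ρ i = cong₂ (𝕂._*_ i) (eval-at s ρ i) (eval-at t ρ i)
  eval-at (⊖ t)   ρ i = cong (𝕂.-_ i) (eval-at t ρ i)
  eval-at 𝟎       ρ i = refl
  eval-at 𝟏       ρ i = refl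

  witness : ∀ {i} {P : 𝕂.Carrier i → Set} → Dec (∃ P) → 𝕂.Carrier i
  witness     (yes (x , _)) = x
  witness {i} (no _)        = 𝕂.0# i

  witness-correct : ∀ {i} {P : 𝕂.Carrier i → Set} (d : Dec (∃ P)) → ∃ P → P (witness {i} d)
  witness-correct (yes (_ , p)) _ = p
  witness-correct (no none)     p = contradiction p none

  -- The two directions are mutually recursive because an implication reverses the direction for its
  -- premise.
  łoś→ : ∀ {n} (φ : Formula ⊤ n) ρ → 𝔽.Sat φ ρ → Large 𝓤 (λ i → 𝕊.Sat i φ (at i ρ))
  łoś← : ∀ {n} (φ : Formula ⊤ n) ρ → Large 𝓤 (λ i → 𝕊.Sat i φ (at i ρ)) → 𝔽.Sat φ ρ

  łoś→ (s ≐ t)    ρ h = large-⊆ (λ {i} eq → trans (sym (eval-at s ρ i)) (trans eq (eval-at t ρ i))) h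
  łoś→ (pred p t) ρ h = large-⊆ (λ {i} → subst (λ x → 𝕂.index i x Subset.∈ A i) (eval-at t ρ i)) h
  łoś→ (φ ∧̇ ψ)    ρ (h , h′) = large-∩ (łoś→ φ ρ h) (łoś→ ψ ρ h′)
  łoś→ (φ ∨̇ ψ)    ρ (inj₁ h) = large-⊆ inj₁ (łoś→ φ ρ h)
  łoś→ (φ ∨̇ ψ)    ρ (inj₂ h) = large-⊆ inj₂ (łoś→ ψ ρ h)
  łoś→ (φ ⇒̇ ψ)    ρ h with large-or-∁ (λ i → 𝕊.Sat i φ (at i ρ))
  ... | inj₁ large = large-⊆ (λ s _ → s) (łoś→ ψ ρ (h (łoś← φ ρ large)))
  ... | inj₂ small = large-⊆ (λ ¬s s → contradiction s ¬s) small
  -- The hypothesis is applied to the element that picks a counterexample in every factor that has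
  -- one; where even this element satisfies `φ`, there is none.
  łoś→ (∀̇ φ)      ρ h = large-⊆
    (λ {i} s y → Dec.decidable-stable (𝕊.sat? i φ (y ∷ at i ρ)) (λ ¬s → witness-correct (counterexample? i) (y , ¬s) s))
    (łoś→ φ ((λ i → witness (counterexample? i)) ∷ ρ) (h (λ i → witness (counterexample? i))))
    where
    counterexample? : ∀ i → Dec (∃[ y ] ¬ 𝕊.Sat i φ (y ∷ at i ρ))
    counterexample? i = 𝕂.∃? i (λ y → ¬? (𝕊.sat? i φ (y ∷ at i ρ)))
  łoś→ (∃̇ φ)      ρ (x , h) = large-⊆ (λ {i} s → x i , s) (łoś→ φ (x ∷ ρ) h)

  łoś← (s ≐ t)    ρ h = large-⊆ (λ {i} eq → trans (eval-at s ρ i) (trans eq (sym (eval-at t ρ i)))) h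
  łoś← (pred p t) ρ h = large-⊆ (λ {i} → subst (λ x → 𝕂.index i x Subset.∈ A i) (sym (eval-at t ρ i))) h
  łoś← ⊥̇          ρ h = ¬large-∅ h
  łoś← (φ ∧̇ ψ)    ρ h = łoś← φ ρ (large-⊆ proj₁ h) , łoś← ψ ρ (large-⊆ proj₂ h)
  łoś← (φ ∨̇ ψ)    ρ h with large-or-∁ (λ i → 𝕊.Sat i φ (at i ρ))
  ... | inj₁ large = inj₁ (łoś← φ ρ large)
  ... | inj₂ small = inj₂ (łoś← ψ ρ (large-⊆ (λ (¬s , s) → [ (λ s → contradiction s ¬s) , id ]′ s) (large-∩ small h)))
  łoś← (φ ⇒̇ ψ)    ρ h s = łoś← ψ ρ (large-⊆ (λ (f , s) → f s) (large-∩ h (łoś→ φ ρ s)))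
  łoś← (∀̇ φ)      ρ h x = łoś← φ (x ∷ ρ) (large-⊆ (λ {i} f → f (x i)) h)
  łoś← (∃̇ φ)      ρ h = x , łoś← φ (x ∷ ρ) (large-⊆ (λ {i} → witness-correct (𝕂.∃? i (λ y → 𝕊.sat? i φ (y ∷ at i ρ)))) h)
    where
    x : |F|
    x i = witness (𝕂.∃? i (λ y → 𝕊.sat? i φ (y ∷ at i ρ)))

  elementsOf : ∀ i → List (𝕂.Carrier i)
  elementsOf i = map (𝕂.element i) (members (A i))

  length-elementsOf : ∀ i → length (elementsOf i) ≡ ∣ A i ∣
  length-elementsOf i = trans (List.length-map (𝕂.element i) (members (A i))) (length-members (A i))

  ∈-elementsOf : ∀ i {x} → 𝕂.index i x Subset.∈ A i → x ∈ˡ elementsOf i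
  ∈-elementsOf i {x} x∈A = subst (_∈ˡ elementsOf i) (𝕂.element-index i x) (Mem.∈-map⁺ (𝕂.element i) (∈-members x∈A))

  elementsOf-unique : ∀ i → Unique (elementsOf i)
  elementsOf-unique i = Unique.map⁺ (𝕂.element-injective i) (members-unique (A i))

  -- The ultrafilter decides for each listed element whether it agrees with `x` almost everywhere;
  -- when all fail, their finitely many complements meet in a large set, which contradicts the
  -- hypothesis.
  large-Any : ∀ (x : |F|) (ys : List |F|) → Large 𝓤 (λ i → Any (λ y → x i ≡ y i) ys) → Any (λ y → Large 𝓤 (λ i → x i ≡ y i)) ys
  large-Any x []       h = contradiction (large-⊆ (λ ()) h) ¬large-∅
  large-Any x (y ∷ ys) h with large-or-∁ (λ i → x i ≡ y i)
  ... | inj₁ large = here large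
  ... | inj₂ small = there (large-Any x ys (large-⊆
    (λ { (x≢y , here x≡y) → contradiction x≡y x≢y ; (_ , there any) → any }) (large-∩ small h)))

  -- If almost all the sets had fewer than n elements, the n functions sending i to the j-th element
  -- of `A i` would list all of `A*`.
  large-cardinality : Infinite F A* → ∀ n → Large 𝓤 (λ i → n ≤ ∣ A i ∣)
  large-cardinality infinite n with large-or-∁ (λ i → n ≤ ∣ A i ∣)
  ... | inj₁ large = large
  ... | inj₂ small = contradiction (applyUpTo entry n , λ x x∈A* → large-Any x (applyUpTo entry n)
    (large-⊆ (λ {i} (A<n , xᵢ∈A) → listed i {x} (ℕ.<⇒≤ (ℕ.≰⇒> A<n)) xᵢ∈A) (large-∩ small x∈A*))) infinite
    where
    nth : ∀ {X : Set} → X → List X → ℕ → X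
    nth d []       _       = d
    nth d (x ∷ xs) zero    = x
    nth d (x ∷ xs) (suc j) = nth d xs j
    entry : ℕ → |F|
    entry j i = nth (𝕂.0# i) (elementsOf i) j
    position : ∀ {X : Set} {x d : X} {xs} → x ∈ˡ xs → ∃[ j ] (j < length xs × x ≡ nth d xs j)
    position (here refl)  = 0 , s≤s z≤n , refl
    position (there x∈xs) = let j , j<l , eq = position x∈xs in suc j , s≤s j<l , eq
    listed : ∀ i {x : |F|} → ∣ A i ∣ ≤ n → 𝕂.index i (x i) Subset.∈ A i → Any (λ y → x i ≡ y i) (applyUpTo entry n)
    listed i {x} A≤n x∈A = let j , j<l , eq = position {d = 𝕂.0# i} (∈-elementsOf i x∈A) in
      Any.applyUpTo⁺ entry eq (ℕ.<-≤-trans j<l (ℕ.≤-trans (ℕ.≤-reflexive (length-elementsOf i)) A≤n))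

  module Definability (e : ℕ) (Char : I → Set) (char? : ∀ i → Dec (Char i)) (char : Large 𝓤 Char)
    (φ : ∀ {n} → (x y d : Fin n) → Formula ⊤ n)
    (β : ∀ i → Char i → 𝕂.Carrier i × 𝕂.Carrier i → 𝕂.Carrier i → Bool)
    (sat-φ : ∀ i p {n} (ρ : Vec (𝕂.Carrier i) n) x y d → 𝕊.Sat i (φ x y d) ρ ⇔ (β i p (lookup ρ y , lookup ρ d) (lookup ρ x) ≡ true))
    (shatters : ∀ i p → Coding.Shatters (K i) e (β i p))
    (infinite : Infinite F A*)
    (small : Large 𝓤 (λ i → 2 ^ ∣ A i ∣ ≤ 𝕂.order i ^ suc e)) where

    open Parameters e using (copies; threshold)

    -- The chain realises the prescribed pattern on `A` only, so membership in `A` is added as a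
    -- conjunct.
    θ : RingFormulaWithPredicate (suc (copies ℕ.* 2))
    θ = pred tt (var zero) ∧̇ chain φ copies zero suc

    Good : I → Set
    Good i = Char i × threshold ≤ ∣ A i ∣ × 2 ^ ∣ A i ∣ ≤ 𝕂.order i ^ suc e

    good? : ∀ i → Dec (Good i)
    good? i = char? i ×-dec (threshold ℕ.≤? ∣ A i ∣ ×-dec 2 ^ ∣ A i ∣ ℕ.≤? 𝕂.order i ^ suc e)

    good : Large 𝓤 Good
    good = large-∩ char (large-∩ (large-cardinality infinite threshold) small)

    module _ (E : ∀ i → SubsetOf (K i)) where

      InE : ∀ i → 𝕂.Carrier i → Set
      InE i x = 𝕂.index i x Subset.∈ E i

      inE? : ∀ i x → Dec (InE i x)
      inE? i x = 𝕂.index i x Subset.∈? E i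

      -- In each good factor the sign pattern is the characteristic function of `E i`, and
      -- shattering supplies a tuple that realises it on `A i`.
      code : ∀ i → Dec (Good i) → Vec (𝕂.Carrier i × 𝕂.Carrier i) copies
      code i (yes (p , large , log-bound)) = proj₁ (shatters i p (elementsOf-unique i) (ℕ.≤-reflexive (length-elementsOf i)) large log-bound (does ∘ inE? i))
      -- An arbitrary value: the factors that are not `Good` lie outside a large set.
      code i (no _)                        = Vec.replicate copies (𝕂.0# i , 𝕂.0# i)

      code-correct : ∀ i (g : Dec (Good i)) → Good i → ∀ x →
                     𝕊.Sat i θ (x ∷ flatten (code i g)) ⇔ (𝕂.index i x Subset.∈ A i × InE i x)
      code-correct i (no ¬g) g x = contradiction g ¬g
      code-correct i (yes g@(p , large , log-bound)) _ x = mk⇔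
        (λ (x∈A , s) → x∈A , Equivalence.from (𝕊.does-⇔-true i (inE? i x)) (trans (sym (agrees x∈A)) (Equivalence.to chain⇔ s)))
        (λ (x∈A , x∈E) → x∈A , Equivalence.from chain⇔ (trans (agrees x∈A) (Equivalence.to (𝕊.does-⇔-true i (inE? i x)) x∈E)))
        where
        c = code i (yes g)
        agrees : 𝕂.index i x Subset.∈ A i → iff-chain (β i p) c x ≡ does (inE? i x)
        agrees x∈A = proj₂ (shatters i p (elementsOf-unique i) (ℕ.≤-reflexive (length-elementsOf i)) large log-bound (does ∘ inE? i)) (∈-elementsOf i x∈A)
        chain⇔ : 𝕊.Sat i (chain φ copies zero suc) (x ∷ flatten c) ⇔ (iff-chain (β i p) c x ≡ true)
        chain⇔ = 𝕊.sat-chain i {φ} (sat-φ i p) copies (x ∷ flatten c) zero suc c (λ j → refl)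

      parameters : Vec |F| (copies ℕ.* 2)
      parameters = Vec.tabulate (λ j i → lookup (flatten (code i (good? i))) j)

      at-parameters : ∀ i → at i parameters ≡ flatten (code i (good? i))
      at-parameters i = trans (sym (Vec.tabulate-∘ (λ x → x i) (λ j i → lookup (flatten (code i (good? i))) j))) (Vec.tabulate∘lookup _)

      defines : ∀ a → 𝔽.Sat θ (a ∷ parameters) ⇔ (a ∈ A* × a ∈ ultraproductSubset 𝓤 K E)
      defines a = mk⇔
        (λ s → let both = large-⊆ (λ {i} (g , s) → Equivalence.to (code-correct i (good? i) g (a i)) (subst (λ c → 𝕊.Sat i θ (a i ∷ c)) (at-parameters i) s))
                                   (large-∩ good (łoś→ θ (a ∷ parameters) s)) in
               large-⊆ proj₁ both , large-⊆ proj₂ both)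
        (λ (a∈A , a∈E) → łoś← θ (a ∷ parameters) (large-⊆
          (λ {i} (g , both) → subst (λ c → 𝕊.Sat i θ (a i ∷ c)) (sym (at-parameters i)) (Equivalence.from (code-correct i (good? i) g (a i)) both))
          (large-∩ good (large-∩ a∈A a∈E))))

    uniformly-definable : ∀ (E : Pred |F| 0ℓ) → Internal 𝓤 K E → E ⊆ A* →
                          Σ[ c ∈ Vec |F| (copies ℕ.* 2) ] (∀ a → a ∈ E ⇔ ⟨ F , A* ⟩⊨ θ [ a ∷ c ])
    uniformly-definable E (Es , E⇔Es) E⊆A* = parameters Es , λ a → mk⇔
      (λ a∈E → Equivalence.from (defines Es a) (E⊆A* a∈E , Equivalence.to (E⇔Es a) a∈E))
      (λ s → Equivalence.from (E⇔Es a) (proj₂ (Equivalence.to (defines Es a) s)))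

  char2? : ∀ i → Dec (Char2 (K i))
  char2? i = 𝕂._≟_ i _ _

  -- The ultrafilter decides whether almost all factors have characteristic two. This selects one of
  -- the two formulas before any subset `E` is given.
  internal-subsets-definable : ∀ e → Infinite F A* → Large 𝓤 (λ i → 2 ^ ∣ A i ∣ ≤ 𝕂.order i ^ suc e) →
    Σ[ m ∈ ℕ ] Σ[ θ ∈ RingFormulaWithPredicate (suc m) ]
      (∀ (E : Pred |F| 0ℓ) → Internal 𝓤 K E → E ⊆ A* →
        Σ[ c ∈ Vec |F| m ] (∀ a → a ∈ E ⇔ ⟨ F , A* ⟩⊨ θ [ a ∷ c ]))
  internal-subsets-definable e infinite small with large-or-∁ (λ i → Char2 (K i))
  ... | inj₁ even = _ , Even.θ , Even.uniformly-definable
    where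
    module Even = Definability e (λ i → Char2 (K i)) char2? even
      evenTest (λ i → ArtinSchreier.test (K i)) 𝕊.sat-evenTest (λ i → Coding.even-shatters (K i) e) infinite small
  ... | inj₂ odd = _ , Odd.θ , Odd.uniformly-definable
    where
    module Odd = Definability e (λ i → ¬ Char2 (K i)) (λ i → ¬? (char2? i)) odd
      oddTest (λ i 2≢0 (y , d) x → Squares.isSquare (K i) 2≢0 (𝕂._+_ i x d)) 𝕊.sat-oddTest (λ i → Coding.odd-shatters (K i) e) infinite small

-- The denominator only increases the left side and may be dropped. The additional factor q makes
-- the exponent a successor, even for a numerator 0, and so keeps the divisor `r` of `Parameters`
-- positive.
bounded-exponent : ∀ {C n q} r → r ∈ ℝ.upper C → 0 < q → n ≤ C ·log₂ q → 2 ^ n ≤ q ^ suc ℤ.∣ ↥ r ∣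
bounded-exponent {C} {n} {q} r r∈ 0<q n≤ = begin
  2 ^ n                      ≤⟨ ℕ.^-monoʳ-≤ 2 (ℕ.m≤m*n n (↧ₙ r)) ⟩
  2 ^ (n ℕ.* ↧ₙ r)           ≤⟨ n≤ r r∈ ⟩
  q ^ ℤ.∣ ↥ r ∣              ≤⟨ ℕ.m≤n*m (q ^ ℤ.∣ ↥ r ∣) q {{ℕ.>-nonZero 0<q}} ⟩
  q ^ suc ℤ.∣ ↥ r ∣          ∎
  where open ℕ.≤-Reasoning

theorem4p3 : (I : Set) (𝓤 : Ultrafilter I) → NonPrincipal 𝓤 →
    (K : I → FiniteField) (A : ∀ i → SubsetOf (K i)) →
    let F  = ultraproduct 𝓤 K
        |F| = RawRing.Carrier F
        A* = ultraproductSubset 𝓤 K A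
    in
    Pseudofinite F →
    Infinite F A* →
    (∃[ C ] Positive C × Large 𝓤 (λ i → ∣ A i ∣ ≤ C ·log₂ FiniteField.order (K i))) →
    Σ[ m ∈ ℕ ] Σ[ θ ∈ RingFormulaWithPredicate (suc m) ]
      (∀ (E : Pred |F| 0ℓ) → Internal 𝓤 K E → E ⊆ A* →
        Σ[ c ∈ Vec |F| m ] (∀ a → a ∈ E ⇔ ⟨ F , A* ⟩⊨ θ [ a ∷ c ]))
theorem4p3 I 𝓤 _ K A _ infinite (C , _ , log-bounded) = Łoś.internal-subsets-definable 𝓤 K A ℤ.∣ ↥ r ∣ infinite
  (Ultrafilter.large-⊆ 𝓤 (λ {i} → bounded-exponent {C} {∣ A i ∣} r r∈ (Frobenius.0<order (K i))) log-bounded)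
  where
  -- Any rational above C will do; its numerator fixes the exponent, and with it the number of
  -- copies and the formula.
  r = proj₁ (ℝ.upper-inhabited C)
  r∈ = proj₂ (ℝ.upper-inhabited C)
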